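{- For every real $\epsilon > 0$, the problem \textsc{Clique Contraction}, parameterized by the solution size $k$ (with optimization version $\mathrm{ClC}$), admits a time efficient $(1+\epsilon)$-approximate polynomial kernel with $\mathcal{O}(k^{d+1})$ vertices, where $d = \lceil 1/\epsilon \rceil$.
   Context: All graphs are finite, simple and undirected. For $F\subseteq E(G)$, $G/F$ is the (simple) graph obtained from $G$ by contracting all edges of $F$ (equivalently, contracting each connected component of $(V(G),F)$ to a single vertex and removing loops and parallel edges). \textsc{Clique Contraction}: given a graph $G$ and a positive integer $k$, decide whether there is $F\subseteq E(G)$ with $|F|\le k$ such that $G/F$ is a clique (complete graph). Input graphs are assumed to be connected. The parameterized optimization version is the minimization problem whose solutions for $(G,k)$ are sets $F\subseteq E(G)$ with value $$\mathrm{ClC}(G,k,F)=\min\{|F|,k+1\}\ \text{ if } G/F \text{ is a clique, and } \infty \text{ otherwise},$$ and $\mathrm{OPT}(G,k)=\min_{F}\mathrm{ClC}(G,k,F)$. For a parameterized minimization problem $\Pi$ (value function $\Pi(I,k,S)$, optimum $\mathrm{OPT}(I,k)$) and real $\alpha\ge 1$, an $\alpha$-approximate polynomial-time preprocessing algorithm is a pair of polynomial-time algorithms: a reduction algorithm that maps an instance $(I,k)$ to an instance $(I',k')$ of $\Pi$; and a solution lifting algorithm that, given $(I,k)$, $(I',k')$ and a solution $S'$ to $(I',k')$, computes a solution $S$ to $(I,k)$ with $$\frac{\Pi(I,k,S)}{\mathrm{OPT}(I,k)}\le \alpha\cdot\frac{\Pi(I',k',S')}{\mathrm{OPT}(I',k')}.$$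 It is an $\alpha$-approximate kernel if in addition the size of $I'$ and $k'$ are bounded by a function of $k$ only; it is polynomial if this bound is polynomial in $k$. It is time efficient if the running time is polynomial in the input size with the exponent of the polynomial being independent of $\epsilon$. The kernel "has $\mathcal{O}(k^{d+1})$ vertices" if the output graph has $\mathcal{O}(k^{d+1})$ vertices, where the hidden constant may depend on $\epsilon$ only. -}

module Defs where

open import Data.Bool.Base using (Bool; true; false; T)
open import Data.Bool.Properties using (T?)
open import Data.Empty using (⊥)
open import Data.Fin.Base using (Fin)
open import Data.Fin.Properties using () renaming (_<?_ to _<ᶠ?_)
open import Data.Integer.Base using (+_)
open import Data.List.Base using (List; []; _∷_; length; filter; allFin; cartesianProduct; tabulate)
open import Data.Nat.Base using (ℕ; zero; suc; _+_; _*_; _^_; _≤_; _⊓_; NonZero)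
open import Data.Product.Base using (∃; ∃-syntax; _×_; _,_; proj₁)
open import Data.Rational.Base as ℚ using (ℚ; 0ℚ; 1ℚ)
import Data.Rational.Properties as ℚ
open import Data.Sum.Base using (_⊎_)
open import Data.Unit.Base using (⊤)
open import Level using (0ℓ)
open import Relation.Binary.Bundles using (Setoid)
open import Relation.Binary.Construct.Add.Supremum.NonStrict _≤_ using (_≤⁺_)
open import Relation.Binary.Construct.Closure.ReflexiveTransitive using (Star; ε; _◅◅_; reverse)
open import Relation.Binary.PropositionalEquality
  using (_≡_; sym; trans; subst)
open import Relation.Nullary.Construct.Add.Supremum using (_⁺; ⊤⁺; [_])
open import Relation.Nullary.Decidable.Core using (_×-dec_)
open import Relation.Nullary.Negation.Core using (¬_)

------------------------------------------------------------------------
-- Real numbers, as located two-sided Dedekind cuts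

record ℝ : Set₁ where
  field
    lower upper     : ℚ → Set
    lower-inhabited : ∃ lower
    upper-inhabited : ∃ upper
    lower-down      : ∀ {p q} → p ℚ.< q → lower q → lower p
    lower-open      : ∀ {p} → lower p → ∃[ q ] (p ℚ.< q × lower q)
    upper-up        : ∀ {p q} → p ℚ.< q → upper p → upper q
    upper-open      : ∀ {q} → upper q → ∃[ p ] (p ℚ.< q × upper p)
    disjoint        : ∀ {q} → lower q → ¬ upper q
    located         : ∀ {p q} → p ℚ.< q → lower p ⊎ upper q

open ℝ public

Positive : ℝ → Set
Positive x = lower x 0ℚ

private
  +1-1 : ∀ q → (q ℚ.+ 1ℚ) ℚ.- 1ℚ ≡ q
  +1-1 q = trans (ℚ.+-assoc q 1ℚ (ℚ.- 1ℚ)) (ℚ.+-identityʳ q)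

  -1+1 : ∀ q → (q ℚ.- 1ℚ) ℚ.+ 1ℚ ≡ q
  -1+1 q = trans (ℚ.+-assoc q (ℚ.- 1ℚ) 1ℚ) (ℚ.+-identityʳ q)

  -1-mono : ∀ {p q} → p ℚ.< q → p ℚ.- 1ℚ ℚ.< q ℚ.- 1ℚ
  -1-mono = ℚ.+-monoˡ-< (ℚ.- 1ℚ)

1+_ : ℝ → ℝ
1+ x = record
  { lower           = λ q → lower x (q ℚ.- 1ℚ)
  ; upper           = λ q → upper x (q ℚ.- 1ℚ)
  ; lower-inhabited = let (q , l) = lower-inhabited x in
                      q ℚ.+ 1ℚ , subst (lower x) (sym (+1-1 q)) l
  ; upper-inhabited = let (q , u) = upper-inhabited x in
                      q ℚ.+ 1ℚ , subst (upper x) (sym (+1-1 q)) u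
  ; lower-down      = λ p<q → lower-down x (-1-mono p<q)
  ; lower-open      = λ {p} l → let (q , p-1<q , l′) = lower-open x l in
                      q ℚ.+ 1ℚ
                      , subst (ℚ._< q ℚ.+ 1ℚ) (-1+1 p) (ℚ.+-monoˡ-< 1ℚ p-1<q)
                      , subst (lower x) (sym (+1-1 q)) l′
  ; upper-up        = λ p<q → upper-up x (-1-mono p<q)
  ; upper-open      = λ {q} u → let (p , p<q-1 , u′) = upper-open x u in
                      p ℚ.+ 1ℚ
                      , subst (p ℚ.+ 1ℚ ℚ.<_) (-1+1 q) (ℚ.+-monoˡ-< 1ℚ p<q-1)
                      , subst (upper x) (sym (+1-1 p)) u′
  ; disjoint        = disjoint x
  ; located         = λ p<q → located x (-1-mono p<q)
  }

-- d - 1 < 1/x ≤ d for x > 0, with the denominator cleared: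
-- 1 ≤ d · x  and  (d - 1) · x < 1, both read off from the rationals above x.
_≡⌈1/_⌉ : ℕ → ℝ → Set
d ≡⌈1/ x ⌉ =
    (∀ r → upper x r → 1ℚ ℚ.≤ (+ d ℚ./ 1) ℚ.* r)
  × (∃[ r ] (upper x r × (+ d ℚ./ 1 ℚ.- 1ℚ) ℚ.* r ℚ.< 1ℚ))

------------------------------------------------------------------------
-- Ratios of values in ℕ ∪ {∞}

-- A positive value over the optimum 0 has ratio ∞; an optimal value has
-- ratio 1, also when the optimum is 0 (or ∞).
ratio : ℕ ⁺ → ℕ ⁺ → ℚ ⁺
ratio ⊤⁺        ⊤⁺          = [ 1ℚ ]
ratio [ v ]     ⊤⁺          = [ 0ℚ ]
ratio ⊤⁺        [ o ]       = ⊤⁺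
ratio [ zero  ] [ zero ]    = [ 1ℚ ]
ratio [ suc v ] [ zero ]    = ⊤⁺
ratio [ v ]     [ o@(suc _) ] = [ + v ℚ./ o ]

-- p ≤ α · q for q ≥ 0, where α · q is the infimum of r · q over rationals r > α.
_≤_·_ : ℚ ⁺ → ℝ → ℚ ⁺ → Set
x     ≤ α · ⊤⁺    = ⊤
⊤⁺    ≤ α · [ q ] = ⊥
[ p ] ≤ α · [ q ] = ∀ r → upper α r → p ℚ.≤ r ℚ.* q

------------------------------------------------------------------------
-- Algorithms: a Turing-complete language of programs on binary trees, in
-- the style of Jones' WHILE language.  The empty tree is "false".

data Tree : Set where
  leaf : Tree
  node : Tree → Tree → Tree

size : Tree → ℕ
size leaf       = 1
size (node s t) = 1 + size s + size t

hd tl : Tree → Tree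
hd leaf       = leaf
hd (node s _) = s
tl leaf       = leaf
tl (node _ t) = t

data Prog : Set where
  idᵖ nilᵖ hdᵖ tlᵖ : Prog
  _⨾_              : Prog → Prog → Prog
  consᵖ            : Prog → Prog → Prog
  ifᵖ              : Prog → Prog → Prog → Prog
  whileᵖ           : Prog → Prog → Prog

-- p ⊢ x ⇓ y [ t ]: on input x, p halts with output y in time t.  A step is
-- charged the size of the tree it acts on rather than unit cost, so size y ≤ t
-- and sharing of subtrees cannot hide exponentially large values; t is
-- polynomially related to Turing machine time.
data _⊢_⇓_[_] : Prog → Tree → Tree → ℕ → Set where
  ⇓id         : ∀ {x} → idᵖ  ⊢ x ⇓ x    [ size x ]
  ⇓nil        : ∀ {x} → nilᵖ ⊢ x ⇓ leaf [ size x ]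
  ⇓hd         : ∀ {x} → hdᵖ  ⊢ x ⇓ hd x [ size x ]
  ⇓tl         : ∀ {x} → tlᵖ  ⊢ x ⇓ tl x [ size x ]
  ⇓seq        : ∀ {p q x y z s t} →
                p ⊢ x ⇓ y [ s ] → q ⊢ y ⇓ z [ t ] →
                (p ⨾ q) ⊢ x ⇓ z [ s + t ]
  ⇓cons       : ∀ {p q x y z s t} →
                p ⊢ x ⇓ y [ s ] → q ⊢ x ⇓ z [ t ] →
                consᵖ p q ⊢ x ⇓ node y z [ size x + s + t ]
  ⇓if-true    : ∀ {b p q x u v y s t} →
                b ⊢ x ⇓ node u v [ s ] → p ⊢ x ⇓ y [ t ] →
                ifᵖ b p q ⊢ x ⇓ y [ size x + s + t ]
  ⇓if-false   : ∀ {b p q x y s t} →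
                b ⊢ x ⇓ leaf [ s ] → q ⊢ x ⇓ y [ t ] →
                ifᵖ b p q ⊢ x ⇓ y [ size x + s + t ]
  ⇓while-stop : ∀ {b p x s} →
                b ⊢ x ⇓ leaf [ s ] →
                whileᵖ b p ⊢ x ⇓ x [ size x + s ]
  ⇓while-step : ∀ {b p x u v y z s t w} →
                b ⊢ x ⇓ node u v [ s ] → p ⊢ x ⇓ y [ t ] →
                whileᵖ b p ⊢ y ⇓ z [ w ] →
                whileᵖ b p ⊢ x ⇓ z [ size x + s + t + w ]

_⊢_⇓_within_ : Prog → Tree → Tree → ℕ → Set
p ⊢ x ⇓ y within T = ∃[ t ] (p ⊢ x ⇓ y [ t ] × t ≤ T)

-- Unary, as the size of a parameterized instance (I , k) is |I| + k.
encodeℕ : ℕ → Tree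
encodeℕ zero    = leaf
encodeℕ (suc n) = node leaf (encodeℕ n)

encodeBool : Bool → Tree
encodeBool false = leaf
encodeBool true  = node leaf leaf

encodeList : List Tree → Tree
encodeList []       = leaf
encodeList (t ∷ ts) = node t (encodeList ts)

------------------------------------------------------------------------
-- Parameterized minimization problems and approximate kernels

record ParamMinProblem : Set₁ where
  field
    Instance       : Set
    param          : Instance → ℕ
    encode         : Instance → Tree
    Solution       : Instance → Set
    encodeSolution : ∀ I → Solution I → Tree
    -- The graph of the value function.
    HasValue       : ∀ I → Solution I → ℕ ⁺ → Set

  IsOPT : Instance → ℕ ⁺ → Set
  IsOPT I o = (∃[ S ] HasValue I S o)
            × (∀ S v → HasValue I S v → o ≤⁺ v)

module _ (Π : ParamMinProblem) where
  open ParamMinProblem Π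

  -- Both algorithms run in time C · (input size) ^ c.
  record ApproxPreprocessing (α : ℝ) (c : ℕ) : Set where
    field
      reduceProg liftProg : Prog
      reduce : Instance → Instance
      lift   : ∀ I → Solution (reduce I) → Solution I
      C      : ℕ

    liftInput : ∀ I → Solution (reduce I) → Tree
    liftInput I S′ =
      node (encode I) (node (encode (reduce I)) (encodeSolution (reduce I) S′))

    field
      reduce-runs : ∀ I →
        reduceProg ⊢ encode I ⇓ encode (reduce I) within (C * size (encode I) ^ c)
      lift-runs : ∀ I S′ →
        liftProg ⊢ liftInput I S′ ⇓ encodeSolution I (lift I S′)
          within (C * size (liftInput I S′) ^ c)
      approximates : ∀ I S′ {v o v′ o′} →
        HasValue I (lift I S′) v → IsOPT I o →
        HasValue (reduce I) S′ v′ → IsOPT (reduce I) o′ →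
        ratio v o ≤ α · ratio v′ o′

  record PolynomialApproxKernel (α : ℝ) (c : ℕ) : Set where
    field
      preprocessing : ApproxPreprocessing α c
    open ApproxPreprocessing preprocessing public
    field
      B e       : ℕ
      size-poly : ∀ I → size (encode (reduce I)) + param (reduce I) ≤ B * suc (param I) ^ e

------------------------------------------------------------------------
-- Finite simple graphs

record Graph (n : ℕ) : Set where
  field
    adj        : Fin n → Fin n → Bool
    adj-sym    : ∀ u v → adj u v ≡ adj v u
    adj-irrefl : ∀ v → adj v v ≡ false

  Adj : Fin n → Fin n → Set
  Adj u v = T (adj u v)

  Adj-sym : ∀ {u v} → Adj u v → Adj v u
  Adj-sym {u} {v} = subst T (adj-sym u v)

  Reachable : Fin n → Fin n → Set
  Reachable = Star Adj

  edges : List (Fin n × Fin n)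
  edges = filter (λ (u , v) → (u <ᶠ? v) ×-dec T? (adj u v))
                 (cartesianProduct (allFin n) (allFin n))

open Graph public

Connected : ∀ {n} → Graph n → Set
Connected {n} G = NonZero n × (∀ u v → Reachable G u v)

encodeGraph : ∀ {n} → Graph n → Tree
encodeGraph G =
  encodeList (tabulate λ u → encodeList (tabulate λ v → encodeBool (adj G u v)))

-- F ⊆ E(G), represented by the spanning subgraph (V(G) , F).
record EdgeSet {n} (G : Graph n) : Set where
  field
    subgraph : Graph n
    included : ∀ {u v} → Adj subgraph u v → Adj G u v

open EdgeSet public

∣_∣ᵉ : ∀ {n} {G : Graph n} → EdgeSet G → ℕ
∣ F ∣ᵉ = length (edges (subgraph F))

-- Simple graphs whose vertices are the classes of an equivalence relation.
record QuotientGraph : Set₁ where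
  field
    vertices : Setoid 0ℓ 0ℓ
  open Setoid vertices public using (_≈_) renaming (Carrier to Vertex)
  field
    _~_      : Vertex → Vertex → Set
    ~-resp   : ∀ {u u′ v v′} → u ≈ u′ → v ≈ v′ → u ~ v → u′ ~ v′
    ~-sym    : ∀ {u v} → u ~ v → v ~ u
    ~-irrefl : ∀ {u v} → u ≈ v → ¬ (u ~ v)

  IsClique : Set
  IsClique = ∀ u v → ¬ (u ≈ v) → u ~ v

-- The vertices of G / F are the connected components of (V(G) , F).
_/_ : ∀ {n} (G : Graph n) → EdgeSet G → QuotientGraph
_/_ {n} G F = record
  { vertices = record
    { Carrier       = Fin n
    ; _≈_           = _≋_
    ; isEquivalence = record { refl = ε ; sym = ≋-sym ; trans = _◅◅_ }
    }
  ; _~_      = λ u v → ¬ (u ≋ v) × ∃[ a ] ∃[ b ] (u ≋ a × v ≋ b × Adj G a b)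
  ; ~-resp   = λ p q (u≉v , a , b , r , s , ab) →
      (λ u′≋v′ → u≉v (p ◅◅ u′≋v′ ◅◅ ≋-sym q)) ,
      a , b , ≋-sym p ◅◅ r , ≋-sym q ◅◅ s , ab
  ; ~-sym    = λ (u≉v , a , b , r , s , ab) →
      (λ v≋u → u≉v (≋-sym v≋u)) , b , a , s , r , Adj-sym G ab
  ; ~-irrefl = λ u≋v u~v → proj₁ u~v u≋v
  }
  where
  _≋_ : Fin n → Fin n → Set
  _≋_ = Reachable (subgraph F)

  ≋-sym : ∀ {u v} → u ≋ v → v ≋ u
  ≋-sym = reverse (Adj-sym (subgraph F))

------------------------------------------------------------------------
-- Clique Contraction

record CCInstance : Set where
  field
    order     : ℕ
    graph     : Graph order
    connected : Connected graph
    k         : ℕ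
    k-pos     : NonZero k

data ClC {n} (G : Graph n) (k : ℕ) (F : EdgeSet G) : ℕ ⁺ → Set where
  clique     : QuotientGraph.IsClique (G / F) → ClC G k F [ ∣ F ∣ᵉ ⊓ suc k ]
  not-clique : ¬ QuotientGraph.IsClique (G / F) → ClC G k F ⊤⁺

CliqueContraction : ParamMinProblem
CliqueContraction = record
  { Instance       = CCInstance
  ; param          = k
  ; encode         = λ I → node (encodeGraph (graph I)) (encodeℕ (k I))
  ; Solution       = λ I → EdgeSet (graph I)
  ; encodeSolution = λ I F → encodeGraph (subgraph F)
  ; HasValue       = λ I → ClC (graph I) (k I)
  }
  where open CCInstance

-- Call a vertex heavy if more than K = 2k + 1 vertices (itself included) are not adjacent to it, and quiet if it
-- is light and adjacent to all other light vertices.  A solution with at most k edges touches fewer than K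
-- vertices, and the untouched ones form a clique; so every heavy vertex is touched, and there are fewer than K heavy
-- vertices and fewer than K² vertices that are neither heavy nor quiet, or else the optimum exceeds k.  The kernel is
-- the subgraph induced by the non-quiet vertices, the first K quiet neighbours of every heavy vertex, and, for every
-- tuple A of at most d heavy vertices, the first K quiet vertices not adjacent to A.
--
-- The optimum does not grow: an edge from a kept vertex x to a deleted one is replaced by an edge from x to a kept quiet
-- neighbour of x that the solution does not touch.  Conversely, a component of a solution of the kernel can fail to
-- be adjacent to a deleted vertex only if it has more than d vertices, all heavy.  Lifting adds one edge from
-- every such component to a quiet vertex; as the component has at least d edges, this costs a factor 1 + 1/d ≤ 1 + ε.
--
-- The tuples are enumerated only until they outnumber the vertices, in which case the instance is already small and
-- nothing is deleted.  This makes the running time polynomial in the input and d together, so that the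
-- exponent does not depend on ε.
module Submission where

open import Data.Bool.Base using (Bool; true; false; T; not; _∧_; _∨_; if_then_else_)
open import Data.Bool.Properties using (T?)
open import Data.Empty using (⊥-elim)
open import Data.Fin.Base using (Fin; zero; suc)
open import Data.Fin.Base as Fin using (toℕ)
import Data.Fin.Properties as Fin
open import Data.List.Base using (List; []; _∷_; length; map; foldl; foldr; _++_; reverse; tabulate; allFin; replicate; filterᵇ; lookup; cartesianProductWith; filter; cartesianProduct)
open import Data.List.Membership.Propositional using (_∈_)
open import Data.List.Membership.Propositional.Properties using (∈-allFin; ∈-filter⁺; ∈-filter⁻; ∈-cartesianProduct⁺; ∈-cartesianProductWith⁺; ∈-++⁺ˡ; ∈-++⁺ʳ; ∈-lookup)
import Data.List.Properties as List
open import Data.List.Relation.Unary.All using (All; []; _∷_)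
import Data.List.Relation.Unary.All as All
open import Data.List.Relation.Unary.AllPairs using ([]; _∷_)
open import Data.List.Relation.Unary.Any using (here; there; index)
open import Data.List.Relation.Unary.Any.Properties using (lookup-index)
open import Data.List.Relation.Unary.Unique.Propositional using (Unique)
import Data.List.Relation.Unary.Unique.Propositional.Properties as Unique
open import Data.Nat.Base using (ℕ; zero; suc; pred; _+_; _*_; _^_; _∸_; _≤_; _<_; _<ᵇ_; z≤n; s≤s; NonZero; >-nonZero; s≤s⁻¹; _⊓_)
open import Data.Nat.Properties
open import Data.Product.Base using (Σ; Σ-syntax; ∃; ∃-syntax; _×_; _,_; proj₁; proj₂)
open import Data.Sum.Base using (_⊎_; inj₁; inj₂)
open import Data.Unit.Base using (⊤; tt)
open import Defs
open import Function.Base using (_∘_; flip; id)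
open import Relation.Binary using (tri<; tri≈; tri>)
open import Relation.Binary.Construct.Closure.ReflexiveTransitive using (Star; _◅_; _◅◅_; gmap) renaming (ε to ∎ᵖ; reverse to invert)
open import Relation.Binary.PropositionalEquality using (_≡_; _≗_; refl; sym; trans; cong; cong₂; subst; module ≡-Reasoning; _≢_)
open import Relation.Nullary using (¬_; yes; no; does; Dec)
open import Relation.Nullary.Decidable using (_×-dec_)

-- Everything on the graph side rests on one principle. A solution with at most k edges cannot touch
-- K vertices, so if the first K members of a set of vertices are kept, then either the whole set is
-- kept or some kept member is untouched. An untouched vertex is a component by itself, hence
-- adjacent to every other component of a solution. Each group of kept quiet vertices is one
-- application. The empty tuple provides quiet vertices outright: they are the substitutes at light
-- vertices and, in lifting, the reason why a component of heavy vertices has an edge to a quiet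
-- vertex at all. The quiet neighbours of heavy vertices are the substitutes at heavy vertices. Both
-- groups also keep the kernel connected, as every instance has to be.
--
-- On the program side, the exponent has to be fixed before ε is given. So one program receives d in
-- unary as part of its input, and d is hard-wired only at the very end. Combinators for a relation
-- `e ⊨ o` produce a program, its time bound and its correctness proof together.

-- Polynomial bounds and a calculus of polynomial-time programs

module Programs where

  private variable
    Γ Δ : Set

  -- A bare power is enough: the base is at least 2, so constants and sums are absorbed by the
  -- exponent. A bound is thus a single number that is the same for all γ.
  record Poly (e : Γ → Tree) (f : Γ → ℕ) : Set where
    constructor _,_
    field
      degree  : ℕ
      bounded : ∀ γ → f γ ≤ suc (size (e γ)) ^ degree

  open Poly public

  size-pos : ∀ t → 1 ≤ size t
  size-pos leaf       = s≤s z≤n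
  size-pos (node _ _) = s≤s z≤n

  2≤1+size : ∀ t → 2 ≤ suc (size t)
  2≤1+size t = s≤s (size-pos t)

  private
    n≤2^n : ∀ n → n ≤ 2 ^ n
    n≤2^n zero    = z≤n
    n≤2^n (suc n) = ≤-trans (+-mono-≤ (m^n>0 2 n) (n≤2^n n)) (+-monoʳ-≤ (2 ^ n) (m≤m+n (2 ^ n) 0))

  poly-≤ : {e : Γ → Tree} {f g : Γ → ℕ} → (∀ γ → f γ ≤ g γ) → Poly e g → Poly e f
  poly-≤ f≤g (c , g≤) = c , λ γ → ≤-trans (f≤g γ) (g≤ γ)

  opaque
    poly-const : {e : Γ → Tree} (m : ℕ) → Poly e (λ _ → m)
    poly-const {e = e} m = m , λ γ → ≤-trans (n≤2^n m) (^-monoˡ-≤ m (2≤1+size (e γ)))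

  opaque
    poly-size : {e : Γ → Tree} → Poly e (size ∘ e)
    poly-size = 1 , λ γ → ≤-trans (n≤1+n _) (≤-reflexive (sym (*-identityʳ _)))

  opaque
    poly-+ : {e : Γ → Tree} {f g : Γ → ℕ} → Poly e f → Poly e g → Poly e (λ γ → f γ + g γ)
    poly-+ {e = e} {f} {g} (a , f≤) (b , g≤) = suc (a + b) , λ γ →
      let N = suc (size (e γ)) in begin
      f γ + g γ                      ≤⟨ +-mono-≤ (f≤ γ) (g≤ γ) ⟩
      N ^ a + N ^ b                  ≤⟨ +-mono-≤ (^-monoʳ-≤ N (m≤m+n a b)) (^-monoʳ-≤ N (m≤n+m b a)) ⟩
      N ^ (a + b) + N ^ (a + b)      ≤⟨ +-monoʳ-≤ (N ^ (a + b)) (m≤m+n _ 0) ⟩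
      2 * N ^ (a + b)                ≤⟨ *-monoˡ-≤ (N ^ (a + b)) (2≤1+size (e γ)) ⟩
      N ^ suc (a + b)                ∎
      where open ≤-Reasoning

  opaque
    poly-* : {e : Γ → Tree} {f g : Γ → ℕ} → Poly e f → Poly e g → Poly e (λ γ → f γ * g γ)
    poly-* {e = e} (a , f≤) (b , g≤) = a + b , λ γ →
      ≤-trans (*-mono-≤ (f≤ γ) (g≤ γ)) (≤-reflexive (sym (^-distribˡ-+-* (suc (size (e γ))) a b)))

  opaque
    poly-^ : {e : Γ → Tree} {f : Γ → ℕ} (c : ℕ) → Poly e f → Poly e (λ γ → f γ ^ c)
    poly-^ zero    p = poly-const 1
    poly-^ (suc c) p = poly-* p (poly-^ c p)

  opaque
    poly-suc : {e : Γ → Tree} {f : Γ → ℕ} → Poly e f → Poly e (suc ∘ f)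
    poly-suc = poly-+ (poly-const 1)

  opaque
    poly-∘ : {e m : Γ → Tree} {f : Γ → ℕ} → Poly e (size ∘ m) → Poly m f → Poly e f
    poly-∘ p (c , f≤) = poly-≤ f≤ (poly-^ c (poly-suc p))

  size≤time : ∀ {p x y t} → p ⊢ x ⇓ y [ t ] → size y ≤ t
  size≤time ⇓id = ≤-refl
  size≤time (⇓nil {x}) = size-pos x
  size≤time (⇓hd {leaf}) = ≤-refl
  size≤time (⇓hd {node s t}) = m≤n⇒m≤1+n (m≤m+n (size s) (size t))
  size≤time (⇓tl {leaf}) = ≤-refl
  size≤time (⇓tl {node s t}) = m≤n⇒m≤1+n (m≤n+m (size t) (size s))
  size≤time (⇓seq {s = s} _ q) = ≤-trans (size≤time q) (m≤n+m _ s)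
  size≤time (⇓cons {x = x} p q) = +-mono-≤ (+-mono-≤ (size-pos x) (size≤time p)) (size≤time q)
  size≤time (⇓if-true _ p) = ≤-trans (size≤time p) (m≤n+m _ _)
  size≤time (⇓if-false _ p) = ≤-trans (size≤time p) (m≤n+m _ _)
  size≤time (⇓while-stop _) = m≤m+n _ _
  size≤time (⇓while-step _ _ w) = ≤-trans (size≤time w) (m≤n+m _ _)

  infix 3 _⊨_

  -- One program computes o γ from e γ in time polynomial in the size of e γ,
  -- uniformly in γ; e plays the role of an environment.
  record _⊨_ {Γ : Set} (e o : Γ → Tree) : Set where
    field
      prog : Prog
      time : Γ → ℕ
      poly : Poly e time
      runs : ∀ γ → prog ⊢ e γ ⇓ o γ within time γ

  open _⊨_ public

  out-poly : {e o : Γ → Tree} → e ⊨ o → Poly e (size ∘ o)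
  out-poly f = poly-≤ (λ γ → let (t , r , t≤) = runs f γ in ≤-trans (size≤time r) t≤) (poly f)

  infixr 5 _⨟_

  opaque
    _⨟_ : {e m o : Γ → Tree} → e ⊨ m → m ⊨ o → e ⊨ o
    f ⨟ g = record
      { prog = prog f ⨾ prog g
      ; time = λ γ → time f γ + time g γ
      ; poly = poly-+ (poly f) (poly-∘ (out-poly f) (poly g))
      ; runs = λ γ → let (_ , r , r≤) = runs f γ ; (_ , s , s≤) = runs g γ in
          _ , ⇓seq r s , +-mono-≤ r≤ s≤
      }

  opaque
    ⊨-id : {e : Γ → Tree} → e ⊨ e
    ⊨-id {e = e} = record { prog = idᵖ ; time = size ∘ e ; poly = poly-size ; runs = λ γ → _ , ⇓id , ≤-refl }

  opaque
    ⊨-leaf : {e : Γ → Tree} → e ⊨ (λ _ → leaf)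
    ⊨-leaf {e = e} = record { prog = nilᵖ ; time = size ∘ e ; poly = poly-size ; runs = λ γ → _ , ⇓nil , ≤-refl }

  opaque
    ⊨-hd : {e : Γ → Tree} → e ⊨ hd ∘ e
    ⊨-hd {e = e} = record { prog = hdᵖ ; time = size ∘ e ; poly = poly-size ; runs = λ γ → _ , ⇓hd , ≤-refl }

  opaque
    ⊨-tl : {e : Γ → Tree} → e ⊨ tl ∘ e
    ⊨-tl {e = e} = record { prog = tlᵖ ; time = size ∘ e ; poly = poly-size ; runs = λ γ → _ , ⇓tl , ≤-refl }

  opaque
    ⊨-node : {e a b : Γ → Tree} → e ⊨ a → e ⊨ b → e ⊨ (λ γ → node (a γ) (b γ))
    ⊨-node {e = e} f g = record
      { prog = consᵖ (prog f) (prog g)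
      ; time = λ γ → size (e γ) + time f γ + time g γ
      ; poly = poly-+ (poly-+ poly-size (poly f)) (poly g)
      ; runs = λ γ → let (_ , r , r≤) = runs f γ ; (_ , s , s≤) = runs g γ in
          _ , ⇓cons r s , +-mono-≤ (+-monoʳ-≤ (size (e γ)) r≤) s≤
      }

  opaque
    ⊨-fst : {e a b : Γ → Tree} → e ⊨ (λ γ → node (a γ) (b γ)) → e ⊨ a
    ⊨-fst f = f ⨟ ⊨-hd

  opaque
    ⊨-snd : {e a b : Γ → Tree} → e ⊨ (λ γ → node (a γ) (b γ)) → e ⊨ b
    ⊨-snd f = f ⨟ ⊨-tl

  opaque
    ⊨-cong : {e a b : Γ → Tree} → a ≗ b → e ⊨ a → e ⊨ b
    ⊨-cong a≗b f = record
      { prog = prog f ; time = time f ; poly = poly f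
      ; runs = λ γ → subst (λ y → prog f ⊢ _ ⇓ y within time f γ) (a≗b γ) (runs f γ) }

  opaque
    ⊨-reindex : {e o : Γ → Tree} (h : Δ → Γ) → e ⊨ o → e ∘ h ⊨ o ∘ h
    ⊨-reindex h f = record
      { prog = prog f ; time = time f ∘ h ; poly = let (c , b) = poly f in c , b ∘ h ; runs = runs f ∘ h }

  ifNode : {A : Set} → Tree → A → A → A
  ifNode leaf       x y = y
  ifNode (node _ _) x y = x

  opaque
    ⊨-ifNode : {e c x y : Γ → Tree} → e ⊨ c → e ⊨ x → e ⊨ y → e ⊨ (λ γ → ifNode (c γ) (x γ) (y γ))
    ⊨-ifNode {e = e} {c = cond} {x} {y} c f g = record
      { prog = ifᵖ (prog c) (prog f) (prog g)
      ; time = λ γ → size (e γ) + time c γ + (time f γ + time g γ)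
      ; poly = poly-+ (poly-+ poly-size (poly c)) (poly-+ (poly f) (poly g))
      ; runs = λ γ → let (_ , r , r≤) = runs c γ in branch γ (cond γ) r r≤
      }
      where
      branch : ∀ γ t {s} → prog c ⊢ e γ ⇓ t [ s ] → s ≤ time c γ →
        ifᵖ (prog c) (prog f) (prog g) ⊢ e γ ⇓ ifNode t (x γ) (y γ)
          within (size (e γ) + time c γ + (time f γ + time g γ))
      branch γ (node _ _) r r≤ = let (_ , s , s≤) = runs f γ in
        _ , ⇓if-true r s , +-mono-≤ (+-monoʳ-≤ (size (e γ)) r≤) (≤-trans s≤ (m≤m+n _ _))
      branch γ leaf r r≤ = let (_ , s , s≤) = runs g γ in
        _ , ⇓if-false r s , +-mono-≤ (+-monoʳ-≤ (size (e γ)) r≤) (≤-trans s≤ (m≤n+m _ (time f γ)))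

  opaque
    ⊨-if : {e x y : Γ → Tree} {b : Γ → Bool} → e ⊨ encodeBool ∘ b → e ⊨ x → e ⊨ y →
           e ⊨ (λ γ → if b γ then x γ else y γ)
    ⊨-if {x = x} {y} {b} c f g = ⊨-cong (λ γ → eq (b γ)) (⊨-ifNode c f g)
      where
      eq : ∀ b {x y : Tree} → ifNode (encodeBool b) x y ≡ (if b then x else y)
      eq false = refl
      eq true  = refl

  -- Loops over lists

  listᴱ : {X : Set} → (X → Tree) → List X → Tree
  listᴱ a xs = encodeList (map a xs)

  length≤size : {X : Set} (a : X → Tree) (xs : List X) → length xs ≤ size (listᴱ a xs)
  length≤size a []       = z≤n
  length≤size a (x ∷ xs) = s≤s (≤-trans (length≤size a xs) (m≤n+m _ (size (a x))))

  module _ {S X : Γ → Set} {e : Γ → Tree} {s₀ : ∀ γ → S γ} {l : ∀ γ → List (X γ)}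
           {encS : ∀ γ → S γ → Tree} {a : ∀ γ → X γ → Tree}
           (step : ∀ γ → S γ → X γ → S γ) (B : Γ → ℕ) where

    private
      state : ∀ γ → S γ → List (X γ) → Tree
      state γ s xs = node (e γ) (node (encS γ s) (listᴱ (a γ) xs))

      Full : (Γ → Set) → Set
      Full Y = Σ Γ λ γ → S γ × X γ × Y γ

      opaque
        body : (λ ((γ , s , x) : Σ Γ λ γ → S γ × X γ) → node (e γ) (node (encS γ s) (a γ x)))
                 ⊨ (λ (γ , s , x) → encS γ (step γ s x)) →
               (λ ((γ , s , x , xs) : Full (List ∘ X)) → state γ s (x ∷ xs))
                 ⊨ (λ (γ , s , x , xs) → state γ (step γ s x) xs)
        body f = ⊨-node ⊨-hd (⊨-node
          (⊨-node ⊨-hd (⊨-node (⊨-tl ⨟ ⊨-hd) (⊨-tl ⨟ ⊨-tl ⨟ ⊨-hd)) ⨟ ⊨-reindex (λ (γ , s , x , _) → γ , s , x) f)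
          (⊨-tl ⨟ ⊨-tl ⨟ ⊨-tl))

      tl-size : ∀ t → size (tl t) ≤ size t
      tl-size leaf       = ≤-refl
      tl-size (node s t) = m≤n⇒m≤1+n (m≤n+m (size t) (size s))

      module Loop {p : Prog} {c : ℕ}
        (p-runs : ∀ γ s x xs → p ⊢ state γ s (x ∷ xs) ⇓ state γ (step γ s x) xs
                    within (suc (size (state γ s (x ∷ xs))) ^ c))
        (γ : Γ) (M : ℕ) where

        W : ℕ
        -- One pass: the charge of the loop itself, the guard `tlᵖ ⨾ tlᵖ` acting on two trees of
        -- size at most M, and the body.
        W = M + (M + M) + suc M ^ c

        loop : ∀ s xs → (∀ q r → q ++ r ≡ xs → size (state γ (foldl (step γ) s q) r) ≤ M) →
          whileᵖ (tlᵖ ⨾ tlᵖ) p ⊢ state γ s xs ⇓ state γ (foldl (step γ) s xs) [] within (suc (length xs) * W)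
        loop s [] h = _ , ⇓while-stop (⇓seq ⇓tl ⇓tl) ,
          ≤-trans (+-mono-≤ m (+-mono-≤ m (≤-trans (tl-size (state γ s [])) m)))
            (≤-trans (m≤m+n _ (suc M ^ c)) (m≤m+n W 0))
          where m = h [] [] refl
        loop s (x ∷ xs) h =
          let m = h [] (x ∷ xs) refl
              (_ , r , r≤) = p-runs γ s x xs
              (_ , w , w≤) = loop (step γ s x) xs (λ q r eq → h (x ∷ q) r (cong (x ∷_) eq))
          in _ , ⇓while-step (⇓seq ⇓tl ⇓tl) r w ,
             +-mono-≤ (+-mono-≤ (+-mono-≤ m (+-mono-≤ m (≤-trans (tl-size (state γ s (x ∷ xs))) m)))
                                (≤-trans r≤ (^-monoˡ-≤ c (s≤s m)))) w≤

    opaque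
      -- Environment, accumulator and remaining list travel through one while loop as a single tree.
      -- A polynomial-time step does not suffice for a polynomial-time loop, since repeated steps
      -- can double the accumulator each time; hence the hypothesis that after every prefix of the
      -- list the accumulator has size at most `B γ`.
      ⊨-foldl : e ⊨ (λ γ → encS γ (s₀ γ)) → e ⊨ (λ γ → listᴱ (a γ) (l γ)) →
        (λ ((γ , s , x) : Σ Γ λ γ → S γ × X γ) → node (e γ) (node (encS γ s) (a γ x)))
          ⊨ (λ (γ , s , x) → encS γ (step γ s x)) →
        Poly e B →
        (∀ γ q r → q ++ r ≡ l γ → size (encS γ (foldl (step γ) (s₀ γ) q)) ≤ B γ) →
        e ⊨ (λ γ → encS γ (foldl (step γ) (s₀ γ) (l γ)))
      ⊨-foldl init list f PB bound =
        ⊨-node ⊨-id (⊨-node init list) ⨟ whole ⨟ ⊨-tl ⨟ ⊨-hd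
        where
        g : (λ ((γ , s , x , xs) : Full (List ∘ X)) → state γ s (x ∷ xs))
              ⊨ (λ (γ , s , x , xs) → state γ (step γ s x) xs)
        g = body f
        c : ℕ
        c = degree (poly g)
        p-runs : ∀ γ s x xs → prog g ⊢ state γ s (x ∷ xs) ⇓ state γ (step γ s x) xs
                   within (suc (size (state γ s (x ∷ xs))) ^ c)
        p-runs γ s x xs = let (t , r , t≤) = runs g (γ , s , x , xs) in
          t , r , ≤-trans t≤ (bounded (poly g) (γ , s , x , xs))
        M : Γ → ℕ
        M γ = size (node (e γ) (node (encS γ (s₀ γ)) (listᴱ (a γ) (l γ)))) + B γ
        shorter : ∀ γ q r xs → q ++ r ≡ xs → size (listᴱ (a γ) r) ≤ size (listᴱ (a γ) xs)
        shorter γ [] r xs refl = ≤-refl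
        shorter γ (x ∷ q) r (_ ∷ xs) refl =
          m≤n⇒m≤1+n (≤-trans (shorter γ q r xs refl) (m≤n+m _ (size (a γ x))))
        fits : ∀ γ q r → q ++ r ≡ l γ → size (state γ (foldl (step γ) (s₀ γ) q) r) ≤ M γ
        fits γ q r eq = begin
          suc (E + suc (Q + R))             ≤⟨ s≤s (+-monoʳ-≤ E (s≤s (+-mono-≤ (bound γ q r eq) (shorter γ q r _ eq)))) ⟩
          suc (E + suc (B γ + L))           ≡⟨ cong (λ z → suc (E + suc z)) (+-comm (B γ) L) ⟩
          suc (E + suc (L + B γ))           ≤⟨ s≤s (+-monoʳ-≤ E (s≤s (+-monoˡ-≤ (B γ) (m≤n+m L S₀)))) ⟩
          suc (E + suc (S₀ + L + B γ))      ≡⟨ cong suc (sym (+-assoc E (suc (S₀ + L)) (B γ))) ⟩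
          M γ ∎
          where
          open ≤-Reasoning
          E S₀ L Q R : ℕ
          E = size (e γ)
          S₀ = size (encS γ (s₀ γ))
          L = size (listᴱ (a γ) (l γ))
          Q = size (encS γ (foldl (step γ) (s₀ γ) q))
          R = size (listᴱ (a γ) r)
        PM : Poly (λ γ → state γ (s₀ γ) (l γ)) M
        PM = poly-+ poly-size (poly-∘ (out-poly ⊨-hd) PB)
        module L γ = Loop {prog g} {c} p-runs γ (M γ)
        whole : (λ γ → state γ (s₀ γ) (l γ)) ⊨ (λ γ → state γ (foldl (step γ) (s₀ γ) (l γ)) [])
        whole = record
          { prog = whileᵖ (tlᵖ ⨾ tlᵖ) (prog g)
          ; time = λ γ → suc (length (l γ)) * L.W γ
          ; poly = poly-* (poly-suc (poly-≤ (λ γ → length≤size (a γ) (l γ))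
                            (out-poly {o = λ γ → listᴱ (a γ) (l γ)} (⊨-tl ⨟ ⊨-tl))))
                          (poly-+ (poly-+ PM (poly-+ PM PM)) (poly-^ c (poly-suc PM)))
          ; runs = λ γ → L.loop γ (s₀ γ) (l γ) (fits γ)
          }

-- Programs for Booleans, lists and unary arithmetic

module ListPrograms where

  open Programs

  private variable
    Γ : Set

  opaque
    ⊨-true : {e : Γ → Tree} → e ⊨ (λ _ → encodeBool true)
    ⊨-true = ⊨-node ⊨-leaf ⊨-leaf

  opaque
    ⊨-not : {e : Γ → Tree} {b : Γ → Bool} → e ⊨ encodeBool ∘ b → e ⊨ encodeBool ∘ not ∘ b
    ⊨-not {b = b} f = ⊨-cong (λ γ → eq (b γ)) (⊨-if f ⊨-leaf ⊨-true)
      where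
      eq : ∀ b → (if b then leaf else encodeBool true) ≡ encodeBool (not b)
      eq false = refl
      eq true  = refl

  opaque
    ⊨-∧ : {e : Γ → Tree} {b c : Γ → Bool} → e ⊨ encodeBool ∘ b → e ⊨ encodeBool ∘ c →
          e ⊨ (λ γ → encodeBool (b γ ∧ c γ))
    ⊨-∧ {b = b} {c} f g = ⊨-cong (λ γ → eq (b γ) (c γ)) (⊨-if f g ⊨-leaf)
      where
      eq : ∀ b c → (if b then encodeBool c else leaf) ≡ encodeBool (b ∧ c)
      eq false c = refl
      eq true  c = refl

  opaque
    ⊨-∨ : {e : Γ → Tree} {b c : Γ → Bool} → e ⊨ encodeBool ∘ b → e ⊨ encodeBool ∘ c →
          e ⊨ (λ γ → encodeBool (b γ ∨ c γ))
    ⊨-∨ {b = b} {c} f g = ⊨-cong (λ γ → eq (b γ) (c γ)) (⊨-if f ⊨-true g)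
      where
      eq : ∀ b c → (if b then encodeBool true else encodeBool c) ≡ encodeBool (b ∨ c)
      eq false c = refl
      eq true  c = refl

  opaque
    ⊨-choose : {A : Γ → Set} {enc : ∀ γ → A γ → Tree} {e : Γ → Tree} {b : Γ → Bool} {x y : ∀ γ → A γ} →
      e ⊨ encodeBool ∘ b → e ⊨ (λ γ → enc γ (x γ)) → e ⊨ (λ γ → enc γ (y γ)) →
      e ⊨ (λ γ → enc γ (if b γ then x γ else y γ))
    ⊨-choose {enc = enc} {b = b} {x} {y} c f g = ⊨-cong (λ γ → eq γ (b γ)) (⊨-if c f g)
      where
      eq : ∀ γ β → (if β then enc γ (x γ) else enc γ (y γ)) ≡ enc γ (if β then x γ else y γ)
      eq γ false = refl
      eq γ true  = refl
  module _ {X : Set} (a : X → Tree) where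

    size-reverse : ∀ xs ys → suc (size (listᴱ a (foldl (flip _∷_) ys xs))) ≡ size (listᴱ a xs) + size (listᴱ a ys)
    size-reverse []       ys = refl
    size-reverse (x ∷ xs) ys = begin
      suc (size (listᴱ a (foldl (flip _∷_) (x ∷ ys) xs)))       ≡⟨ size-reverse xs (x ∷ ys) ⟩
      size (listᴱ a xs) + suc (size (a x) + size (listᴱ a ys))  ≡⟨ cong (size (listᴱ a xs) +_) (cong suc refl) ⟩
      size (listᴱ a xs) + (suc (size (a x)) + size (listᴱ a ys)) ≡⟨ +-assoc (size (listᴱ a xs)) _ _ ⟨
      size (listᴱ a xs) + suc (size (a x)) + size (listᴱ a ys)  ≡⟨ cong (_+ size (listᴱ a ys)) (+-comm (size (listᴱ a xs)) _) ⟩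
      suc (size (a x)) + size (listᴱ a xs) + size (listᴱ a ys)  ∎
      where open ≡-Reasoning

    size-++ : ∀ xs ys → suc (size (listᴱ a (xs ++ ys))) ≡ size (listᴱ a xs) + size (listᴱ a ys)
    size-++ []       ys = refl
    size-++ (x ∷ xs) ys = cong suc (begin
      suc (size (a x) + size (listᴱ a (xs ++ ys)))       ≡⟨ +-suc (size (a x)) _ ⟨
      size (a x) + suc (size (listᴱ a (xs ++ ys)))       ≡⟨ cong (size (a x) +_) (size-++ xs ys) ⟩
      size (a x) + (size (listᴱ a xs) + size (listᴱ a ys)) ≡⟨ +-assoc (size (a x)) _ _ ⟨
      size (a x) + size (listᴱ a xs) + size (listᴱ a ys) ∎)
      where open ≡-Reasoning

    size-prefix : ∀ p q → size (listᴱ a p) ≤ size (listᴱ a (p ++ q))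
    size-prefix []      q = size-pos (listᴱ a q)
    size-prefix (x ∷ p) q = s≤s (+-monoʳ-≤ (size (a x)) (size-prefix p q))

    size-suffix : ∀ p q → size (listᴱ a q) ≤ size (listᴱ a (p ++ q))
    size-suffix []      q = ≤-refl
    size-suffix (x ∷ p) q = ≤-trans (size-suffix p q) (m≤n⇒m≤1+n (m≤n+m _ (size (a x))))

    size-listᴱ : ∀ {b : X → Tree} {M Z} xs → size (listᴱ a xs) ≤ M →
      (∀ x → size (a x) ≤ M → size (b x) ≤ Z) → size (listᴱ b xs) ≤ suc (length xs * suc Z)
    size-listᴱ []       _ _ = ≤-refl
    size-listᴱ {Z = Z} (x ∷ xs) h b≤ = s≤s (≤-trans
      (+-mono-≤ (b≤ x (≤-trans (m≤m+n _ _) (<⇒≤ h)))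
        (size-listᴱ xs (≤-trans (m≤n+m _ (size (a x))) (<⇒≤ h)) b≤))
      (≤-reflexive (+-suc Z (length xs * suc Z))))

  listᴱ-tabulate : ∀ {n} {X : Set} (a : X → Tree) (f : Fin n → X) →
    listᴱ a (tabulate f) ≡ encodeList (tabulate (a ∘ f))
  listᴱ-tabulate a f = cong encodeList (List.map-tabulate f a)

  opaque
    ⊨-reverse : {X : Γ → Set} {e : Γ → Tree} {l : ∀ γ → List (X γ)} {a : ∀ γ → X γ → Tree} →
      e ⊨ (λ γ → listᴱ (a γ) (l γ)) → e ⊨ (λ γ → listᴱ (a γ) (reverse (l γ)))
    ⊨-reverse {X = X} {l = l} {a} list =
      ⊨-foldl {S = List ∘ X} {s₀ = λ _ → []} {encS = λ γ → listᴱ (a γ)} (λ γ → flip _∷_)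
        (λ γ → size (listᴱ (a γ) (l γ))) ⊨-leaf list
        (⊨-node (⊨-tl ⨟ ⊨-tl) (⊨-tl ⨟ ⊨-hd)) (out-poly list)
        (λ γ q r eq → s≤s⁻¹ (begin
          suc (size (listᴱ (a γ) (foldl (flip _∷_) [] q))) ≡⟨ size-reverse (a γ) q [] ⟩
          size (listᴱ (a γ) q) + 1                         ≡⟨ +-comm _ 1 ⟩
          suc (size (listᴱ (a γ) q))                       ≤⟨ s≤s (size-prefix (a γ) q r) ⟩
          suc (size (listᴱ (a γ) (q ++ r)))                ≡⟨ cong (suc ∘ size ∘ listᴱ (a γ)) eq ⟩
          suc (size (listᴱ (a γ) (l γ)))                   ∎))
      where
      open ≤-Reasoning
      open import Data.Nat.Base using (s≤s⁻¹)

  module _ {S X : Γ → Set} {e : Γ → Tree} {s₀ : ∀ γ → S γ} {l : ∀ γ → List (X γ)}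
           {encS : ∀ γ → S γ → Tree} {a : ∀ γ → X γ → Tree}
           (step : ∀ γ → X γ → S γ → S γ) (B : Γ → ℕ) where
    opaque
      -- A right fold is a left fold over the reversed list, so the size bound is now demanded for
      -- suffixes instead of prefixes.
      ⊨-foldr : e ⊨ (λ γ → encS γ (s₀ γ)) → e ⊨ (λ γ → listᴱ (a γ) (l γ)) →
        (λ ((γ , s , x) : Σ Γ λ γ → S γ × X γ) → node (e γ) (node (encS γ s) (a γ x)))
          ⊨ (λ (γ , s , x) → encS γ (step γ x s)) →
        Poly e B →
        (∀ γ p q → p ++ q ≡ l γ → size (encS γ (foldr (step γ) (s₀ γ) q)) ≤ B γ) →
        e ⊨ (λ γ → encS γ (foldr (step γ) (s₀ γ) (l γ)))
      ⊨-foldr init list f PB bound =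
        ⊨-cong (λ γ → cong (encS γ) (List.reverse-foldl (flip (step γ)) (s₀ γ) (l γ)))
          (⊨-foldl {l = reverse ∘ l} {encS = encS} {a} (flip ∘ step) B init (⊨-reverse list) f PB λ γ p q eq →
            ≤-trans (≤-reflexive (cong (size ∘ encS γ)
              (trans (cong (foldl (flip (step γ)) (s₀ γ)) (sym (List.reverse-involutive p)))
                     (List.reverse-foldl (flip (step γ)) (s₀ γ) (reverse p)))))
              (bound γ (reverse q) (reverse p)
                (trans (sym (List.reverse-++ p q)) (trans (cong reverse eq) (List.reverse-involutive (l γ))))))

  size-encodeBool : ∀ b → size (encodeBool b) ≤ 3
  size-encodeBool false = s≤s z≤n
  size-encodeBool true  = ≤-refl

  size-encodeℕ : ∀ m → size (encodeℕ m) ≡ suc (m + m)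
  size-encodeℕ zero    = refl
  size-encodeℕ (suc m) = cong (2 +_) (trans (size-encodeℕ m) (sym (+-suc m m)))

  anyᴸ : {A : Set} → (A → Bool) → List A → Bool
  anyᴸ p = foldr (λ x b → p x ∨ b) false

  countᴸ : {A : Set} → (A → Bool) → List A → ℕ
  countᴸ p = foldr (λ x m → if p x then suc m else m) 0

  module _ {X : Γ → Set} {e : Γ → Tree} {l : ∀ γ → List (X γ)} {a : ∀ γ → X γ → Tree} where

    private
      length-suffix : ∀ {A : Set} (p q : List A) {l} → p ++ q ≡ l → length q ≤ length l
      length-suffix p q refl = ≤-trans (m≤n+m _ (length p)) (≤-reflexive (sym (List.length-++ p)))

    opaque
      ⊨-map : {b : ∀ γ → X γ → Tree} → e ⊨ (λ γ → listᴱ (a γ) (l γ)) →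
        (λ ((γ , x) : Σ Γ X) → node (e γ) (a γ x)) ⊨ (λ (γ , x) → b γ x) →
        e ⊨ (λ γ → listᴱ (b γ) (l γ))
      ⊨-map {b = b} list f =
        ⊨-cong (λ γ → cong (listᴱ (b γ)) (sym (List.id-is-foldr (l γ))))
          (⊨-foldr {S = List ∘ X} {s₀ = λ _ → []} {encS = λ γ → listᴱ (b γ)} (λ γ → _∷_) B ⊨-leaf list
            (⊨-node (⊨-node ⊨-hd (⊨-tl ⨟ ⊨-tl) ⨟ ⊨-reindex (λ (γ , _ , x) → γ , x) f) (⊨-tl ⨟ ⊨-hd))
            (poly-suc (poly-* (poly-≤ (λ γ → length≤size (a γ) (l γ)) (out-poly list))
              (poly-suc (poly-^ (degree (poly f)) (poly-suc (poly-suc (poly-+ poly-size (out-poly list))))))))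
            (λ γ p q eq → ≤-trans
              (≤-reflexive (cong (size ∘ listᴱ (b γ)) (sym (List.id-is-foldr q))))
              (≤-trans
                (size-listᴱ (a γ) q (≤-trans (size-suffix (a γ) p q) (≤-reflexive (cong (size ∘ listᴱ (a γ)) eq)))
                  (λ x a≤ → let (_ , r , r≤) = runs f (γ , x) in
                    ≤-trans (size≤time r) (≤-trans r≤ (≤-trans (bounded (poly f) (γ , x))
                      (^-monoˡ-≤ (degree (poly f)) (s≤s (s≤s (+-monoʳ-≤ (size (e γ)) a≤))))))))
                (s≤s (*-monoˡ-≤ _ (length-suffix p q eq))))))
        where
        B : Γ → ℕ
        B γ = suc (length (l γ) * suc (suc (suc (size (e γ) + size (listᴱ (a γ) (l γ)))) ^ degree (poly f)))

    private
      count≤length : ∀ {A : Set} (p : A → Bool) xs → countᴸ p xs ≤ length xs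
      count≤length p []       = z≤n
      count≤length p (x ∷ xs) with p x
      ... | true  = s≤s (count≤length p xs)
      ... | false = m≤n⇒m≤1+n (count≤length p xs)

    opaque
      ⊨-any : {p : ∀ γ → X γ → Bool} → e ⊨ (λ γ → listᴱ (a γ) (l γ)) →
        (λ ((γ , x) : Σ Γ X) → node (e γ) (a γ x)) ⊨ (λ (γ , x) → encodeBool (p γ x)) →
        e ⊨ (λ γ → encodeBool (anyᴸ (p γ) (l γ)))
      ⊨-any {p = p} list f =
        ⊨-foldr {encS = λ _ → encodeBool} (λ γ x b → p γ x ∨ b) (λ _ → 3) ⊨-leaf list
          (⊨-∨ (⊨-node ⊨-hd (⊨-tl ⨟ ⊨-tl) ⨟ ⊨-reindex (λ (γ , _ , x) → γ , x) f) (⊨-tl ⨟ ⊨-hd))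
          (poly-const 3) (λ γ _ q _ → size-encodeBool (anyᴸ (p γ) q))

    opaque
      ⊨-count : {p : ∀ γ → X γ → Bool} → e ⊨ (λ γ → listᴱ (a γ) (l γ)) →
        (λ ((γ , x) : Σ Γ X) → node (e γ) (a γ x)) ⊨ (λ (γ , x) → encodeBool (p γ x)) →
        e ⊨ (λ γ → encodeℕ (countᴸ (p γ) (l γ)))
      ⊨-count {p = p} list f =
        ⊨-foldr {encS = λ _ → encodeℕ} (λ γ x m → if p γ x then suc m else m) (λ γ → suc (length (l γ) + length (l γ)))
          ⊨-leaf list
          (⊨-choose {enc = λ _ → encodeℕ} (⊨-node ⊨-hd (⊨-tl ⨟ ⊨-tl) ⨟ ⊨-reindex (λ (γ , _ , x) → γ , x) f)
            (⊨-node ⊨-leaf (⊨-tl ⨟ ⊨-hd)) (⊨-tl ⨟ ⊨-hd))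
          (poly-suc (poly-+ pl pl))
          (λ γ p′ q eq → ≤-trans (≤-reflexive (size-encodeℕ (countᴸ (p γ) q)))
            (let c≤ = ≤-trans (count≤length (p γ) q) (length-suffix p′ q eq) in s≤s (+-mono-≤ c≤ c≤)))
        where
        pl : Poly e (length ∘ l)
        pl = poly-≤ (λ γ → length≤size (a γ) (l γ)) (out-poly list)

    opaque
      ⊨-length : e ⊨ (λ γ → listᴱ (a γ) (l γ)) → e ⊨ (λ γ → encodeℕ (length (l γ)))
      ⊨-length list = ⊨-cong (λ γ → cong encodeℕ (all-true (l γ))) (⊨-count {p = λ _ _ → true} list ⊨-true)
        where
        all-true : ∀ {A : Set} (xs : List A) → countᴸ (λ _ → true) xs ≡ length xs
        all-true []       = refl
        all-true (x ∷ xs) = cong suc (all-true xs)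

    opaque
      ⊨-filter : {p : ∀ γ → X γ → Bool} → e ⊨ (λ γ → listᴱ (a γ) (l γ)) →
        (λ ((γ , x) : Σ Γ X) → node (e γ) (a γ x)) ⊨ (λ (γ , x) → encodeBool (p γ x)) →
        e ⊨ (λ γ → listᴱ (a γ) (filterᵇ (p γ) (l γ)))
      ⊨-filter {p = p} list f =
        ⊨-cong (λ γ → cong (listᴱ (a γ)) (filter-foldr (p γ) (l γ)))
          (⊨-foldr {S = List ∘ X} {s₀ = λ _ → []} {encS = λ γ → listᴱ (a γ)}
            (λ γ x xs → if p γ x then x ∷ xs else xs) (λ γ → size (listᴱ (a γ) (l γ))) ⊨-leaf list
            (⊨-choose {enc = λ (γ , _) → listᴱ (a γ)} (⊨-node ⊨-hd (⊨-tl ⨟ ⊨-tl) ⨟ ⊨-reindex (λ (γ , _ , x) → γ , x) f)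
              (⊨-node (⊨-tl ⨟ ⊨-tl) (⊨-tl ⨟ ⊨-hd)) (⊨-tl ⨟ ⊨-hd))
            (out-poly list)
            (λ γ p′ q eq → ≤-trans (smaller (a γ) (p γ) q)
              (≤-trans (size-suffix (a γ) p′ q) (≤-reflexive (cong (size ∘ listᴱ (a γ)) eq)))))
        where
        filter-foldr : ∀ {A : Set} (p : A → Bool) xs → foldr (λ x xs → if p x then x ∷ xs else xs) [] xs ≡ filterᵇ p xs
        filter-foldr p []       = refl
        filter-foldr p (x ∷ xs) with p x
        ... | true  = cong (x ∷_) (filter-foldr p xs)
        ... | false = filter-foldr p xs
        smaller : ∀ {A : Set} (a : A → Tree) (p : A → Bool) xs →
          size (listᴱ a (foldr (λ x xs → if p x then x ∷ xs else xs) [] xs)) ≤ size (listᴱ a xs)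
        smaller a p []       = ≤-refl
        smaller a p (x ∷ xs) with p x
        ... | true  = s≤s (+-monoʳ-≤ (size (a x)) (smaller a p xs))
        ... | false = ≤-trans (smaller a p xs) (m≤n⇒m≤1+n (m≤n+m _ (size (a x))))

    opaque
      ⊨-++ : {r : ∀ γ → List (X γ)} → e ⊨ (λ γ → listᴱ (a γ) (l γ)) → e ⊨ (λ γ → listᴱ (a γ) (r γ)) →
        e ⊨ (λ γ → listᴱ (a γ) (l γ ++ r γ))
      ⊨-++ {r = r} list rest =
        ⊨-cong (λ γ → cong (listᴱ (a γ)) (sym (List.++-is-foldr (l γ) (r γ))))
          (⊨-foldr {S = List ∘ X} {s₀ = r} {encS = λ γ → listᴱ (a γ)} (λ γ → _∷_)
            (λ γ → size (listᴱ (a γ) (l γ)) + size (listᴱ (a γ) (r γ))) rest list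
            (⊨-node (⊨-tl ⨟ ⊨-tl) (⊨-tl ⨟ ⊨-hd)) (poly-+ (out-poly list) (out-poly rest))
            (λ γ p q eq → ≤-trans (n≤1+n _) (≤-trans
              (≤-reflexive (trans (cong (suc ∘ size ∘ listᴱ (a γ)) (sym (List.++-is-foldr q (r γ)))) (size-++ (a γ) q (r γ))))
              (+-monoˡ-≤ _ (≤-trans (size-suffix (a γ) p q) (≤-reflexive (cong (size ∘ listᴱ (a γ)) eq)))))))

  -- Table lookup by flags. The last flagged entry wins, so flags with exactly one `true` address
  -- exactly one entry, and `r` is the default.
  pick : {X : Set} → (X → Bool) → (X → Tree) → List X → Tree → Tree
  pick p x []       r = r
  pick p x (y ∷ ys) r = pick p x ys (if p y then x y else r)

  opaque
    -- Two lists are traversed in step: the fold runs over the flags, while the values wait in the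
    -- accumulator and lose their head in every round.
    ⊨-pick : {X : Γ → Set} {e : Γ → Tree} {l : ∀ γ → List (X γ)} {p : ∀ γ → X γ → Bool} {x : ∀ γ → X γ → Tree} →
      e ⊨ (λ γ → listᴱ (encodeBool ∘ p γ) (l γ)) → e ⊨ (λ γ → listᴱ (x γ) (l γ)) →
      e ⊨ (λ γ → pick (p γ) (x γ) (l γ) leaf)
    ⊨-pick {X = X} {e} {l} {p} {x} flags list =
      ⊨-cong (λ γ → trans (cong (λ l′ → tl (foldl (step γ) (node (listᴱ (x γ) l′) leaf) (l γ))) (sym (List.++-identityʳ (l γ))))
                          (cong tl (spec γ (l γ) [] leaf)))
        (⊨-foldl {S = λ _ → Tree} {X} {s₀ = λ γ → node (listᴱ (x γ) (l γ)) leaf} {l} {encS = λ _ s → s}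
            {λ γ → encodeBool ∘ p γ} step
            (λ γ → suc (size (listᴱ (x γ) (l γ)) + suc (size (listᴱ (x γ) (l γ)))))
            (⊨-node list ⊨-leaf) flags
            (⊨-node (⊨-tl ⨟ ⊨-hd ⨟ ⊨-hd ⨟ ⊨-tl)
              (⊨-if (⊨-tl ⨟ ⊨-tl) (⊨-tl ⨟ ⊨-hd ⨟ ⊨-hd ⨟ ⊨-hd) (⊨-tl ⨟ ⊨-hd ⨟ ⊨-tl)))
            (poly-suc (poly-+ (out-poly list) (poly-suc (out-poly list))))
            (λ γ q r eq → ≤-trans
              (≤-reflexive (cong size (trans (cong (λ l′ → foldl (step γ) (node (listᴱ (x γ) l′) leaf) q) (sym eq))
                                             (spec γ q r leaf))))
              (subst (λ l′ → size (node (listᴱ (x γ) r) (pick (p γ) (x γ) q leaf))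
                               ≤ suc (size (listᴱ (x γ) l′) + suc (size (listᴱ (x γ) l′)))) eq
                (s≤s (+-mono-≤ (size-suffix (x γ) q r)
                  (≤-trans (pick-size γ q leaf) (s≤s (size-prefix (x γ) q r)))))))
         ⨟ ⊨-tl)
      where
      step : ∀ γ → Tree → X γ → Tree
      step γ s y = node (tl (hd s)) (if p γ y then hd (hd s) else tl s)
      spec : ∀ γ q r t → foldl (step γ) (node (listᴱ (x γ) (q ++ r)) t) q ≡ node (listᴱ (x γ) r) (pick (p γ) (x γ) q t)
      spec γ []      r t = refl
      spec γ (y ∷ q) r t = spec γ q r _
      pick-size : ∀ γ q t → size (pick (p γ) (x γ) q t) ≤ size t + size (listᴱ (x γ) q)
      pick-size γ []      t = m≤m+n _ _
      pick-size γ (y ∷ q) t with p γ y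
      ... | true  = ≤-trans (pick-size γ q (x γ y)) (≤-trans (n≤1+n _) (m≤n+m _ (size t)))
      ... | false = ≤-trans (pick-size γ q t) (+-monoʳ-≤ (size t) (m≤n⇒m≤1+n (m≤n+m _ (size (x γ y)))))
  -- A unary numeral is a list of leaves, which turns arithmetic and counted iteration into folds
  -- over lists.
  unaryᴱ : ∀ m → listᴱ {⊤} (λ _ → leaf) (replicate m tt) ≡ encodeℕ m
  unaryᴱ zero    = refl
  unaryᴱ (suc m) = cong (node leaf) (unaryᴱ m)

  private
    asList : {e : Γ → Tree} {m : Γ → ℕ} → e ⊨ encodeℕ ∘ m → e ⊨ (λ γ → listᴱ {⊤} (λ _ → leaf) (replicate (m γ) tt))
    asList {m = m} = ⊨-cong (λ γ → sym (unaryᴱ (m γ)))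

    suffix≤ : ∀ {n} (p q : List ⊤) → p ++ q ≡ replicate n tt → length q ≤ n
    suffix≤ {n} p q eq = ≤-trans (m≤n+m _ (length p))
      (≤-reflexive (trans (sym (List.length-++ p)) (trans (cong length eq) (List.length-replicate n))))

  opaque
    ⊨-+ : {e : Γ → Tree} {m r : Γ → ℕ} → e ⊨ encodeℕ ∘ m → e ⊨ encodeℕ ∘ r → e ⊨ (λ γ → encodeℕ (m γ + r γ))
    ⊨-+ {m = m} {r} f g = ⊨-cong (λ γ → trans (cong (listᴱ (λ _ → leaf)) (eq (m γ) (r γ))) (unaryᴱ (m γ + r γ)))
      (⊨-++ (asList f) (⊨-cong (λ γ → sym (unaryᴱ (r γ))) g))
      where
      eq : ∀ a b → replicate a tt ++ replicate b tt ≡ replicate (a + b) tt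
      eq zero    b = refl
      eq (suc a) b = cong (tt ∷_) (eq a b)

  module _ {e : Γ → Tree} {m r : Γ → ℕ} where

    opaque
      ⊨-* : e ⊨ encodeℕ ∘ m → e ⊨ encodeℕ ∘ r → e ⊨ (λ γ → encodeℕ (m γ * r γ))
      ⊨-* f g = ⊨-cong (λ γ → cong encodeℕ (trans (spec (r γ) (replicate (m γ) tt)) (cong (_* r γ) (List.length-replicate (m γ)))))
        (⊨-foldr {s₀ = λ _ → 0} {l = λ γ → replicate (m γ) tt} {encS = λ _ → encodeℕ} (λ γ _ s → r γ + s)
          (λ γ → suc (m γ * r γ + m γ * r γ)) ⊨-leaf (asList f)
          (⊨-+ (⊨-hd ⨟ ⊨-reindex proj₁ g) (⊨-tl ⨟ ⊨-hd))
          (poly-suc (poly-+ pm pm))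
          (λ γ p q eq → ≤-trans (≤-reflexive (trans (cong (size ∘ encodeℕ) (spec (r γ) q)) (size-encodeℕ (length q * r γ))))
            (let q≤ = *-monoˡ-≤ (r γ) (suffix≤ p q eq) in s≤s (+-mono-≤ q≤ q≤))))
        where
        spec : ∀ c (xs : List ⊤) → foldr (λ _ s → c + s) 0 xs ≡ length xs * c
        spec c []       = refl
        spec c (x ∷ xs) = cong (c +_) (spec c xs)
        value≤size : ∀ {t : Γ → ℕ} γ → t γ ≤ size (encodeℕ (t γ))
        value≤size {t} γ = ≤-trans (m≤n⇒m≤1+n (m≤m+n (t γ) (t γ))) (≤-reflexive (sym (size-encodeℕ (t γ))))
        pm : Poly e (λ γ → m γ * r γ)
        pm = poly-* (poly-≤ (value≤size {m}) (out-poly f)) (poly-≤ (value≤size {r}) (out-poly g))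

    opaque
      ⊨-∸ : e ⊨ encodeℕ ∘ m → e ⊨ encodeℕ ∘ r → e ⊨ (λ γ → encodeℕ (r γ ∸ m γ))
      ⊨-∸ f g = ⊨-cong (λ γ → cong encodeℕ (trans (spec (r γ) (replicate (m γ) tt)) (cong (r γ ∸_) (List.length-replicate (m γ)))))
        (⊨-foldl {s₀ = r} {l = λ γ → replicate (m γ) tt} {encS = λ _ → encodeℕ} (λ _ s _ → pred s) (λ γ → size (encodeℕ (r γ)))
          g (asList f) (⊨-cong (λ (_ , s , _) → tl-encode s) (⊨-tl ⨟ ⊨-hd ⨟ ⊨-tl)) (out-poly g)
          (λ γ p _ _ → shrink (r γ) p))
        where
        tl-encode : ∀ s → tl (encodeℕ s) ≡ encodeℕ (pred s)
        tl-encode zero    = refl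
        tl-encode (suc s) = refl
        spec : ∀ s (xs : List ⊤) → foldl (λ s _ → pred s) s xs ≡ s ∸ length xs
        spec s       []       = refl
        spec zero    (x ∷ xs) = trans (spec 0 xs) (0∸n≡0 (length xs))
        spec (suc s) (x ∷ xs) = spec s xs
        pred-size : ∀ s → size (encodeℕ (pred s)) ≤ size (encodeℕ s)
        pred-size zero    = ≤-refl
        pred-size (suc s) = m≤n⇒m≤1+n (n≤1+n _)
        shrink : ∀ s (xs : List ⊤) → size (encodeℕ (foldl (λ s _ → pred s) s xs)) ≤ size (encodeℕ s)
        shrink s []       = ≤-refl
        shrink s (x ∷ xs) = ≤-trans (shrink (pred s) xs) (pred-size s)

  module _ {e : Γ → Tree} {m : Γ → ℕ} where

    opaque
      ⊨-iterate : {S : Γ → Set} {encS : ∀ γ → S γ → Tree} {s₀ : ∀ γ → S γ} (it : ∀ γ → ℕ → S γ) (step : ∀ γ → S γ → S γ) →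
        (∀ γ → it γ 0 ≡ s₀ γ) → (∀ γ j → it γ (suc j) ≡ step γ (it γ j)) → (B : Γ → ℕ) →
        e ⊨ encodeℕ ∘ m → e ⊨ (λ γ → encS γ (s₀ γ)) →
        (λ ((γ , s) : Σ Γ S) → node (e γ) (encS γ s)) ⊨ (λ (γ , s) → encS γ (step γ s)) →
        Poly e B → (∀ γ j → j ≤ m γ → size (encS γ (it γ j)) ≤ B γ) →
        e ⊨ (λ γ → encS γ (it γ (m γ)))
      ⊨-iterate {encS = encS} {s₀} it step it-0 it-suc B count init f PB bound =
        ⊨-cong (λ γ → cong (encS γ) (trans (spec γ (replicate (m γ) tt)) (cong (it γ) (List.length-replicate (m γ)))))
          (⊨-foldr {s₀ = s₀} {l = λ γ → replicate (m γ) tt} {encS = encS} (λ γ _ → step γ) B init (asList count)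
            (⊨-node ⊨-hd (⊨-tl ⨟ ⊨-hd) ⨟ ⊨-reindex (λ (γ , s , _) → γ , s) f) PB
            (λ γ p q eq → ≤-trans (≤-reflexive (cong (size ∘ encS γ) (spec γ q)))
              (bound γ (length q) (suffix≤ p q eq))))
        where
        spec : ∀ γ (xs : List ⊤) → foldr (λ _ → step γ) (s₀ γ) xs ≡ it γ (length xs)
        spec γ []       = sym (it-0 γ)
        spec γ (x ∷ xs) = trans (cong (step γ) (spec γ xs)) (sym (it-suc γ (length xs)))

  module _ {e : Γ → Tree} {m r : Γ → ℕ} where

    opaque
      ⊨-<ᵇ : e ⊨ encodeℕ ∘ m → e ⊨ encodeℕ ∘ r → e ⊨ (λ γ → encodeBool (m γ <ᵇ r γ))
      ⊨-<ᵇ f g = ⊨-cong (λ γ → eq (m γ) (r γ)) (⊨-ifNode (⊨-∸ f g) ⊨-true ⊨-leaf)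
        where
        eq : ∀ a b → ifNode (encodeℕ (b ∸ a)) (encodeBool true) leaf ≡ encodeBool (a <ᵇ b)
        eq zero    zero    = refl
        eq zero    (suc b) = refl
        eq (suc a) zero    = refl
        eq (suc a) (suc b) = eq a b

-- Reduction and lifting as Boolean functions

module Algorithm where

  open ListPrograms using (anyᴸ; countᴸ)

  Rel : ℕ → Set
  Rel n = Fin n → Fin n → Bool

  anyᶠ : ∀ {n} → (Fin n → Bool) → Bool
  anyᶠ {n} p = anyᴸ p (allFin n)

  count : ∀ {n} → (Fin n → Bool) → ℕ
  count {n} p = countᴸ p (allFin n)

  -- The three values are taken at u ≡ v, u < v and v < u.
  trichotomy : ∀ {n} → Bool → Bool → Bool → Rel n
  trichotomy x y z zero    zero    = x
  trichotomy x y z zero    (suc v) = y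
  trichotomy x y z (suc u) zero    = z
  trichotomy x y z (suc u) (suc v) = trichotomy x y z u v

  infix 7 _==_ _≺_

  _==_ : ∀ {n} → Rel n
  _==_ = trichotomy true false false

  _≺_ : ∀ {n} → Rel n
  u ≺ v = trichotomy false false true v u

  least : ∀ {n} → (Fin n → Bool) → Fin n → Bool
  least p v = p v ∧ not (anyᶠ λ w → w ≺ v ∧ p w)

  closure : ∀ {n} → Rel n → Rel n
  closure {n} R = foldr (λ p C u v → C u v ∨ (C u p ∧ C p v)) (λ u v → u == v ∨ R u v) (allFin n)

  record Input : Set where
    field
      order : ℕ
      edge  : Rel order
      k d   : ℕ

  module Kernel (I : Input) where
    open Input I

    K : ℕ
    K = suc (k + k)

    heavy : Fin order → Bool
    heavy x = K <ᵇ count (λ v → not (edge x v))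

    quiet : Fin order → Bool
    quiet x = not (heavy x) ∧ not (anyᶠ λ v → not (heavy v) ∧ (not (edge x v) ∧ not (x == v)))

    noisy : Fin order → Bool
    noisy x = not (heavy x) ∧ not (quiet x)

    infeasible : Bool
    infeasible = not (count heavy <ᵇ K) ∨ not (count noisy <ᵇ K * K)

    heavies : List (Fin order)
    heavies = filterᵇ heavy (allFin order)

    avoiding : List (Fin order) → Fin order → Bool
    avoiding []      v = quiet v
    avoiding (x ∷ A) v = not (edge x v) ∧ avoiding A v

    -- The old tuples stay in the list, because components with fewer than d vertices have to be
    -- found as well. Once the length reaches `order` the list never changes again, so `overflow`
    -- only has to inspect the last one.
    grow : List (List (Fin order)) → List (List (Fin order))
    grow As = if length As <ᵇ order then As ++ cartesianProductWith (λ A x → x ∷ A) As heavies else As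

    tuples : ℕ → List (List (Fin order))
    tuples zero    = [] ∷ []
    tuples (suc j) = grow (tuples j)

    overflow : Bool
    overflow = not (length (tuples d) <ᵇ order)

    early : (Fin order → Bool) → Fin order → Bool
    early S v = S v ∧ (count (λ w → w ≺ v ∧ S w) <ᵇ K)

    quietNbr : Fin order → Fin order → Bool
    quietNbr x w = quiet w ∧ edge x w

    marked : Fin order → Bool
    marked v = not (quiet v) ∨ (overflow ∨
      (anyᴸ (λ A → early (avoiding A) v) (tuples d) ∨
       anyᶠ (λ x → heavy x ∧ early (quietNbr x) v)))

    opaque
      -- If the counts exclude a solution with at most k edges, a single vertex is left. The optimum
      -- of the given instance is then k + 1, and the cap makes every lifted solution optimal.
      -- Keeping one vertex rather than none leaves a legitimate connected instance.
      keep : Fin order → Bool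
      keep v = if infeasible then not (anyᶠ λ w → w ≺ v) else marked v

      keep≡ : ∀ v → keep v ≡ (if infeasible then not (anyᶠ λ w → w ≺ v) else marked v)
      keep≡ v = refl

    kept : List (Fin order)
    kept = filterᵇ keep (allFin order)

    module Lift (F′ : Rel (length kept)) where

      ι : Fin (length kept) → Fin order
      ι = lookup kept

      F : Rel order
      F u v = anyᶠ λ i → ι i == u ∧ anyᶠ λ j → ι j == v ∧ F′ i j

      conn : Rel order
      conn = closure F

      touched : Fin order → Bool
      touched u = anyᶠ (F u)

      bad : Fin order → Bool
      bad u = anyᶠ λ v → not (keep v) ∧ not (anyᶠ λ w → conn u w ∧ edge w v)

      rep : Fin order → Bool
      rep r = keep r ∧ (bad r ∧ not (anyᶠ λ w → w ≺ r ∧ conn r w))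

      door : Fin order → Rel order
      door r b a = conn r a ∧ edge a b

      -- The one edge added for the component whose least vertex is r.
      link : Fin order → Rel order
      link r a b = least (λ b → quiet b ∧ anyᶠ (door r b)) b ∧ least (door r b) a

      extended : Rel order
      extended u v = F u v ∨ anyᶠ λ r → rep r ∧ (link r u v ∨ link r v u)

      -- Contracting all edges of a connected graph leaves one vertex and costs at most k + 1
      -- because of the cap. This loses nothing when F touches at least K = 2k + 1 vertices, since F
      -- then has more than k edges and the value k + 1 itself.
      lifted : Rel order
      lifted u v = if infeasible ∨ not (count touched <ᵇ K) then edge u v else extended u v

-- Programs on vertices, sets and relations

module VertexPrograms where

  open Programs
  open ListPrograms
  open Algorithm

  private variable
    Γ : Set

  setᴱ : ∀ {n} → (Fin n → Bool) → Tree
  setᴱ S = listᴱ (encodeBool ∘ S) (allFin _)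

  relᴱ : ∀ {n} → Rel n → Tree
  relᴱ R = listᴱ (λ u → setᴱ (R u)) (allFin _)

  -- A vertex is stored as its characteristic vector.
  opaque
    unit : ∀ {n} → Fin n → Tree
    unit u = setᴱ (u ==_)

    unit≡ : ∀ {n} (u : Fin n) → unit u ≡ setᴱ (u ==_)
    unit≡ u = refl

  size-setᴱ : ∀ {n} (S : Fin n → Bool) → size (setᴱ S) ≤ suc (n * 4)
  size-setᴱ {n} S = subst (λ l → size (setᴱ S) ≤ suc (l * 4)) (List.length-tabulate {n = n} id)
    (size-listᴱ (λ _ → leaf) (allFin n) ≤-refl (λ x _ → size-encodeBool (S x)))

  size-relᴱ : ∀ {n} (R : Rel n) → size (relᴱ R) ≤ suc (n * suc (suc (n * 4)))
  size-relᴱ {n} R = subst (λ l → size (relᴱ R) ≤ suc (l * suc (suc (n * 4)))) (List.length-tabulate {n = n} id)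
    (size-listᴱ (λ _ → leaf) (allFin n) ≤-refl (λ x _ → size-setᴱ (R x)))

  listᴱ-suc : ∀ {n} (a : Fin (suc n) → Tree) → listᴱ a (tabulate {n = n} suc) ≡ listᴱ (a ∘ suc) (allFin n)
  listᴱ-suc {n} a = trans (listᴱ-tabulate a suc) (sym (listᴱ-tabulate (a ∘ suc) (id {A = Fin n})))

  module _ {X : Γ → Set} {e : Γ → Tree} {l : ∀ γ → List (X γ)} {a : ∀ γ → X γ → Tree} (x y z : Bool) where

    private
      tri : ∀ {n} → Rel n
      tri = trichotomy x y z

      -- A new vertex below all others adds a constant first row and a constant first column. The
      -- table therefore grows by a fold that never compares two vertices, and this is why equality
      -- and order are both instances of `trichotomy`.
      relᴱ-suc : ∀ m → node (node (encodeBool x) (listᴱ {Fin m} (λ _ → encodeBool y) (allFin m)))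
                            (listᴱ (λ u → node (encodeBool z) (setᴱ (tri {m} u))) (allFin m))
                       ≡ relᴱ (tri {suc m})
      relᴱ-suc m = cong₂ (λ r s → node (node (encodeBool x) r) s)
        (sym (listᴱ-suc {m} (encodeBool ∘ tri zero)))
        (sym (trans (listᴱ-suc {m} (λ u → setᴱ (tri u)))
          (cong encodeList (List.map-cong (λ u → cong (node (encodeBool z)) (listᴱ-suc (encodeBool ∘ tri (suc u)))) (allFin m)))))

    opaque
      ⊨-bool : {Γ : Set} {e : Γ → Tree} (b : Bool) → e ⊨ (λ _ → encodeBool b)
      ⊨-bool true  = ⊨-true
      ⊨-bool false = ⊨-leaf

    opaque
      ⊨-trichotomy : e ⊨ (λ γ → listᴱ (a γ) (l γ)) → e ⊨ (λ γ → relᴱ {length (l γ)} tri)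
      ⊨-trichotomy list = ⊨-cong (λ γ → cong (λ m → relᴱ {m} tri) (count-all (l γ)))
        (⊨-foldr {S = λ _ → ℕ} {s₀ = λ _ → 0} {encS = λ _ m → relᴱ {m} tri} (λ _ _ → suc)
          (λ γ → suc (length (l γ) * suc (suc (length (l γ) * 4)))) ⊨-leaf list
          (⊨-cong (λ (_ , m , _) → relᴱ-suc m)
            (⊨-node (⊨-node (⊨-bool x) (⊨-map {a = λ (_ , m , _) u → setᴱ {m} (tri u)} rows (⊨-bool y)))
                    (⊨-map {a = λ (_ , m , _) u → setᴱ {m} (tri u)} rows (⊨-node (⊨-bool z) ⊨-tl))))
          (poly-suc (poly-* pl (poly-suc (poly-suc (poly-* pl (poly-const 4))))))
          (λ γ p q eq → subst (λ m → size (relᴱ {m} tri) ≤ _) (sym (count-all q))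
            (≤-trans (size-relᴱ {length q} tri) (s≤s
              (*-mono-≤ (suffix p q eq) (s≤s (s≤s (*-monoˡ-≤ 4 (suffix p q eq)))))))))
        where
        rows : (λ ((γ , m , v) : Σ Γ λ γ → ℕ × X γ) → node (e γ) (node (relᴱ {m} tri) (a γ v)))
                 ⊨ (λ (_ , m , _) → relᴱ {m} tri)
        rows = ⊨-tl ⨟ ⊨-hd
        pl : Poly e (length ∘ l)
        pl = poly-≤ (λ γ → length≤size (a γ) (l γ)) (out-poly list)
        count-all : ∀ {A : Set} (xs : List A) → foldr (λ _ → suc) 0 xs ≡ length xs
        count-all []       = refl
        count-all (x ∷ xs) = cong suc (count-all xs)
        suffix : ∀ {A : Set} (p q : List A) {xs} → p ++ q ≡ xs → length q ≤ length xs
        suffix p q refl = ≤-trans (m≤n+m _ (length p)) (≤-reflexive (sym (List.length-++ p)))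

  pick-unique : ∀ {n} {X : Set} (p : X → Bool) (x : X → Tree) (g : Fin n → X) (u : Fin n) r →
    (∀ v → p (g v) ≡ u == v) → pick p x (tabulate g) r ≡ x (g u)
  pick-unique {suc n} p x g zero r h rewrite h zero = none (g ∘ suc) (x (g zero)) (h ∘ suc)
    where
    none : ∀ {n} (g : Fin n → _) r → (∀ v → p (g v) ≡ false) → pick p x (tabulate g) r ≡ r
    none {zero}  g r h = refl
    none {suc n} g r h rewrite h zero = none (g ∘ suc) r (h ∘ suc)
  pick-unique {suc n} p x g (suc u) r h rewrite h zero = pick-unique p x (g ∘ suc) u r (h ∘ suc)

  infixl 5 _▹_

  -- Context extension in the style of de Bruijn: the innermost vertex variable is the right
  -- subtree, and outer variables are reached by `weaken`.
  _▹_ : (e : Γ → Tree) (n : Γ → ℕ) → Σ Γ (Fin ∘ n) → Tree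
  (e ▹ n) (γ , u) = node (e γ) (unit u)

  Vertices : (e : Γ → Tree) (n : Γ → ℕ) → Set
  Vertices e n = e ⊨ (λ γ → listᴱ unit (allFin (n γ)))

  weaken : {e o : Γ → Tree} {n : Γ → ℕ} → e ⊨ o → e ▹ n ⊨ o ∘ proj₁
  weaken f = ⊨-hd ⨟ ⊨-reindex proj₁ f

  module _ {Γ : Set} {e : Γ → Tree} {n : Γ → ℕ} where

    var : e ▹ n ⊨ (λ (_ , u) → unit u)
    var = ⊨-tl

    ⊨-anyᶠ : {p : ∀ γ → Fin (n γ) → Bool} → Vertices e n → e ▹ n ⊨ (λ (γ , u) → encodeBool (p γ u)) →
             e ⊨ (λ γ → encodeBool (anyᶠ (p γ)))
    ⊨-anyᶠ = ⊨-any

    ⊨-countᶠ : {p : ∀ γ → Fin (n γ) → Bool} → Vertices e n → e ▹ n ⊨ (λ (γ , u) → encodeBool (p γ u)) →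
               e ⊨ (λ γ → encodeℕ (count (p γ)))
    ⊨-countᶠ = ⊨-count

    ⊨-set : {p : ∀ γ → Fin (n γ) → Bool} → Vertices e n → e ▹ n ⊨ (λ (γ , u) → encodeBool (p γ u)) →
            e ⊨ (λ γ → setᴱ (p γ))
    ⊨-set = ⊨-map

    ⊨-rel : {p : ∀ γ → Rel (n γ)} → Vertices e n →
            (e ▹ n) ▹ (n ∘ proj₁) ⊨ (λ ((γ , u) , v) → encodeBool (p γ u v)) → e ⊨ (λ γ → relᴱ (p γ))
    ⊨-rel vs f = ⊨-map vs (⊨-map (weaken vs) f)

    opaque
      -- The characteristic vector of a vertex is exactly the list of flags that selects its entry
      -- in a table.
      ⊨-at : {x : ∀ γ → Fin (n γ) → Tree} {u : ∀ γ → Fin (n γ)} →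
        e ⊨ (λ γ → listᴱ (x γ) (allFin (n γ))) → e ⊨ (λ γ → unit (u γ)) → e ⊨ (λ γ → x γ (u γ))
      ⊨-at {x} {u} table vertex =
        ⊨-cong (λ γ → pick-unique (u γ ==_) (x γ) id (u γ) leaf (λ _ → refl)) (⊨-pick (⊨-cong (λ γ → unit≡ (u γ)) vertex) table)

    ⊨-∈ : {S : ∀ γ → Fin (n γ) → Bool} {u : ∀ γ → Fin (n γ)} →
      e ⊨ (λ γ → setᴱ (S γ)) → e ⊨ (λ γ → unit (u γ)) → e ⊨ (λ γ → encodeBool (S γ (u γ)))
    ⊨-∈ {S} = ⊨-at {x = λ γ → encodeBool ∘ S γ}

    ⊨-at₂ : {R : ∀ γ → Rel (n γ)} {u v : ∀ γ → Fin (n γ)} →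
      e ⊨ (λ γ → relᴱ (R γ)) → e ⊨ (λ γ → unit (u γ)) → e ⊨ (λ γ → unit (v γ)) → e ⊨ (λ γ → encodeBool (R γ (u γ) (v γ)))
    ⊨-at₂ {R} {u} r f g = ⊨-∈ (⊨-at {x = λ γ u → setᴱ (R γ u)} r f) g

    ⊨-== : {u v : ∀ γ → Fin (n γ)} →
      e ⊨ (λ γ → unit (u γ)) → e ⊨ (λ γ → unit (v γ)) → e ⊨ (λ γ → encodeBool (u γ == v γ))
    ⊨-== {u} f g = ⊨-∈ {λ γ → u γ ==_} (⊨-cong (λ γ → unit≡ (u γ)) f) g

  module _ {Γ : Set} {e : Γ → Tree} {n : Γ → ℕ} where

    ⊨-least : {p : ∀ γ → Fin (n γ) → Bool} {v : ∀ γ → Fin (n γ)} → Vertices e n →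
      e ⊨ (λ γ → relᴱ {n γ} (λ u v → v ≺ u)) →
      e ▹ n ⊨ (λ (γ , u) → encodeBool (p γ u)) → e ⊨ (λ γ → unit (v γ)) → e ⊨ (λ γ → encodeBool (least (p γ) (v γ)))
    ⊨-least {p} {v} vs ord f g = ⊨-∧ (⊨-∈ {S = p} (⊨-set vs f) g)
      (⊨-not (⊨-anyᶠ vs (⊨-∧ (⊨-at₂ {R = λ _ u v → v ≺ u} (weaken ord) (weaken g) var) f)))

-- The reduction algorithm as a program

module ReductionProgram where

  open Programs
  open ListPrograms
  open VertexPrograms
  open Algorithm

  open Input

  length-cons-all : ∀ {A : Set} (As : List (List A)) xs → length (cartesianProductWith (λ A x → x ∷ A) As xs) ≡ length As * length xs
  length-cons-all []       xs = refl
  length-cons-all (A ∷ As) xs = trans (List.length-++ (map (_∷ A) xs)) (cong₂ _+_ (List.length-map _ xs) (length-cons-all As xs))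

  -- A program knows a vertex only as a vector, so the list of all vertices and their order have to
  -- be available as tables, like the edges. Row u of `orderᴾ` is the set of predecessors of u.
  record Base {Γ : Set} (e : Γ → Tree) (I : Γ → Input) : Set where
    field
      verticesᴾ : Vertices e (order ∘ I)
      orderᴾ    : e ⊨ (λ γ → relᴱ {order (I γ)} (λ u v → v ≺ u))
      edgeᴾ     : e ⊨ (λ γ → relᴱ (edge (I γ)))
      kᴾ        : e ⊨ (λ γ → encodeℕ (k (I γ)))
      dᴾ        : e ⊨ (λ γ → encodeℕ (d (I γ)))

  open Base

  Base-reindex : {Γ Δ : Set} {e : Γ → Tree} {e′ : Δ → Tree} {I : Γ → Input} (h : Δ → Γ) → e′ ⊨ e ∘ h → Base e I → Base e′ (I ∘ h)
  Base-reindex h p B = record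
    { verticesᴾ = p ⨟ ⊨-reindex h (verticesᴾ B)
    ; orderᴾ    = p ⨟ ⊨-reindex h (orderᴾ B)
    ; edgeᴾ     = p ⨟ ⊨-reindex h (edgeᴾ B)
    ; kᴾ        = p ⨟ ⊨-reindex h (kᴾ B)
    ; dᴾ        = p ⨟ ⊨-reindex h (dᴾ B)
    }

  module _ {Γ : Set} {e : Γ → Tree} {I : Γ → Input} where

    Base-▹ : {n : Γ → ℕ} → Base e I → Base (e ▹ n) (I ∘ proj₁)
    Base-▹ = Base-reindex proj₁ ⊨-hd

    Kᴾ : Base e I → e ⊨ (λ γ → encodeℕ (Kernel.K (I γ)))
    Kᴾ B = ⊨-node ⊨-leaf (⊨-+ (kᴾ B) (kᴾ B))

    ⊨-edge : Base e I → {u v : ∀ γ → Fin (order (I γ))} → e ⊨ (λ γ → unit (u γ)) → e ⊨ (λ γ → unit (v γ)) →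
      e ⊨ (λ γ → encodeBool (edge (I γ) (u γ) (v γ)))
    ⊨-edge B = ⊨-at₂ {R = λ γ → edge (I γ)} (edgeᴾ B)

    ⊨-≺ : Base e I → {u v : ∀ γ → Fin (order (I γ))} → e ⊨ (λ γ → unit (u γ)) → e ⊨ (λ γ → unit (v γ)) →
      e ⊨ (λ γ → encodeBool (u γ ≺ v γ))
    ⊨-≺ B f g = ⊨-at₂ {R = λ γ u v → v ≺ u} (orderᴾ B) g f

  module _ {Γ : Set} {e : Γ → Tree} {I : Γ → Input} (B : Base e I) where

    opaque
      ⊨-heavy : {x : ∀ γ → Fin (order (I γ))} → e ⊨ (λ γ → unit (x γ)) → e ⊨ (λ γ → encodeBool (Kernel.heavy (I γ) (x γ)))
      ⊨-heavy x = ⊨-<ᵇ (Kᴾ B) (⊨-countᶠ (verticesᴾ B) (⊨-not (⊨-edge (Base-▹ B) (weaken x) var)))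

  module _ {Γ : Set} {e : Γ → Tree} {I : Γ → Input} (B : Base e I) where

    opaque
      ⊨-quiet : {x : ∀ γ → Fin (order (I γ))} → e ⊨ (λ γ → unit (x γ)) → e ⊨ (λ γ → encodeBool (Kernel.quiet (I γ) (x γ)))
      ⊨-quiet {x = x} xᴾ = ⊨-∧ (⊨-not (⊨-heavy B xᴾ)) (⊨-not (⊨-anyᶠ (verticesᴾ B)
        (⊨-∧ (⊨-not (⊨-heavy (Base-▹ B) var))
          (⊨-∧ (⊨-not (⊨-edge (Base-▹ B) (weaken xᴾ) var)) (⊨-not (⊨-== {u = λ (γ , _) → x γ} (weaken xᴾ) var))))))

  module _ {Γ : Set} {e : Γ → Tree} {I : Γ → Input} (B : Base e I) where

    private module 𝕂 γ = Kernel (I γ)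

    opaque
      ⊨-infeasible : e ⊨ (λ γ → encodeBool (𝕂.infeasible γ))
      ⊨-infeasible = ⊨-∨ (⊨-not (⊨-<ᵇ (⊨-countᶠ (verticesᴾ B) (⊨-heavy (Base-▹ B) var)) (Kᴾ B)))
        (⊨-not (⊨-<ᵇ (⊨-countᶠ (verticesᴾ B)
          (⊨-∧ (⊨-not (⊨-heavy (Base-▹ B) var)) (⊨-not (⊨-quiet (Base-▹ B) var)))) (⊨-* (Kᴾ B) (Kᴾ B))))

    ⊨-early : {S : ∀ γ → Fin (order (I γ)) → Bool} {v : ∀ γ → Fin (order (I γ))} →
      e ⊨ (λ γ → setᴱ (S γ)) → e ⊨ (λ γ → unit (v γ)) → e ⊨ (λ γ → encodeBool (𝕂.early γ (S γ) (v γ)))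
    ⊨-early {S} {v} Sᴾ vᴾ = ⊨-∧ (⊨-∈ {S = S} Sᴾ vᴾ) (⊨-<ᵇ
      (⊨-countᶠ {p = λ γ w → w ≺ v γ ∧ S γ w} (verticesᴾ B) (⊨-∧ (⊨-≺ (Base-▹ B) var (weaken vᴾ)) (⊨-∈ {S = λ (γ , _) → S γ} (weaken Sᴾ) var))) (Kᴾ B))

    -- A tuple is stored as the set of quiet vertices that avoid it. This is all that `marked` asks
    -- of a tuple, and the set for `x ∷ A` is the one for `A` without the neighbours of `x`.
    tuplesᴱ : ∀ γ → List (List (Fin (order (I γ)))) → Tree
    tuplesᴱ γ = listᴱ (λ A → setᴱ (𝕂.avoiding γ A))

    opaque
      ⊨-heavies : e ⊨ (λ γ → listᴱ unit (𝕂.heavies γ))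
      ⊨-heavies = ⊨-filter (verticesᴾ B) (⊨-heavy (Base-▹ B) var)

    orderᴺ : e ⊨ (λ γ → encodeℕ (order (I γ)))
    orderᴺ = ⊨-cong (λ γ → cong encodeℕ (List.length-tabulate {n = order (I γ)} id)) (⊨-length (verticesᴾ B))

  module _ {Γ : Set} {e : Γ → Tree} {I : Γ → Input} (B : Base e I) where

    private
      module 𝕂 γ = Kernel (I γ)
      Tuples : Γ → Set
      Tuples γ = List (List (Fin (order (I γ))))
      stepᴱ : Σ Γ Tuples → Tree
      stepᴱ (γ , As) = node (e γ) (tuplesᴱ B γ As)
      B′ : Base stepᴱ (I ∘ proj₁)
      B′ = Base-reindex proj₁ ⊨-hd B

      cons-all : ∀ {n} → List (List (Fin n)) → List (Fin n) → List (List (Fin n))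
      cons-all As xs = cartesianProductWith (λ A x → x ∷ A) As xs

      as-foldr : ∀ {n} (As : List (List (Fin n))) xs → foldr (λ A acc → map (_∷ A) xs ++ acc) [] As ≡ cons-all As xs
      as-foldr []       xs = refl
      as-foldr (A ∷ As) xs = cong (map (_∷ A) xs ++_) (as-foldr As xs)

      count≤ : ∀ {A : Set} (p : A → Bool) xs → length (filterᵇ p xs) ≤ length xs
      count≤ p []       = z≤n
      count≤ p (x ∷ xs) with p x
      ... | true  = s≤s (count≤ p xs)
      ... | false = m≤n⇒m≤1+n (count≤ p xs)

      heavies≤ : ∀ γ → length (𝕂.heavies γ) ≤ order (I γ)
      heavies≤ γ = ≤-trans (count≤ (𝕂.heavy γ) (allFin _)) (≤-reflexive (List.length-tabulate id))

      size-tuples : ∀ γ As → size (tuplesᴱ B γ As) ≤ suc (length As * suc (suc (order (I γ) * 4)))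
      size-tuples γ As = size-listᴱ (λ _ → leaf) As ≤-refl (λ A _ → size-setᴱ (𝕂.avoiding γ A))

      order≤ : Poly e (order ∘ I)
      order≤ = poly-≤ (λ γ → ≤-trans (m≤n⇒m≤1+n (m≤m+n _ _)) (≤-reflexive (sym (size-encodeℕ (order (I γ)))))) (out-poly (orderᴺ B))

    private
      -- A list is extended only while it has fewer than n entries, and each entry then contributes
      -- at most n new ones. The bound is free of j, which keeps the time polynomial in d.
      length-tuples : ∀ γ j → length (𝕂.tuples γ j) ≤ suc (order (I γ) + order (I γ) * order (I γ))
      length-tuples γ zero    = s≤s z≤n
      length-tuples γ (suc j) with length (𝕂.tuples γ j) <ᵇ order (I γ) in eq
      ... | false = length-tuples γ j
      ... | true  = begin
        length (As ++ cons-all As H)        ≡⟨ List.length-++ As ⟩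
        length As + length (cons-all As H)  ≡⟨ cong (length As +_) (length-cons-all As H) ⟩
        length As + length As * length H    ≤⟨ +-mono-≤ short (*-mono-≤ short (heavies≤ γ)) ⟩
        order (I γ) + order (I γ) * order (I γ) ≤⟨ n≤1+n _ ⟩
        suc (order (I γ) + order (I γ) * order (I γ)) ∎
        where
        open ≤-Reasoning
        As = 𝕂.tuples γ j
        H = 𝕂.heavies γ
        short = <⇒≤ (<ᵇ⇒< (length As) (order (I γ)) (subst T (sym eq) _))

    opaque
      ⊨-grow : stepᴱ ⊨ (λ (γ , As) → tuplesᴱ B γ (𝕂.grow γ As))
      ⊨-grow = ⊨-choose {enc = λ (γ , _) → tuplesᴱ B γ} (⊨-<ᵇ (⊨-length ⊨-tl) (orderᴺ B′))
        (⊨-++ ⊨-tl (⊨-cong (λ (γ , As) → cong (tuplesᴱ B γ) (as-foldr As (𝕂.heavies γ)))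
          (⊨-foldr {S = λ (γ , _) → Tuples γ} {s₀ = λ _ → []} {encS = λ (γ , _) → tuplesᴱ B γ}
            (λ (γ , _) A acc → map (_∷ A) (𝕂.heavies γ) ++ acc)
            (λ (γ , As) → suc (length As * order (I γ) * suc (suc (order (I γ) * 4))))
            ⊨-leaf ⊨-tl
            (⊨-++ (⊨-cong (λ (_ , _ , A) → cong encodeList (List.map-∘ _))
                    (⊨-map {b = λ ((γ , _) , _ , A) x → setᴱ (𝕂.avoiding γ (x ∷ A))}
                      (⊨-hd ⨟ ⊨-reindex proj₁ (⊨-heavies B′))
                      (⊨-set (⊨-hd ⨟ ⊨-hd ⨟ ⊨-reindex (λ ((γ , _) , _) → γ) (verticesᴾ B′))
                        (⊨-∧ (⊨-not (⊨-edge (Base-reindex (λ (((γ , _) , _) , _) → γ) (⊨-hd ⨟ ⊨-hd ⨟ ⊨-hd) B′) (⊨-hd ⨟ ⊨-tl) var))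
                             (⊨-∈ {S = λ (((( γ , _) , _ , A) , _) , _) → 𝕂.avoiding γ A} (⊨-hd ⨟ ⊨-hd ⨟ ⊨-tl ⨟ ⊨-tl) var)))))
                  (⊨-tl ⨟ ⊨-hd))
            (poly-suc (poly-* (poly-* (poly-≤ (λ (γ , As) → length≤size _ As) (out-poly ⊨-tl)) on) (poly-suc (poly-suc (poly-* on (poly-const 4))))))
            (λ (γ , As) p q eq → begin
              size (tuplesᴱ B γ (foldr (λ A acc → map (_∷ A) (𝕂.heavies γ) ++ acc) [] q)) ≡⟨ cong (size ∘ tuplesᴱ B γ) (as-foldr q (𝕂.heavies γ)) ⟩
              size (tuplesᴱ B γ (cons-all q (𝕂.heavies γ))) ≤⟨ size-tuples γ (cons-all q (𝕂.heavies γ)) ⟩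
              suc (length (cons-all q (𝕂.heavies γ)) * _) ≡⟨ cong (λ z → suc (z * _)) (length-cons-all q (𝕂.heavies γ)) ⟩
              suc (length q * length (𝕂.heavies γ) * _) ≤⟨ s≤s (*-monoˡ-≤ _ (*-mono-≤ (suffix p q eq) (heavies≤ γ))) ⟩
              suc (length As * order (I γ) * suc (suc (order (I γ) * 4))) ∎))))
        ⊨-tl
        where
        open ≤-Reasoning
        on : Poly stepᴱ (order ∘ I ∘ proj₁)
        on = poly-∘ {m = e ∘ proj₁} (out-poly ⊨-hd) (degree order≤ , bounded order≤ ∘ proj₁)
        suffix : ∀ {A : Set} (p q : List A) {xs} → p ++ q ≡ xs → length q ≤ length xs
        suffix p q refl = ≤-trans (m≤n+m _ (length p)) (≤-reflexive (sym (List.length-++ p)))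

    opaque
      -- The parameter d is read from the environment in unary and merely counts the rounds.
      ⊨-tuples : e ⊨ (λ γ → tuplesᴱ B γ (𝕂.tuples γ (d (I γ))))
      ⊨-tuples = ⊨-iterate {S = Tuples} {encS = tuplesᴱ B} {s₀ = λ _ → [] ∷ []} 𝕂.tuples 𝕂.grow (λ _ → refl) (λ _ _ → refl)
        (λ γ → suc (suc (order (I γ) + order (I γ) * order (I γ)) * suc (suc (order (I γ) * 4))))
        (dᴾ B) (⊨-node (⊨-set (verticesᴾ B) (⊨-quiet (Base-▹ B) var)) ⊨-leaf) ⊨-grow
        (poly-suc (poly-* (poly-suc (poly-+ order≤ (poly-* order≤ order≤))) (poly-suc (poly-suc (poly-* order≤ (poly-const 4))))))
        (λ γ j _ → ≤-trans (size-tuples γ (𝕂.tuples γ j)) (s≤s (*-monoˡ-≤ _ (length-tuples γ j))))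

  module _ {Γ : Set} {e : Γ → Tree} {I : Γ → Input} (B : Base e I) where

    private module 𝕂 γ = Kernel (I γ)

    opaque
      ⊨-marked : {v : ∀ γ → Fin (order (I γ))} → e ⊨ (λ γ → unit (v γ)) → e ⊨ (λ γ → encodeBool (𝕂.marked γ (v γ)))
      ⊨-marked {v} vᴾ = ⊨-∨ (⊨-not (⊨-quiet B vᴾ)) (⊨-∨ (⊨-not (⊨-<ᵇ (⊨-length (⊨-tuples B)) (orderᴺ B)))
        (⊨-∨ (⊨-any (⊨-tuples B) (⊨-early (Base-reindex proj₁ ⊨-hd B) {S = λ (γ , A) → 𝕂.avoiding γ A} ⊨-tl (⊨-hd ⨟ ⊨-reindex proj₁ vᴾ)))
          (⊨-anyᶠ (verticesᴾ B) (⊨-∧ (⊨-heavy (Base-▹ B) var)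
            (⊨-early (Base-▹ B) {S = λ (γ , x) → 𝕂.quietNbr γ x}
              (⊨-set (weaken (verticesᴾ B)) (⊨-∧ (⊨-quiet (Base-▹ (Base-▹ B)) var) (⊨-edge (Base-▹ (Base-▹ B)) (weaken var) var)))
              (weaken vᴾ))))))

    opaque
      ⊨-keep : {v : ∀ γ → Fin (order (I γ))} → e ⊨ (λ γ → unit (v γ)) → e ⊨ (λ γ → encodeBool (𝕂.keep γ (v γ)))
      ⊨-keep {v} vᴾ = ⊨-cong (λ γ → cong encodeBool (sym (𝕂.keep≡ γ (v γ)))) (⊨-choose {enc = λ _ → encodeBool} (⊨-infeasible B)
        (⊨-not (⊨-anyᶠ (verticesᴾ B) (⊨-≺ (Base-▹ B) var (weaken vᴾ)))) (⊨-marked vᴾ))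

  module _ {Γ : Set} {e : Γ → Tree} {I : Γ → Input} (B : Base e I) where

    private module 𝕂 γ = Kernel (I γ)

    opaque
      ⊨-kept : e ⊨ (λ γ → listᴱ unit (𝕂.kept γ))
      ⊨-kept = ⊨-filter (verticesᴾ B) (⊨-keep (Base-▹ B) var)

    opaque
      ⊨-induced : e ⊨ (λ γ → listᴱ (λ u → listᴱ (λ v → encodeBool (edge (I γ) u v)) (𝕂.kept γ)) (𝕂.kept γ))
      ⊨-induced = ⊨-map ⊨-kept (⊨-map (weaken ⊨-kept) (⊨-edge (Base-▹ (Base-▹ B)) (weaken var) var))

-- The solution lifting algorithm as a program

module LiftingProgram where

  open Programs
  open ListPrograms
  open VertexPrograms
  open ReductionProgram
  open Algorithm

  open Input
  open Base

  -- Every intermediate stage of Warshall's algorithm is again a table of n rows and n columns, so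
  -- its size is bounded whatever it contains.
  ⊨-closure : {Γ : Set} {e : Γ → Tree} {n : Γ → ℕ} {R : ∀ γ → Rel (n γ)} → Vertices e n →
    e ▹ n ▹ n ∘ proj₁ ⊨ (λ ((γ , u) , v) → encodeBool (R γ u v)) → e ⊨ (λ γ → relᴱ (closure (R γ)))
  ⊨-closure {Γ} {e} {n} {R} vs f =
    ⊨-foldr {S = Rel ∘ n} {s₀ = λ γ u v → u == v ∨ R γ u v} {l = allFin ∘ n} {encS = λ _ → relᴱ}
      (λ γ p C u v → C u v ∨ (C u p ∧ C p v)) (λ γ → suc (n γ * suc (suc (n γ * 4))))
      (⊨-rel vs (⊨-∨ (⊨-== (weaken var) var) f)) vs
      (⊨-rel (⊨-hd ⨟ ⊨-reindex proj₁ vs)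
        (⊨-∨ (⊨-at₂ {R = R′} C u v) (⊨-∧ (⊨-at₂ {R = R′} C u p) (⊨-at₂ {R = R′} C p v))))
      (poly-suc (poly-* n≤ (poly-suc (poly-suc (poly-* n≤ (poly-const 4))))))
      (λ γ _ q _ → size-relᴱ (foldr (λ p C u v → C u v ∨ (C u p ∧ C p v)) (λ u v → u == v ∨ R γ u v) q))
    where
    n≤ : Poly e n
    n≤ = poly-≤ (λ γ → ≤-trans (≤-reflexive (sym (List.length-tabulate id))) (length≤size unit (allFin (n γ)))) (out-poly vs)
    Γ₁ : Set
    Γ₁ = Σ Γ λ γ → Rel (n γ) × Fin (n γ)
    e₁ : Γ₁ → Tree
    e₁ (γ , C , p) = node (e γ) (node (relᴱ C) (unit p))
    n₁ : Γ₁ → ℕ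
    n₁ = n ∘ proj₁
    R′ : (((γ , _) , _) : Σ (Σ Γ₁ (Fin ∘ n₁)) (Fin ∘ n₁ ∘ proj₁)) → Rel (n (proj₁ γ))
    R′ (((_ , C , _) , _) , _) = C
    C : e₁ ▹ n₁ ▹ n₁ ∘ proj₁ ⊨ (λ γ → relᴱ (R′ γ))
    C = ⊨-hd ⨟ ⊨-hd ⨟ ⊨-tl ⨟ ⊨-hd
    p : e₁ ▹ n₁ ▹ n₁ ∘ proj₁ ⊨ (λ (((_ , _ , p) , _) , _) → unit p)
    p = ⊨-hd ⨟ ⊨-hd ⨟ ⊨-tl ⨟ ⊨-tl
    u : e₁ ▹ n₁ ▹ n₁ ∘ proj₁ ⊨ (λ ((_ , u) , _) → unit u)
    u = ⊨-hd ⨟ ⊨-tl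
    v : e₁ ▹ n₁ ▹ n₁ ∘ proj₁ ⊨ (λ (_ , v) → unit v)
    v = ⊨-tl

  record LiftBase {Γ : Set} (e : Γ → Tree) (I : Γ → Input) (F′ : ∀ γ → Rel (length (Kernel.kept (I γ)))) : Set where
    field
      base      : Base e I
      solutionᴾ : e ⊨ (λ γ → relᴱ (F′ γ))

  open LiftBase

  module _ {Γ : Set} {e : Γ → Tree} {I : Γ → Input} {F′ : ∀ γ → Rel (length (Kernel.kept (I γ)))} where

    LiftBase-▹ : {n : Γ → ℕ} → LiftBase e I F′ → LiftBase (e ▹ n) (I ∘ proj₁) (F′ ∘ proj₁)
    LiftBase-▹ B = record { base = Base-▹ (base B) ; solutionᴾ = weaken (solutionᴾ B) }

    module _ (B : LiftBase e I F′) where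

      private
        module 𝕃 γ = Kernel.Lift (I γ) (F′ γ)
        V : Γ → ℕ
        V = order ∘ I
        V′ : Γ → ℕ
        V′ γ = length (Kernel.kept (I γ))
        vs = verticesᴾ (base B)

      opaque
        ⊨-vertices′ : Vertices e V′
        ⊨-vertices′ = ⊨-cong (λ γ → cong encodeList (List.map-cong (λ u → sym (unit≡ u)) (allFin (V′ γ))))
          (⊨-trichotomy true false false (⊨-kept (base B)))

      opaque
        -- The list of kept vertices is already the table of `ι`: its entry at position i is the
        -- vector of `ι i`.
        ⊨-ι : {i : ∀ γ → Fin (V′ γ)} → e ⊨ (λ γ → unit (i γ)) → e ⊨ (λ γ → unit (𝕃.ι γ (i γ)))
        ⊨-ι = ⊨-at {x = λ γ i → unit (𝕃.ι γ i)} (⊨-cong (λ γ → sym (table (Kernel.kept (I γ)))) (⊨-kept (base B)))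
          where
          table : ∀ {n} (l : List (Fin n)) → listᴱ (unit ∘ lookup l) (allFin (length l)) ≡ listᴱ unit l
          table l = cong encodeList (trans (List.map-tabulate id (unit ∘ lookup l))
            (trans (sym (List.map-tabulate (lookup l) unit)) (cong (map unit) (List.tabulate-lookup l))))

  module _ {Γ : Set} {e : Γ → Tree} {I : Γ → Input} {F′ : ∀ γ → Rel (length (Kernel.kept (I γ)))} (B : LiftBase e I F′) where

    private
      module 𝕃 γ = Kernel.Lift (I γ) (F′ γ)
      V V′ : Γ → ℕ
      V = order ∘ I
      V′ γ = length (Kernel.kept (I γ))
      vs : Vertices e V
      vs = verticesᴾ (base B)

    opaque
      ⊨-F : {u v : ∀ γ → Fin (V γ)} → e ⊨ (λ γ → unit (u γ)) → e ⊨ (λ γ → unit (v γ)) →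
        e ⊨ (λ γ → encodeBool (𝕃.F γ (u γ) (v γ)))
      ⊨-F {u} {v} uᴾ vᴾ = ⊨-anyᶠ {n = V′} (⊨-vertices′ B) (⊨-∧ (⊨-== (⊨-ι (LiftBase-▹ B) var) (weaken uᴾ))
        (⊨-anyᶠ (weaken (⊨-vertices′ B)) (⊨-∧ (⊨-== (⊨-ι (LiftBase-▹ (LiftBase-▹ B)) var) (weaken (weaken vᴾ)))
          (⊨-at₂ {R = λ ((γ , _) , _) → F′ γ} (weaken (weaken (solutionᴾ B))) (weaken var) var))))

  module _ {Γ : Set} {e : Γ → Tree} {I : Γ → Input} {F′ : ∀ γ → Rel (length (Kernel.kept (I γ)))} (B : LiftBase e I F′) where

    private
      module 𝕃 γ = Kernel.Lift (I γ) (F′ γ)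
      V : Γ → ℕ
      V = order ∘ I
      vs : Vertices e V
      vs = verticesᴾ (base B)

    opaque
      ⊨-conn : {u v : ∀ γ → Fin (V γ)} → e ⊨ (λ γ → unit (u γ)) → e ⊨ (λ γ → unit (v γ)) →
        e ⊨ (λ γ → encodeBool (𝕃.conn γ (u γ) (v γ)))
      ⊨-conn = ⊨-at₂ {R = 𝕃.conn} (⊨-closure vs (⊨-F (LiftBase-▹ (LiftBase-▹ B)) (weaken var) var))

  module _ {Γ : Set} {e : Γ → Tree} {I : Γ → Input} {F′ : ∀ γ → Rel (length (Kernel.kept (I γ)))} (B : LiftBase e I F′) where

    private
      module 𝕃 γ = Kernel.Lift (I γ) (F′ γ)
      V : Γ → ℕ
      V = order ∘ I
      vs : Vertices e V
      vs = verticesᴾ (base B)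
      B₁ : LiftBase (e ▹ V) (I ∘ proj₁) (F′ ∘ proj₁)
      B₁ = LiftBase-▹ B
      B₂ : LiftBase (e ▹ V ▹ V ∘ proj₁) (I ∘ proj₁ ∘ proj₁) (F′ ∘ proj₁ ∘ proj₁)
      B₂ = LiftBase-▹ B₁

    opaque
      ⊨-rep : {r : ∀ γ → Fin (V γ)} → e ⊨ (λ γ → unit (r γ)) → e ⊨ (λ γ → encodeBool (𝕃.rep γ (r γ)))
      ⊨-rep r = ⊨-∧ (⊨-keep (base B) r) (⊨-∧
        (⊨-anyᶠ vs (⊨-∧ (⊨-not (⊨-keep (base B₁) var)) (⊨-not (⊨-anyᶠ (weaken vs)
          (⊨-∧ (⊨-conn B₂ (weaken (weaken r)) var) (⊨-edge (base B₂) var (weaken var)))))))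
        (⊨-not (⊨-anyᶠ vs (⊨-∧ (⊨-≺ (base B₁) var (weaken r)) (⊨-conn B₁ (weaken r) var)))))

  module _ {Γ : Set} {e : Γ → Tree} {I : Γ → Input} {F′ : ∀ γ → Rel (length (Kernel.kept (I γ)))} (B : LiftBase e I F′) where

    private module 𝕃 γ = Kernel.Lift (I γ) (F′ γ)

    ⊨-door : {r a b : ∀ γ → Fin (order (I γ))} → e ⊨ (λ γ → unit (r γ)) → e ⊨ (λ γ → unit (b γ)) → e ⊨ (λ γ → unit (a γ)) →
      e ⊨ (λ γ → encodeBool (𝕃.door γ (r γ) (b γ) (a γ)))
    ⊨-door r b a = ⊨-∧ (⊨-conn B r a) (⊨-edge (base B) a b)

  module _ {Γ : Set} {e : Γ → Tree} {I : Γ → Input} {F′ : ∀ γ → Rel (length (Kernel.kept (I γ)))} (B : LiftBase e I F′) where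

    private
      module 𝕃 γ = Kernel.Lift (I γ) (F′ γ)
      vs : Vertices e (order ∘ I)
      vs = verticesᴾ (base B)

    opaque
      ⊨-link : {r a b : ∀ γ → Fin (order (I γ))} → e ⊨ (λ γ → unit (r γ)) → e ⊨ (λ γ → unit (a γ)) → e ⊨ (λ γ → unit (b γ)) →
        e ⊨ (λ γ → encodeBool (𝕃.link γ (r γ) (a γ) (b γ)))
      ⊨-link r a b = ⊨-∧
        (⊨-least vs (orderᴾ (base B)) (⊨-∧ (⊨-quiet (base (LiftBase-▹ B)) var)
          (⊨-anyᶠ (weaken vs) (⊨-door (LiftBase-▹ (LiftBase-▹ B)) (weaken (weaken r)) (weaken var) var))) b)
        (⊨-least vs (orderᴾ (base B)) (⊨-door (LiftBase-▹ B) (weaken r) (weaken b) var) a)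

  module _ {Γ : Set} {e : Γ → Tree} {I : Γ → Input} {F′ : ∀ γ → Rel (length (Kernel.kept (I γ)))} (B : LiftBase e I F′) where

    private
      module 𝕃 γ = Kernel.Lift (I γ) (F′ γ)
      V : Γ → ℕ
      V = order ∘ I
      vs : Vertices e V
      vs = verticesᴾ (base B)
      B₁ : LiftBase (e ▹ V) (I ∘ proj₁) (F′ ∘ proj₁)
      B₁ = LiftBase-▹ B
      B₂ : LiftBase (e ▹ V ▹ V ∘ proj₁) (I ∘ proj₁ ∘ proj₁) (F′ ∘ proj₁ ∘ proj₁)
      B₂ = LiftBase-▹ B₁

    opaque
      ⊨-lifted : e ⊨ (λ γ → relᴱ (𝕃.lifted γ))
      ⊨-lifted = ⊨-rel vs (⊨-choose {enc = λ _ → encodeBool}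
        (weaken (weaken (⊨-∨ (⊨-infeasible (base B))
          (⊨-not (⊨-<ᵇ (⊨-countᶠ vs (⊨-anyᶠ (weaken vs) (⊨-F B₂ (weaken var) var))) (Kᴾ (base B)))))))
        (⊨-edge (base B₂) (weaken var) var)
        (⊨-∨ (⊨-F B₂ (weaken var) var) (⊨-anyᶠ (weaken (weaken vs)) (⊨-∧ (⊨-rep B₃ var)
          (⊨-∨ (⊨-link B₃ var (weaken (weaken var)) (weaken var)) (⊨-link B₃ var (weaken var) (weaken (weaken var))))))))
        where
        B₃ : LiftBase (e ▹ V ▹ V ∘ proj₁ ▹ V ∘ proj₁ ∘ proj₁) (I ∘ proj₁ ∘ proj₁ ∘ proj₁) (F′ ∘ proj₁ ∘ proj₁ ∘ proj₁)
        B₃ = LiftBase-▹ B₂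

-- Counting subsets of a finite set

module Counting where

  open import Algebra.Properties.CommutativeMonoid.Sum +-0-commutativeMonoid public using (sum; ∑-distrib-+; ∑-comm; sum-cong-≗)
  open ListPrograms using (anyᴸ; countᴸ)
  open Algorithm

  ∧⁺ : ∀ {a b} → T a → T b → T (a ∧ b)
  ∧⁺ {true} _ b = b

  ∧⁻ˡ : ∀ {a b} → T (a ∧ b) → T a
  ∧⁻ˡ {true} _ = _

  ∧⁻ʳ : ∀ {a b} → T (a ∧ b) → T b
  ∧⁻ʳ {true} b = b

  ∨⁺ˡ : ∀ {a b} → T a → T (a ∨ b)
  ∨⁺ˡ {true} _ = _

  ∨⁺ʳ : ∀ {a b} → T b → T (a ∨ b)
  ∨⁺ʳ {true}  _ = _
  ∨⁺ʳ {false} b = b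

  ∨⁻ : ∀ {a b} → T (a ∨ b) → T a ⊎ T b
  ∨⁻ {true}  _ = inj₁ _
  ∨⁻ {false} b = inj₂ b

  not⁺ : ∀ {a} → ¬ T a → T (not a)
  not⁺ {true}  ¬a = ¬a _
  not⁺ {false} _  = _

  not⁻ : ∀ {a} → T (not a) → ¬ T a
  not⁻ {false} _ ()

  ¬¬T : ∀ {a} → ¬ T (not a) → T a
  ¬¬T {true}  _ = _
  ¬¬T {false} h = h _

  T⇒≡ : ∀ {a} → T a → a ≡ true
  T⇒≡ {true} _ = refl

  ¬T⇒≡ : ∀ {a} → ¬ T a → a ≡ false
  ¬T⇒≡ {true}  h = ⊥-elim (h _)
  ¬T⇒≡ {false} _ = refl

  anyᴸ⁺ : ∀ {A : Set} (p : A → Bool) {x xs} → x ∈ xs → T (p x) → T (anyᴸ p xs)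
  anyᴸ⁺ p (here refl) px = ∨⁺ˡ px
  anyᴸ⁺ p {xs = y ∷ _} (there x∈) px = ∨⁺ʳ {p y} (anyᴸ⁺ p x∈ px)

  anyᴸ⁻ : ∀ {A : Set} (p : A → Bool) xs → T (anyᴸ p xs) → ∃[ x ] (x ∈ xs × T (p x))
  anyᴸ⁻ p (x ∷ xs) h with ∨⁻ {p x} h
  ... | inj₁ px = x , here refl , px
  ... | inj₂ h′ = let (y , y∈ , py) = anyᴸ⁻ p xs h′ in y , there y∈ , py

  module _ {n} (p : Fin n → Bool) where

    anyᶠ⁺ : ∀ i → T (p i) → T (anyᶠ p)
    anyᶠ⁺ i = anyᴸ⁺ p (∈-allFin i)

    anyᶠ⁻ : T (anyᶠ p) → ∃[ i ] T (p i)
    anyᶠ⁻ h = let (i , _ , pi) = anyᴸ⁻ p (allFin n) h in i , pi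

  ==⇒≡ : ∀ {n} {u v : Fin n} → T (u == v) → u ≡ v
  ==⇒≡ {u = zero}  {zero}  _ = refl
  ==⇒≡ {u = suc u} {suc v} h = cong suc (==⇒≡ h)

  ==-refl : ∀ {n} (u : Fin n) → T (u == u)
  ==-refl zero    = _
  ==-refl (suc u) = ==-refl u

  ≡⇒== : ∀ {n} {u v : Fin n} → u ≡ v → T (u == v)
  ≡⇒== {u = u} refl = ==-refl u

  ≺⇒< : ∀ {n} {u v : Fin n} → T (u ≺ v) → u Fin.< v
  ≺⇒< {u = zero}  {suc v} _ = s≤s z≤n
  ≺⇒< {u = suc u} {suc v} h = s≤s (≺⇒< h)

  <⇒≺ : ∀ {n} {u v : Fin n} → u Fin.< v → T (u ≺ v)
  <⇒≺ {u = zero}  {suc v} _       = _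
  <⇒≺ {u = suc u} {suc v} (s≤s h) = <⇒≺ h
  module _ {n} (p : Fin n → Bool) where

    least-∈ : ∀ {v} → T (least p v) → T (p v)
    least-∈ = ∧⁻ˡ

    least-≮ : ∀ {v} → T (least p v) → ∀ {w} → T (w ≺ v) → ¬ T (p w)
    least-≮ {v} h {w} w≺v pw = not⁻ (∧⁻ʳ {p v} h) (anyᶠ⁺ (λ w → w ≺ v ∧ p w) w (∧⁺ w≺v pw))

    least-unique : ∀ {v w} → T (least p v) → T (least p w) → v ≡ w
    least-unique {v} {w} lv lw with Fin.<-cmp v w
    ... | tri< v<w _ _ = ⊥-elim (least-≮ lw (<⇒≺ v<w) (least-∈ lv))
    ... | tri≈ _ v≡w _ = v≡w
    ... | tri> _ _ w<v = ⊥-elim (least-≮ lv (<⇒≺ w<v) (least-∈ lw))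

    least-exists : ∀ {v} → T (p v) → ∃[ w ] T (least p w)
    least-exists {v} = go (suc (toℕ v)) v ≤-refl
      where
      go : ∀ m v → toℕ v < m → T (p v) → ∃[ w ] T (least p w)
      go (suc m) v (s≤s v≤m) pv with T? (anyᶠ λ w → w ≺ v ∧ p w)
      ... | no ¬smaller = v , ∧⁺ pv (not⁺ ¬smaller)
      ... | yes smaller = let (w , h) = anyᶠ⁻ (λ w → w ≺ v ∧ p w) smaller in
        go m w (≤-trans (≺⇒< {u = w} {v} (∧⁻ˡ h)) v≤m) (∧⁻ʳ {w ≺ v} h)
  ^-distribʳ-* : ∀ m a b → (a * b) ^ m ≡ a ^ m * b ^ m
  ^-distribʳ-* zero    a b = refl
  ^-distribʳ-* (suc m) a b = trans (cong (a * b *_) (^-distribʳ-* m a b)) ([m*n]*[o*p]≡[m*o]*[n*p] a b (a ^ m) (b ^ m))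

  sum-mono : ∀ {n} {f g : Fin n → ℕ} → (∀ i → f i ≤ g i) → sum f ≤ sum g
  sum-mono {zero}  f≤g = z≤n
  sum-mono {suc n} f≤g = +-mono-≤ (f≤g zero) (sum-mono (f≤g ∘ suc))

  term≤sum : ∀ {n} (f : Fin n → ℕ) i → f i ≤ sum f
  term≤sum f zero    = m≤m+n _ _
  term≤sum f (suc i) = ≤-trans (term≤sum (f ∘ suc) i) (m≤n+m _ (f zero))

  sum-*ʳ : ∀ {n} (f : Fin n → ℕ) c → sum (λ i → f i * c) ≡ sum f * c
  sum-*ʳ {zero}  f c = refl
  sum-*ʳ {suc n} f c = trans (cong (f zero * c +_) (sum-*ʳ (f ∘ suc) c)) (sym (*-distribʳ-+ c (f zero) (sum (f ∘ suc))))

  sum-zero : ∀ {n} → sum {n} (λ _ → 0) ≡ 0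
  sum-zero {zero}  = refl
  sum-zero {suc n} = sum-zero {n}

  bit : Bool → ℕ
  bit false = 0
  bit true  = 1

  bit-mono : ∀ {a b} → (T a → T b) → bit a ≤ bit b
  bit-mono {false} h = z≤n
  bit-mono {true} {true}  h = ≤-refl
  bit-mono {true} {false} h = ⊥-elim (h _)

  bit≤1 : ∀ b → bit b ≤ 1
  bit≤1 false = z≤n
  bit≤1 true  = ≤-refl

  count-sum : ∀ {n} (p : Fin n → Bool) → count p ≡ sum (bit ∘ p)
  count-sum p = go p id
    where
    go : ∀ {n} {A : Set} (p : A → Bool) (g : Fin n → A) → countᴸ p (tabulate g) ≡ sum (bit ∘ p ∘ g)
    go {zero}  p g = refl
    go {suc n} p g with p (g zero)
    ... | true  = cong suc (go p (g ∘ suc))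
    ... | false = go p (g ∘ suc)

  count≤n : ∀ {n} (p : Fin n → Bool) → count p ≤ n
  count≤n p = ≤-trans (≤-reflexive (count-sum p)) (≤-trans (sum-mono (bit≤1 ∘ p)) (≤-reflexive (ones _)))
    where
    ones : ∀ n → sum {n} (λ _ → 1) ≡ n
    ones zero    = refl
    ones (suc n) = cong suc (ones n)

  count-mono : ∀ {n} {p q : Fin n → Bool} → (∀ i → T (p i) → T (q i)) → count p ≤ count q
  count-mono {p = p} {q} h = subst (_≤ count q) (sym (count-sum p))
    (≤-trans (sum-mono (λ i → bit-mono (h i))) (≤-reflexive (sym (count-sum q))))

  count-cong : ∀ {n} {p q : Fin n → Bool} → (∀ i → p i ≡ q i) → count p ≡ count q
  count-cong {p = p} {q} h = trans (count-sum p) (trans (sum-cong-≗ (cong bit ∘ h)) (sym (count-sum q)))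

  pigeonhole : ∀ {n} (p q : Fin n → Bool) → count q < count p → ∃[ i ] (T (p i) × ¬ T (q i))
  pigeonhole p q q<p with T? (anyᶠ λ i → p i ∧ not (q i))
  ... | yes h = let (i , pq) = anyᶠ⁻ (λ i → p i ∧ not (q i)) h in i , ∧⁻ˡ pq , not⁻ (∧⁻ʳ {p i} pq)
  ... | no ¬h = ⊥-elim (<⇒≱ q<p (count-mono λ i pi → ¬¬T λ ¬qi → ¬h (anyᶠ⁺ (λ i → p i ∧ not (q i)) i (∧⁺ pi ¬qi))))

  union-bound : ∀ {m n} (p : Fin n → Bool) (q : Fin m → Bool) (r : Fin m → Fin n → Bool) {M} →
    (∀ x → T (p x) → ∃[ t ] (T (q t) × T (r t x))) → (∀ t → T (q t) → count (r t) ≤ M) →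
    count p ≤ count q * M
  union-bound {n = n} p q r {M} cover small = begin
    count p                                   ≡⟨ count-sum p ⟩
    sum (λ x → bit (p x))                     ≤⟨ sum-mono bound ⟩
    sum (λ x → sum λ t → bit (q t ∧ r t x))   ≡⟨ ∑-comm (λ x t → bit (q t ∧ r t x)) ⟩
    sum (λ t → sum λ x → bit (q t ∧ r t x))   ≤⟨ sum-mono each ⟩
    sum (λ t → bit (q t) * M)                 ≡⟨ sum-*ʳ (bit ∘ q) M ⟩
    sum (bit ∘ q) * M                         ≡⟨ cong (_* M) (sym (count-sum q)) ⟩
    count q * M                               ∎
    where
    open ≤-Reasoning
    bound : ∀ x → bit (p x) ≤ sum λ t → bit (q t ∧ r t x)
    bound x with p x in eq
    ... | false = z≤n
    ... | true  = let (t , qt , rt) = cover x (subst T (sym eq) _) in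
      ≤-trans (≤-reflexive (cong bit (sym (T⇒≡ (∧⁺ {q t} qt rt))))) (term≤sum (λ t → bit (q t ∧ r t x)) t)
    each : ∀ t → sum (λ x → bit (q t ∧ r t x)) ≤ bit (q t) * M
    each t with q t in eq
    ... | false = ≤-reflexive (sum-zero {n})
    ... | true  = ≤-trans (≤-reflexive (sym (count-sum (r t)))) (≤-trans (small t (subst T (sym eq) _)) (m≤m+n M 0))

  count-union : ∀ {n} {p q r : Fin n → Bool} → (∀ x → T (p x) → T (q x) ⊎ T (r x)) → count p ≤ count q + count r
  count-union {p = p} {q} {r} h = begin
    count p                          ≡⟨ count-sum p ⟩
    sum (bit ∘ p)                    ≤⟨ sum-mono each ⟩
    sum (λ x → bit (q x) + bit (r x)) ≡⟨ ∑-distrib-+ (bit ∘ q) (bit ∘ r) ⟩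
    sum (bit ∘ q) + sum (bit ∘ r)    ≡⟨ cong₂ _+_ (count-sum q) (count-sum r) ⟨
    count q + count r                ∎
    where
    open ≤-Reasoning
    each : ∀ x → bit (p x) ≤ bit (q x) + bit (r x)
    each x with p x in eq
    ... | false = z≤n
    ... | true with h x (subst T (sym eq) _)
    ...   | inj₁ qx = ≤-trans (≤-reflexive (cong bit (sym (T⇒≡ qx)))) (m≤m+n _ _)
    ...   | inj₂ rx = ≤-trans (≤-reflexive (cong bit (sym (T⇒≡ rx)))) (m≤n+m _ _)

  count-unique : ∀ {n} (p : Fin n → Bool) → (∀ {i j} → T (p i) → T (p j) → i ≡ j) → count p ≤ 1
  count-unique p uniq = subst (_≤ 1) (sym (count-sum p)) (go p uniq)
    where
    go : ∀ {n} (p : Fin n → Bool) → (∀ {i j} → T (p i) → T (p j) → i ≡ j) → sum (bit ∘ p) ≤ 1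
    go {zero}  p uniq = z≤n
    go {suc n} p uniq with p zero in eq
    ... | false = go (p ∘ suc) (λ a b → Fin.suc-injective (uniq a b))
    ... | true  = s≤s (≤-trans (sum-mono {g = λ _ → 0} λ i → ≤-reflexive (cong bit (¬T⇒≡ λ pi →
      Fin.0≢1+n (uniq {zero} {suc i} (subst T (sym eq) _) pi)))) (≤-reflexive (sum-zero {n})))

  count-== : ∀ {n} (u : Fin n) → count (u ==_) ≤ 1
  count-== u = count-unique (u ==_) λ {i} {j} u=i u=j → trans (sym (==⇒≡ {u = u} {i} u=i)) (==⇒≡ {u = u} {j} u=j)

  length-filter : ∀ {n} (p : Fin n → Bool) → length (filterᵇ p (allFin n)) ≡ count p
  length-filter p = go (allFin _)
    where
    go : ∀ xs → length (filterᵇ p xs) ≡ countᴸ p xs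
    go []       = refl
    go (x ∷ xs) with p x
    ... | true  = cong suc (go xs)
    ... | false = go xs

  count-prefix : ∀ K {n} (S : Fin n → Bool) → count (λ v → S v ∧ (count (λ w → w ≺ v ∧ S w) <ᵇ K)) ≤ K
  count-prefix K S = ≤-trans (≤-reflexive (trans (count-cong λ v → cong (λ c → S v ∧ (c <ᵇ K)) (count-sum λ w → w ≺ v ∧ S w))
    (count-sum λ v → S v ∧ (sum (λ w → bit (w ≺ v ∧ S w)) <ᵇ K)))) (go K S)
    where
    go : ∀ K {n} (S : Fin n → Bool) → sum (λ v → bit (S v ∧ (sum (λ w → bit (w ≺ v ∧ S w)) <ᵇ K))) ≤ K
    go K {zero}  S = z≤n
    go zero    {suc n} S = ≤-trans
      (sum-mono {g = λ _ → 0} λ v → bit-mono {S v ∧ (sum (λ w → bit (w ≺ v ∧ S w)) <ᵇ 0)} {false} (∧⁻ʳ {S v}))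
      (≤-reflexive (sum-zero {suc n}))
    go (suc K) {suc n} S with S zero
    ... | false = go (suc K) (S ∘ suc)
    -- If vertex 0 lies in S, it precedes all other members and takes one of the places, which
    -- leaves the same claim with one place fewer for the remaining vertices.
    ... | true  = +-mono-≤ (bit≤1 (sum {n} (λ _ → 0) <ᵇ suc K)) (go K (S ∘ suc))

  -- The first K members of S include one outside t, for lack of room in t.
  prefix-escapes : ∀ {n} (S t : Fin n → Bool) {K v} → count t < K → T (S v) →
    ¬ T (t v) ⊎ ¬ T (S v ∧ (count (λ w → w ≺ v ∧ S w) <ᵇ K)) →
    ∃[ y ] (T (S y ∧ (count (λ w → w ≺ y ∧ S w) <ᵇ K)) × ¬ T (t y))
  prefix-escapes {n} S t {K} {v} t<K Sv (inj₁ ¬tv) =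
    -- Since y is the least member of S outside t, all members before it lie in t, so there are
    -- fewer than K of them.
    let (y , ly) = least-exists out (∧⁺ Sv (not⁺ ¬tv)); y∈ = least-∈ out ly in
    y , ∧⁺ (∧⁻ˡ {S y} y∈) (<⇒<ᵇ (≤-trans (s≤s (count-mono λ w h → ¬¬T λ ¬tw →
      least-≮ out ly (∧⁻ˡ {w ≺ y} h) (∧⁺ (∧⁻ʳ {w ≺ y} h) ¬tw))) t<K)) , not⁻ (∧⁻ʳ {S y} y∈)
    where
    out : Fin n → Bool
    out w = S w ∧ not (t w)
  prefix-escapes S t {K} {v} t<K Sv (inj₂ late) =
    -- If v is late, at least K members of S precede it. They do not all fit into t, and one that is
    -- left out falls under the first case.
    let (w , h , ¬tw) = pigeonhole (λ w → w ≺ v ∧ S w) t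
          (≤-trans t<K (≮⇒≥ λ few → late (∧⁺ Sv (<⇒<ᵇ few))))
    in prefix-escapes S t t<K (∧⁻ʳ {w ≺ v} h) (inj₁ ¬tw)

-- Reachability, edge counts and component sizes

module GraphTheory where

  open ListPrograms using (anyᴸ; countᴸ)
  open Algorithm
  open Counting

  Path : ∀ {n} → Rel n → Fin n → Fin n → Set
  Path R = Star (λ u v → T (R u v))

  module _ {n} (R : Rel n) where

    private
      base : Rel n
      base u v = u == v ∨ R u v

      step : Fin n → Rel n → Rel n
      step p C u v = C u v ∨ (C u p ∧ C p v)

    closure-sound : ∀ {u v} → T (closure R u v) → Path R u v
    closure-sound = go (allFin n)
      where
      go : ∀ ps {u v} → T (foldr step base ps u v) → Path R u v
      go [] {u} {v} h with ∨⁻ {u == v} h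
      ... | inj₁ eq = subst (Path R u) (==⇒≡ eq) ∎ᵖ
      ... | inj₂ r  = r ◅ ∎ᵖ
      go (p ∷ ps) {u} {v} h with ∨⁻ {foldr step base ps u v} h
      ... | inj₁ c = go ps c
      ... | inj₂ c = go ps (∧⁻ˡ c) ◅◅ go ps (∧⁻ʳ {foldr step base ps u p} c)

    private
      includes : ∀ ps {u v} → T (base u v) → T (foldr step base ps u v)
      includes []       b = b
      includes (p ∷ ps) b = ∨⁺ˡ (includes ps b)

      -- Warshall's invariant: after the pivots ps, the relation is transitive through every member of ps.
      through : ∀ ps {w u v} → w ∈ ps → T (foldr step base ps u w) → T (foldr step base ps w v) → T (foldr step base ps u v)
      through (p ∷ ps) {w} {u} {v} w∈ uw wv with w∈ | ∨⁻ {foldr step base ps u w} uw | ∨⁻ {foldr step base ps w v} wv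
      ... | here refl | up | pv = ∨⁺ʳ {foldr step base ps u v} (∧⁺ (left up) (right pv))
        where
        left : T (foldr step base ps u p) ⊎ T (foldr step base ps u p ∧ foldr step base ps p p) → T (foldr step base ps u p)
        left (inj₁ x) = x
        left (inj₂ x) = ∧⁻ˡ x
        right : T (foldr step base ps p v) ⊎ T (foldr step base ps p p ∧ foldr step base ps p v) → T (foldr step base ps p v)
        right (inj₁ x) = x
        right (inj₂ x) = ∧⁻ʳ {foldr step base ps p p} x
      ... | there w∈ | inj₁ x | inj₁ y = ∨⁺ˡ (through ps w∈ x y)
      ... | there w∈ | inj₁ x | inj₂ y = ∨⁺ʳ {foldr step base ps u v}
        (∧⁺ (through ps w∈ x (∧⁻ˡ y)) (∧⁻ʳ {foldr step base ps w p} y))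
      ... | there w∈ | inj₂ x | inj₁ y = ∨⁺ʳ {foldr step base ps u v}
        (∧⁺ (∧⁻ˡ x) (through ps w∈ (∧⁻ʳ {foldr step base ps u p} x) y))
      ... | there w∈ | inj₂ x | inj₂ y = ∨⁺ʳ {foldr step base ps u v} (∧⁺ (∧⁻ˡ x) (∧⁻ʳ {foldr step base ps w p} y))

    closure-complete : ∀ {u v} → Path R u v → T (closure R u v)
    closure-complete {u} ∎ᵖ = includes (allFin n) (∨⁺ˡ {u == u} (==-refl u))
    closure-complete {u} {v} (_◅_ {j = w} r path) =
      through (allFin n) (∈-allFin w) (includes (allFin n) (∨⁺ʳ {u == w} r)) (closure-complete path)
  -- For the adjacency relation of a graph this is twice the number of edges. Ordered pairs are
  -- easier to add and transpose than the increasing pairs listed by `edges`.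
  volume : ∀ {n} → Rel n → ℕ
  volume R = sum λ u → sum λ v → bit (R u v)

  touched≤volume : ∀ {n} (R : Rel n) → count (λ u → anyᶠ (R u)) ≤ volume R
  touched≤volume R = ≤-trans (≤-reflexive (count-sum (λ u → anyᶠ (R u)))) (sum-mono each)
    where
    each : ∀ u → bit (anyᶠ (R u)) ≤ sum λ v → bit (R u v)
    each u with anyᶠ (R u) in eq
    ... | false = z≤n
    ... | true  = let (v , r) = anyᶠ⁻ (R u) (subst T (sym eq) _) in
      ≤-trans (≤-reflexive (cong bit (sym (T⇒≡ r)))) (term≤sum (λ v → bit (R u v)) v)

  volume-cong : ∀ {n} {R S : Rel n} → (∀ u v → R u v ≡ S u v) → volume R ≡ volume S
  volume-cong h = sum-cong-≗ λ u → sum-cong-≗ λ v → cong bit (h u v)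

  volume-flip : ∀ {n} (R : Rel n) → volume R ≡ volume (λ u v → R v u)
  volume-flip R = ∑-comm λ u v → bit (R u v)

  volume-+ : ∀ {n} {R S U : Rel n} → (∀ u v → bit (R u v) ≤ bit (S u v) + bit (U u v)) → volume R ≤ volume S + volume U
  volume-+ {R = R} {S} {U} h = ≤-trans (sum-mono λ u → ≤-trans (sum-mono (h u))
    (≤-reflexive (∑-distrib-+ (λ v → bit (S u v)) (λ v → bit (U u v)))))
    (≤-reflexive (∑-distrib-+ (λ u → sum λ v → bit (S u v)) (λ u → sum λ v → bit (U u v))))

  volume-+⁻ : ∀ {n} {R S U : Rel n} → (∀ u v → bit (S u v) + bit (U u v) ≤ bit (R u v)) → volume S + volume U ≤ volume R
  volume-+⁻ {R = R} {S} {U} h = ≤-trans (≤-reflexive (sym (∑-distrib-+ (λ u → sum λ v → bit (S u v)) (λ u → sum λ v → bit (U u v)))))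
    (sum-mono λ u → ≤-trans (≤-reflexive (sym (∑-distrib-+ (λ v → bit (S u v)) (λ v → bit (U u v))))) (sum-mono (h u)))

  module _ {n} (H : Graph n) where

    private
      forward : Rel n
      forward u v = does (u Fin.<? v) ∧ adj H u v

    length-edges : length (edges H) ≡ volume forward
    length-edges = outer id
      where
      keep? : (e : Fin n × Fin n) → Dec (proj₁ e Fin.< proj₂ e × T (adj H (proj₁ e) (proj₂ e)))
      keep? (u , v) = (u Fin.<? v) ×-dec T? (adj H u v)
      inner : ∀ {m} u (g : Fin m → Fin n) → length (filter keep? (map (u ,_) (tabulate g))) ≡ sum λ i → bit (forward u (g i))
      inner {zero}  u g = refl
      inner {suc m} u g with forward u (g zero)
      ... | true  = cong suc (inner u (g ∘ suc))
      ... | false = inner u (g ∘ suc)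
      outer : ∀ {m} (g : Fin m → Fin n) → length (filter keep? (cartesianProduct (tabulate g) (allFin n))) ≡
        sum λ i → sum λ v → bit (forward (g i) v)
      outer {zero}  g = refl
      outer {suc m} g = trans (cong length (List.filter-++ keep? (map (g zero ,_) (allFin n)) _))
        (trans (List.length-++ (filter keep? (map (g zero ,_) (allFin n)))) (cong₂ _+_ (inner (g zero) id) (outer (g ∘ suc))))

    volume-edges : volume (adj H) ≡ length (edges H) + length (edges H)
    volume-edges = ≤-antisym
      (≤-trans (volume-+ {S = forward} {λ u v → forward v u} each) (≤-reflexive both))
      (≤-trans (≤-reflexive (sym both)) (volume-+⁻ {S = forward} {λ u v → forward v u} each⁻))
      where
      both : volume forward + volume (λ u v → forward v u) ≡ length (edges H) + length (edges H)
      both = cong₂ _+_ (sym length-edges) (trans (sym (volume-flip forward)) (sym length-edges))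
      each : ∀ u v → bit (adj H u v) ≤ bit (forward u v) + bit (forward v u)
      each u v rewrite adj-sym H v u with toℕ u <ᵇ toℕ v in u≮v | toℕ v <ᵇ toℕ u in v≮u | Fin.<-cmp u v
      ... | true  | _     | _ = m≤m+n _ _
      ... | false | true  | _ = ≤-refl
      ... | false | false | tri< u<v _ _ = ⊥-elim (subst T u≮v (<⇒<ᵇ u<v))
      ... | false | false | tri> _ _ v<u = ⊥-elim (subst T v≮u (<⇒<ᵇ v<u))
      ... | false | false | tri≈ _ refl _ rewrite adj-irrefl H u = z≤n
      each⁻ : ∀ u v → bit (forward u v) + bit (forward v u) ≤ bit (adj H u v)
      each⁻ u v rewrite adj-sym H v u with toℕ u <ᵇ toℕ v in u<v | toℕ v <ᵇ toℕ u in v<u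
      ... | true  | true  = ⊥-elim (<-asym (<ᵇ⇒< (toℕ u) (toℕ v) (subst T (sym u<v) _)) (<ᵇ⇒< (toℕ v) (toℕ u) (subst T (sym v<u) _)))
      ... | true  | false = ≤-reflexive (+-identityʳ _)
      ... | false | true  = ≤-refl
      ... | false | false = z≤n
  module _ {n : ℕ} where

    -- Merging labels along one edge after another, as in union-find.
    label : List (Fin n × Fin n) → Fin n → Fin n
    label []             w = w
    label ((u , v) ∷ es) w = if label es w == label es u then label es v else label es w

    moved : List (Fin n × Fin n) → Fin n → Bool
    moved es w = not (label es w == w)

    -- Merging along an edge relabels a whole class, but the only member of that class that can have
    -- been its own label is the old label itself. So every edge moves at most one further vertex.
    -- This is the inequality between vertices, components and edges, obtained without spanning
    -- forests.
    count-moved : ∀ es → count (moved es) ≤ length es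
    count-moved [] = ≤-trans (≤-reflexive (count-sum (moved []))) (≤-trans
      (sum-mono {g = λ _ → 0} λ w → bit-mono {moved [] w} {false} λ h → not⁻ h (==-refl w)) (≤-reflexive (sum-zero {n})))
    count-moved ((u , v) ∷ es) = ≤-trans (count-union {q = label es u ==_} {moved es} new)
      (+-mono-≤ (count-== (label es u)) (count-moved es))
      where
      new : ∀ w → T (moved ((u , v) ∷ es) w) → T (label es u == w) ⊎ T (moved es w)
      new w h with label es w == label es u in eq | T? (label es w == w)
      ... | true  | yes fixed = inj₁ (≡⇒== (trans (sym (==⇒≡ {u = label es w} {label es u} (subst T (sym eq) _))) (==⇒≡ {u = label es w} {w} fixed)))
      ... | _     | no ¬fixed = inj₂ (not⁺ ¬fixed)
      ... | false | yes fixed = inj₂ h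

    label-edge : ∀ {es u v} → (u , v) ∈ es → label es u ≡ label es v
    label-edge {(u , v) ∷ es} (here refl) rewrite T⇒≡ (==-refl (label es u)) with label es v == label es u
    ... | true  = refl
    ... | false = refl
    label-edge {(u , v) ∷ es} (there e∈) rewrite label-edge e∈ = refl

    label-path : ∀ {R : Rel n} → (∀ {u v} → T (R u v) → T (R v u)) → ∀ es → (∀ {u v} → (u , v) ∈ es → T (R u v)) →
      ∀ w → Path R w (label es w)
    label-path R-sym [] es⊆ w = ∎ᵖ
    label-path {R} R-sym ((u , v) ∷ es) es⊆ w with label es w == label es u in eq
    ... | false = label-path R-sym es (es⊆ ∘ there) w
    ... | true  = subst (Path R w) (==⇒≡ (subst T (sym eq) _)) (label-path R-sym es (es⊆ ∘ there) w)
      ◅◅ invert R-sym (label-path R-sym es (es⊆ ∘ there) u) ◅◅ es⊆ (here refl) ◅ label-path R-sym es (es⊆ ∘ there) v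

    module _ (H : Graph n) where

      private
        ℓ : Fin n → Fin n
        ℓ = label (edges H)

        edge? : (e : Fin n × Fin n) → Dec (proj₁ e Fin.< proj₂ e × T (adj H (proj₁ e) (proj₂ e)))
        edge? (u , v) = (u Fin.<? v) ×-dec T? (adj H u v)

        ∈edges : ∀ {u v} → u Fin.< v → Adj H u v → (u , v) ∈ edges H
        ∈edges {u} {v} u<v uv = ∈-filter⁺ edge? (∈-cartesianProduct⁺ (∈-allFin u) (∈-allFin v)) (u<v , uv)

        ℓ-adj : ∀ {u v} → Adj H u v → ℓ u ≡ ℓ v
        ℓ-adj {u} {v} uv with Fin.<-cmp u v
        ... | tri< u<v _ _ = label-edge (∈edges u<v uv)
        ... | tri≈ _ refl _ = refl
        ... | tri> _ _ v<u = sym (label-edge (∈edges v<u (Adj-sym H uv)))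

        ℓ-path : ∀ {u v} → Reachable H u v → ℓ u ≡ ℓ v
        ℓ-path ∎ᵖ        = refl
        ℓ-path (uv ◅ p) = trans (ℓ-adj uv) (ℓ-path p)

        path-ℓ : ∀ w → Reachable H w (ℓ w)
        path-ℓ = label-path {adj H} (Adj-sym H) (edges H) λ e∈ →
          proj₂ (proj₂ (∈-filter⁻ edge? {xs = cartesianProduct (allFin n) (allFin n)} e∈))

        ℓ-reflects : ∀ {u v} → ℓ u ≡ ℓ v → Reachable H u v
        ℓ-reflects {u} {v} eq = subst (Reachable H u) eq (path-ℓ u) ◅◅ invert (Adj-sym H) (path-ℓ v)

      -- All vertices of a component carry one label, so only the label itself can be unmoved there,
      -- and a component with more than d vertices contains at least d moved ones. Representatives
      -- of distinct components have distinct labels, so no moved vertex is charged twice.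
      forest-bound : (rep : Fin n → Bool) (C : Rel n) {d : ℕ} → (∀ {r w} → T (C r w) → Reachable H r w) →
        (∀ {r r′} → T (rep r) → T (rep r′) → Reachable H r r′ → r ≡ r′) →
        (∀ r → T (rep r) → d < count (C r)) → count rep * d ≤ length (edges H)
      forest-bound rep C {d} sound apart big = begin
        count rep * d                               ≡⟨ cong (_* d) (count-sum rep) ⟩
        sum (bit ∘ rep) * d                         ≡⟨ sum-*ʳ (bit ∘ rep) d ⟨
        sum (λ r → bit (rep r) * d)                 ≤⟨ sum-mono row ⟩
        sum (λ r → sum λ w → bit (rep r ∧ (ℓ r == ℓ w ∧ moved (edges H) w)))  ≡⟨ ∑-comm (λ r w → bit (rep r ∧ (ℓ r == ℓ w ∧ moved (edges H) w))) ⟩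
        sum (λ w → sum λ r → bit (rep r ∧ (ℓ r == ℓ w ∧ moved (edges H) w)))  ≤⟨ sum-mono col ⟩
        sum (λ w → bit (moved (edges H) w))         ≡⟨ count-sum (moved (edges H)) ⟨
        count (moved (edges H))                     ≤⟨ count-moved (edges H) ⟩
        length (edges H)                            ∎
        where
        open ≤-Reasoning
        row : ∀ r → bit (rep r) * d ≤ sum λ w → bit (rep r ∧ (ℓ r == ℓ w ∧ moved (edges H) w))
        row r with rep r in eq
        ... | false = z≤n
        ... | true  = ≤-trans (≤-reflexive (*-identityˡ d)) (≤-trans (s≤s⁻¹ (≤-trans (big r (subst T (sym eq) _))
          (≤-trans (count-union {q = ℓ r ==_} {λ w → ℓ r == ℓ w ∧ moved (edges H) w} cover)
            (+-monoˡ-≤ _ (count-== (ℓ r))))))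
          (≤-reflexive (count-sum λ w → ℓ r == ℓ w ∧ moved (edges H) w)))
          where
          cover : ∀ w → T (C r w) → T (ℓ r == w) ⊎ T (ℓ r == ℓ w ∧ moved (edges H) w)
          cover w c with T? (ℓ w == w)
          ... | yes fixed = inj₁ (≡⇒== (trans (ℓ-path (sound c)) (==⇒≡ fixed)))
          ... | no ¬fixed = inj₂ (∧⁺ (≡⇒== (ℓ-path (sound c))) (not⁺ ¬fixed))
        col : ∀ w → sum (λ r → bit (rep r ∧ (ℓ r == ℓ w ∧ moved (edges H) w))) ≤ bit (moved (edges H) w)
        col w with moved (edges H) w
        ... | true  = ≤-trans (≤-reflexive (sym (count-sum λ r → rep r ∧ (ℓ r == ℓ w ∧ true))))
          (count-unique (λ r → rep r ∧ (ℓ r == ℓ w ∧ true)) λ {i} {j} hi hj → apart (∧⁻ˡ hi) (∧⁻ˡ hj)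
            (ℓ-reflects (trans (==⇒≡ (∧⁻ˡ {ℓ i == ℓ w} (∧⁻ʳ {rep i} hi))) (sym (==⇒≡ (∧⁻ˡ {ℓ j == ℓ w} (∧⁻ʳ {rep j} hj)))))))
        ... | false = ≤-trans (sum-mono {g = λ _ → 0} λ r → bit-mono {rep r ∧ (ℓ r == ℓ w ∧ false)} {false}
            (λ h → ∧⁻ʳ {ℓ r == ℓ w} (∧⁻ʳ {rep r} h))) (≤-reflexive (sum-zero {n}))

-- Heavy, noisy and quiet vertices: feasibility and the size of the kernel

module Deletion where

  open ListPrograms using (anyᴸ; countᴸ)
  open Algorithm
  open Counting
  open GraphTheory
  open ReductionProgram using (length-cons-all)

  touched : ∀ {n} → Rel n → Fin n → Bool
  touched R u = anyᶠ (R u)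

  -- The quotient of E by the components of R is a clique.
  Contracts : ∀ {n} → Rel n → Rel n → Set
  Contracts E R = ∀ u v → ¬ Path R u v → ∃[ a ] ∃[ b ] (Path R u a × Path R v b × T (E a b))

  untouched-path : ∀ {n} {R : Rel n} {u v} → ¬ T (touched R u) → Path R u v → u ≡ v
  untouched-path          ¬t ∎ᵖ       = refl
  untouched-path {R = R} {u} ¬t (_◅_ {j = w} r _) = ⊥-elim (¬t (anyᶠ⁺ (R u) w r))

  module _ {n} (G : Graph n) (k d : ℕ) where

    input : Input
    input = record { order = n ; edge = adj G ; k = k ; d = d }

    open Kernel input

    nonNbr : Rel n
    nonNbr x v = not (adj G x v)

    quiet⇒light : ∀ {x} → T (quiet x) → ¬ T (heavy x)
    quiet⇒light q = not⁻ (∧⁻ˡ q)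

    quiet-adj : ∀ {q x} → T (quiet q) → ¬ T (heavy x) → q ≢ x → Adj G q x
    quiet-adj {q} {x} hq light q≢x = ¬¬T λ ¬qx → not⁻ (∧⁻ʳ {not (heavy q)} hq)
      (anyᶠ⁺ (λ v → not (heavy v) ∧ (not (adj G q v) ∧ not (q == v))) x
        (∧⁺ (not⁺ light) (∧⁺ ¬qx (not⁺ (q≢x ∘ ==⇒≡ {u = q} {x})))))

    noisy-witness : ∀ {x} → T (noisy x) → ∃[ v ] (¬ T (heavy v) × ¬ Adj G x v × x ≢ v)
    noisy-witness {x} h =
      let (v , w) = anyᶠ⁻ (λ v → not (heavy v) ∧ (not (adj G x v) ∧ not (x == v))) (¬¬T (not⁻ (∧⁻ʳ {not (heavy x)} h) ∘ ∧⁺ (∧⁻ˡ h)))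
          w′ = ∧⁻ʳ {not (heavy v)} w
      in v , not⁻ (∧⁻ˡ w) , not⁻ (∧⁻ˡ w′) , λ x≡v → not⁻ (∧⁻ʳ {not (adj G x v)} w′) (≡⇒== x≡v)

    light-nonNbrs : ∀ {x} → ¬ T (heavy x) → count (nonNbr x) ≤ K
    light-nonNbrs light = ≮⇒≥ (light ∘ <⇒<ᵇ)

    ¬Adj-refl : ∀ {x} → ¬ Adj G x x
    ¬Adj-refl {x} h = subst T (adj-irrefl G x) h
    module _ {R : Rel n} (solution : Contracts (adj G) R) (few : count (touched R) < K) where

      untouched-adj : ∀ {u v} → ¬ T (touched R u) → ¬ T (touched R v) → u ≢ v → Adj G u v
      untouched-adj {u} {v} ¬tu ¬tv u≢v with solution u v (u≢v ∘ untouched-path ¬tu)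
      ... | a , b , p , q , ab with untouched-path ¬tu p | untouched-path ¬tv q
      ...   | refl | refl = ab

      -- All non-neighbours of an untouched x are touched, except x itself, which is its own
      -- non-neighbour. That makes at most K non-neighbours, too few for a heavy vertex.
      heavy⇒touched : ∀ {x} → T (heavy x) → T (touched R x)
      heavy⇒touched {x} h = ¬¬T λ ¬t → <⇒≱ (<ᵇ⇒< K (count (nonNbr x)) h) (begin
        count (nonNbr x)                 ≤⟨ count-union {q = touched R} {x ==_} (cover (not⁻ ¬t)) ⟩
        count (touched R) + count (x ==_) ≤⟨ +-monoʳ-≤ (count (touched R)) (count-== x) ⟩
        count (touched R) + 1            ≡⟨ +-comm (count (touched R)) 1 ⟩
        suc (count (touched R))          ≤⟨ few ⟩
        K                                ∎)
        where
        open ≤-Reasoning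
        cover : ¬ T (touched R x) → ∀ v → T (nonNbr x v) → T (touched R v) ⊎ T (x == v)
        cover ¬tx v ¬xv with T? (touched R v) | T? (x == v)
        ... | yes tv | _      = inj₁ tv
        ... | no _   | yes eq = inj₂ eq
        ... | no ¬tv | no ¬eq = ⊥-elim (not⁻ ¬xv (untouched-adj ¬tx ¬tv λ { refl → ¬eq (==-refl x) }))

      feasible : ¬ T infeasible
      feasible h with ∨⁻ {not (count heavy <ᵇ K)} h
      ... | inj₁ many = not⁻ many (<⇒<ᵇ (≤-<-trans (count-mono {p = heavy} {touched R} λ x → heavy⇒touched {x}) few))
      -- Every noisy vertex is a non-neighbour of some touched light vertex. There are fewer than K
      -- of the latter, each with at most K non-neighbours.
      ... | inj₂ many = not⁻ many (<⇒<ᵇ (≤-<-trans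
        (union-bound noisy (λ t → touched R t ∧ not (heavy t)) nonNbr cover λ t ht → light-nonNbrs (not⁻ (∧⁻ʳ {touched R t} ht)))
        (*-monoˡ-< K (≤-<-trans (count-mono {p = λ t → touched R t ∧ not (heavy t)} {touched R} λ t → ∧⁻ˡ {touched R t}) few))))
        where
        cover : ∀ x → T (noisy x) → ∃[ t ] (T (touched R t ∧ not (heavy t)) × T (nonNbr t x))
        cover x h with noisy-witness h | T? (touched R x)
        -- A touched noisy vertex is covered by itself, as no vertex is adjacent to itself.
        ... | v , light , ¬xv , x≢v | yes tx = x , ∧⁺ tx (∧⁻ˡ h) , not⁺ ¬Adj-refl
        ... | v , light , ¬xv , x≢v | no ¬tx = v ,
          ∧⁺ (¬¬T λ ¬tv → ¬xv (untouched-adj ¬tx (not⁻ ¬tv) x≢v)) (not⁺ light) , not⁺ (¬xv ∘ Adj-sym G)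
    -- One round multiplies the length by at most 1 + `count heavy`, which is at most K.
    length-tuples : count heavy < K → ∀ j → length (tuples j) ≤ K ^ j
    length-tuples h zero    = ≤-refl
    length-tuples h (suc j) with length (tuples j) <ᵇ n
    ... | false = ≤-trans (length-tuples h j) (m≤m+n _ _)
    ... | true  = begin
      length (As ++ _)                            ≡⟨ List.length-++ As ⟩
      length As + _                               ≡⟨ cong (length As +_) (length-cons-all As heavies) ⟩
      length As + length As * length heavies      ≡⟨ *-suc (length As) (length heavies) ⟨
      length As * suc (length heavies)            ≡⟨ cong (λ c → length As * suc c) (length-filter heavy) ⟩
      length As * suc (count heavy)               ≤⟨ *-mono-≤ (length-tuples h j) h ⟩
      K ^ j * K                                   ≡⟨ *-comm (K ^ j) K ⟩
      K ^ suc j                                   ∎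
      where
      open ≤-Reasoning
      As = tuples j

    -- On overflow all vertices are marked, but then there are no more vertices than tuples, and
    -- thus at most `K ^ d`.
    count-marked : ¬ T infeasible → count marked ≤ K ^ d ⊎
      count marked ≤ (count heavy + count noisy) + (K ^ d * K + K * K)
    count-marked ok with T? overflow
    ... | yes over = inj₁ (≤-trans (count≤n marked) (≤-trans (≮⇒≥ (not⁻ over ∘ <⇒<ᵇ)) (length-tuples heavy<K d)))
      where
      heavy<K : count heavy < K
      heavy<K = <ᵇ⇒< _ _ (¬¬T (ok ∘ ∨⁺ˡ))
    ... | no ¬over = inj₂ (≤-trans (count-union {q = λ v → not (quiet v)} {λ v → byTuple v ∨ byNbr v} split)
        (+-mono-≤ (count-union {q = heavy} {noisy} loud)
          (≤-trans (count-union {q = byTuple} {byNbr} (λ v → ∨⁻ {byTuple v})) (+-mono-≤ tupleBound nbrBound))))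
      where
      heavy<K : count heavy < K
      heavy<K = <ᵇ⇒< _ _ (¬¬T (ok ∘ ∨⁺ˡ))
      byTuple byNbr : Fin n → Bool
      byTuple v = anyᴸ (λ A → early (avoiding A) v) (tuples d)
      byNbr v = anyᶠ (λ x → heavy x ∧ early (quietNbr x) v)
      split : ∀ v → T (marked v) → T (not (quiet v)) ⊎ T (byTuple v ∨ byNbr v)
      split v m with ∨⁻ {not (quiet v)} m
      ... | inj₁ h = inj₁ h
      ... | inj₂ h with ∨⁻ {overflow} h
      ...   | inj₁ over = ⊥-elim (¬over over)
      ...   | inj₂ h′ = inj₂ h′
      loud : ∀ v → T (not (quiet v)) → T (heavy v) ⊎ T (noisy v)
      loud v ¬q with T? (heavy v)
      ... | yes h = inj₁ h
      ... | no ¬h = inj₂ (∧⁺ (not⁺ ¬h) ¬q)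
      tupleBound : count byTuple ≤ K ^ d * K
      tupleBound = ≤-trans (union-bound byTuple (λ _ → true) (λ i → early (avoiding (lookup (tuples d) i)))
        (λ v h → let (A , A∈ , e) = anyᴸ⁻ (λ A → early (avoiding A) v) (tuples d) h in
          index A∈ , _ , subst (λ A → T (early (avoiding A) v)) (lookup-index A∈) e)
        (λ i _ → count-prefix K (avoiding (lookup (tuples d) i))))
        (*-monoˡ-≤ K (≤-trans (count≤n {length (tuples d)} (λ _ → true)) (length-tuples heavy<K d)))
      nbrBound : count byNbr ≤ K * K
      nbrBound = ≤-trans (union-bound byNbr heavy (λ x → early (quietNbr x))
        (λ v h → let (x , e) = anyᶠ⁻ (λ x → heavy x ∧ early (quietNbr x) v) h in x , ∧⁻ˡ e , ∧⁻ʳ {heavy x} e)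
        (λ x _ → count-prefix K (quietNbr x))) (*-monoˡ-≤ K (<⇒≤ heavy<K))

    keep≡marked : ¬ T infeasible → ∀ v → keep v ≡ marked v
    keep≡marked ok v = trans (keep≡ v) (cong (λ b → if b then not (anyᶠ λ w → w ≺ v) else marked v) (¬T⇒≡ ok))

    keep≡first : T infeasible → ∀ v → keep v ≡ not (anyᶠ λ w → w ≺ v)
    keep≡first bad v = trans (keep≡ v) (cong (λ b → if b then not (anyᶠ λ w → w ≺ v) else marked v) (T⇒≡ bad))

    keep-first : T infeasible → ∀ {i j} → T (keep i) → T (keep j) → i ≡ j
    keep-first bad {i} {j} ki kj with Fin.<-cmp i j
    ... | tri< i<j _ _ = ⊥-elim (not⁻ (subst T (keep≡first bad j) kj) (anyᶠ⁺ (λ w → w ≺ j) i (<⇒≺ i<j)))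
    ... | tri≈ _ i≡j _ = i≡j
    ... | tri> _ _ j<i = ⊥-elim (not⁻ (subst T (keep≡first bad i) ki) (anyᶠ⁺ (λ w → w ≺ i) j (<⇒≺ j<i)))

    -- The 4 stands for the heavy vertices, the noisy ones, those kept for tuples and those kept as
    -- neighbours; each group has at most `K ^ suc d` members, where `K * K ≤ K ^ suc d` uses d ≥ 1.
    -- The power of 3 comes from K ≤ 3k, valid for k ≥ 1.
    count-keep : .{{_ : NonZero k}} → .{{_ : NonZero d}} → count keep ≤ 4 * 3 ^ suc d * k ^ suc d
    count-keep = ≤-trans bound (begin
      4 * K ^ suc d                  ≤⟨ *-monoʳ-≤ 4 (^-monoˡ-≤ (suc d) K≤3k) ⟩
      4 * (3 * k) ^ suc d            ≡⟨ cong (4 *_) (^-distribʳ-* (suc d) 3 k) ⟩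
      4 * (3 ^ suc d * k ^ suc d)    ≡⟨ *-assoc 4 (3 ^ suc d) (k ^ suc d) ⟨
      4 * 3 ^ suc d * k ^ suc d      ∎)
      where
      open ≤-Reasoning
      K≤3k : K ≤ 3 * k
      K≤3k = +-mono-≤ (>-nonZero⁻¹ k) (+-monoʳ-≤ k (≤-reflexive (sym (+-identityʳ k))))
        where open import Data.Nat.Base using (>-nonZero⁻¹)
      P : ℕ
      P = K ^ suc d
      K*K≤P : K * K ≤ P
      K*K≤P = *-monoʳ-≤ K (subst (_≤ K ^ d) (*-identityʳ K) (^-monoʳ-≤ K {1} {d} (>-nonZero⁻¹ d)))
        where open import Data.Nat.Base using (>-nonZero⁻¹)
      K≤P : K ≤ P
      K≤P = ≤-trans (m≤m*n K K) K*K≤P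
      1≤P : 1 ≤ P
      1≤P = m^n>0 K (suc d)
      bound : count keep ≤ 4 * P
      bound with T? infeasible
      ... | yes bad = ≤-trans (count-unique keep (keep-first bad)) (≤-trans 1≤P (m≤m+n P _))
      ... | no ok rewrite count-cong (keep≡marked ok) with count-marked ok
      ...   | inj₁ h = ≤-trans h (≤-trans (m≤m+n (K ^ d) _) (m≤m+n P _))
      ...   | inj₂ h = ≤-trans h (begin
        count heavy + count noisy + (K ^ d * K + K * K) ≤⟨ +-mono-≤ (+-mono-≤ heavy≤ noisy≤) (+-mono-≤ (≤-reflexive (*-comm (K ^ d) K)) K*K≤P) ⟩
        P + P + (P + P)                                 ≡⟨ +-assoc P P (P + P) ⟩
        P + (P + (P + P))                               ≡⟨ cong (λ z → P + (P + (P + z))) (+-identityʳ P) ⟨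
        4 * P                                           ∎)
        where
        heavy≤ : count heavy ≤ P
        heavy≤ = ≤-trans (<⇒≤ (<ᵇ⇒< _ _ (¬¬T (ok ∘ ∨⁺ˡ)))) K≤P
        noisy≤ : count noisy ≤ P
        noisy≤ = ≤-trans (<⇒≤ (<ᵇ⇒< _ _ (¬¬T (ok ∘ ∨⁺ʳ {not (count heavy <ᵇ K)})))) K*K≤P
    -- Room at the end implies room in every earlier round, because a list that has reached n
    -- entries is passed on unchanged.
    tuples-complete : ∀ j → length (tuples j) < n → ∀ {A} → All (T ∘ heavy) A → length A ≤ j → A ∈ tuples j
    tuples-complete zero    _ [] z≤n = here refl
    tuples-complete (suc j) room {A} hs A≤j with length (tuples j) <ᵇ n in eq
    ... | false = ⊥-elim (subst T eq (<⇒<ᵇ room))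
    ... | true with hs | A≤j
    ...   | []     | _       = ∈-++⁺ˡ (tuples-complete j (<ᵇ⇒< _ _ (subst T (sym eq) _)) [] z≤n)
    ...   | h ∷ hs | s≤s A≤j = ∈-++⁺ʳ (tuples j) (∈-cartesianProductWith⁺ (λ A x → x ∷ A)
      (tuples-complete j (<ᵇ⇒< _ _ (subst T (sym eq) _)) hs A≤j) (∈-filter⁺ (T? ∘ heavy) (∈-allFin _) h))

    module _ (ok : ¬ T infeasible) where

      marked⇒keep : ∀ {v} → T (marked v) → T (keep v)
      marked⇒keep {v} = subst T (sym (keep≡marked ok v))

      early-avoiding⇒keep : ∀ {A v} → A ∈ tuples d → T (early (avoiding A) v) → T (keep v)
      early-avoiding⇒keep {A} {v} A∈ e = marked⇒keep (∨⁺ʳ {not (quiet v)} (∨⁺ʳ {overflow} (∨⁺ˡ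
        (anyᴸ⁺ (λ A → early (avoiding A) v) A∈ e))))

      early-nbr⇒keep : ∀ {x v} → T (heavy x) → T (early (quietNbr x) v) → T (keep v)
      early-nbr⇒keep {x} {v} h e = marked⇒keep (∨⁺ʳ {not (quiet v)} (∨⁺ʳ {overflow}
        (∨⁺ʳ {anyᴸ (λ A → early (avoiding A) v) (tuples d)} (anyᶠ⁺ (λ x → heavy x ∧ early (quietNbr x) v) x (∧⁺ h e)))))

      deleted⇒quiet : ∀ {v} → ¬ T (keep v) → T (quiet v)
      deleted⇒quiet ¬kv = ¬¬T (¬kv ∘ marked⇒keep ∘ ∨⁺ˡ)

      -- On overflow nothing is deleted, so a single deleted vertex certifies that the enumeration
      -- was carried out in full.
      avoiding-complete : ∀ {v A} → ¬ T (keep v) → All (T ∘ heavy) A → length A ≤ d → A ∈ tuples d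
      avoiding-complete {v} ¬kv = tuples-complete d (<ᵇ⇒< (length (tuples d)) n
        (¬¬T (¬kv ∘ marked⇒keep ∘ ∨⁺ʳ {not (quiet v)} ∘ ∨⁺ˡ)))

    avoiding⇒quiet : ∀ A {v} → T (avoiding A v) → T (quiet v)
    avoiding⇒quiet []      q = q
    avoiding⇒quiet (x ∷ A) {v} q = avoiding⇒quiet A (∧⁻ʳ {not (adj G x v)} q)

    avoiding⁻ : ∀ {A x v} → x ∈ A → T (avoiding A v) → ¬ Adj G x v
    avoiding⁻ (here refl) h = not⁻ (∧⁻ˡ h)
    avoiding⁻ {y ∷ _} {v = v} (there x∈) h = avoiding⁻ x∈ (∧⁻ʳ {not (adj G y v)} h)

    avoiding⁺ : ∀ A {v} → T (quiet v) → (∀ {x} → x ∈ A → ¬ Adj G x v) → T (avoiding A v)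
    avoiding⁺ []      q _ = q
    avoiding⁺ (x ∷ A) q h = ∧⁺ (not⁺ (h (here refl))) (avoiding⁺ A q (h ∘ there))

-- The kernel is connected and its optimum is not larger

module Reduction where

  open ListPrograms using (anyᴸ; countᴸ)
  open Algorithm
  open Counting
  open GraphTheory
  open Deletion

  lookup-injective : ∀ {A : Set} {xs : List A} → Unique xs → ∀ {i j} → lookup xs i ≡ lookup xs j → i ≡ j
  lookup-injective (_ ∷ _)  {zero}  {zero}  _  = refl
  lookup-injective (x∉ ∷ _) {zero}  {suc j} eq = ⊥-elim (All.lookup x∉ (∈-lookup j) eq)
  lookup-injective (x∉ ∷ _) {suc i} {zero}  eq = ⊥-elim (All.lookup x∉ (∈-lookup i) (sym eq))
  lookup-injective (_ ∷ u)  {suc i} {suc j} eq = cong suc (lookup-injective u eq)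

  T-≡ : ∀ {a b} → (T a → T b) → (T b → T a) → a ≡ b
  T-≡ {true}  {true}  _ _ = refl
  T-≡ {true}  {false} f _ = ⊥-elim (f _)
  T-≡ {false} {true}  _ g = ⊥-elim (g _)
  T-≡ {false} {false} _ _ = refl

  module Restrict {n} (keep : Fin n → Bool) where

    kept : List (Fin n)
    kept = filterᵇ keep (allFin n)

    ι : Fin (length kept) → Fin n
    ι = lookup kept

    ι-keep : ∀ i → T (keep (ι i))
    ι-keep i = proj₂ (∈-filter⁻ (T? ∘ keep) {xs = allFin n} (∈-lookup i))

    ι-onto : ∀ {v} → T (keep v) → ∃[ i ] ι i ≡ v
    ι-onto {v} kv = let v∈ = ∈-filter⁺ (T? ∘ keep) (∈-allFin v) kv in index v∈ , sym (lookup-index v∈)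

    ι-injective : ∀ {i j} → ι i ≡ ι j → i ≡ j
    ι-injective = lookup-injective (Unique.filter⁺ (T? ∘ keep) (Unique.allFin⁺ n))

    Supported : Rel n → Set
    Supported R = ∀ {u v} → T (R u v) → T (keep u) × T (keep v)

    restrict : Rel n → Rel (length kept)
    restrict R i j = R (ι i) (ι j)

    path-down : ∀ {R} → Supported R → ∀ {i v} → Path R (ι i) v → ∃[ j ] (ι j ≡ v × Path (restrict R) i j)
    path-down {R} supp {i} p = go i refl p
      where
      go : ∀ i {u v} → ι i ≡ u → Path R u v → ∃[ j ] (ι j ≡ v × Path (restrict R) i j)
      go i eq ∎ᵖ = i , eq , ∎ᵖ
      go i refl (r ◅ p) with ι-onto (proj₂ (supp r))
      ... | w , refl = let (j , eq , q) = go w refl p in j , eq , r ◅ q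

    path-restrict : ∀ {R} → Supported R → ∀ {i j} → Path R (ι i) (ι j) → Path (restrict R) i j
    path-restrict {R} supp {i} {j} p = let (j′ , eq , q) = path-down supp p in subst (Path (restrict R) i) (ι-injective eq) q

    sum-ι : (f : Fin n → ℕ) → sum (f ∘ ι) ≡ sum λ u → bit (keep u) * f u
    sum-ι f = go id
      where
      go : ∀ {m} (g : Fin m → Fin n) → sum (f ∘ lookup (filterᵇ keep (tabulate g))) ≡ sum λ i → bit (keep (g i)) * f (g i)
      go {zero}  g = refl
      go {suc m} g with keep (g zero)
      ... | true  = cong₂ _+_ (sym (+-identityʳ (f (g zero)))) (go (g ∘ suc))
      ... | false = go (g ∘ suc)

    volume-restrict : ∀ {R} → Supported R → volume (restrict R) ≡ volume R
    volume-restrict {R} supp = trans (sum-cong-≗ λ i → trans (sum-ι (bit ∘ R (ι i))) (sum-cong-≗ (col (ι i))))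
      (trans (sum-ι (λ u → sum λ v → bit (R u v))) (sum-cong-≗ row))
      where
      col : ∀ u v → bit (keep v) * bit (R u v) ≡ bit (R u v)
      col u v with R u v in eq
      ... | false = *-zeroʳ (bit (keep v))
      ... | true rewrite T⇒≡ (proj₂ (supp (subst T (sym eq) _))) = refl
      row : ∀ u → bit (keep u) * sum (λ v → bit (R u v)) ≡ sum λ v → bit (R u v)
      row u with keep u in eq
      ... | true  = +-identityʳ _
      ... | false = sym (trans (sum-cong-≗ λ v → cong bit (¬T⇒≡ λ r → subst T eq (proj₁ (supp {u} {v} r)))) (sum-zero {n}))

  induced : ∀ {m n} → Graph n → (Fin m → Fin n) → Graph m
  induced G ι = record
    { adj        = λ i j → adj G (ι i) (ι j)
    ; adj-sym    = λ i j → adj-sym G (ι i) (ι j)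
    ; adj-irrefl = adj-irrefl G ∘ ι
    }

  module _ {n} (G : Graph n) (k d : ℕ) where

    open Kernel (input G k d) hiding (kept)
    open Restrict keep

    keepAdj : Rel n
    keepAdj u v = keep u ∧ (keep v ∧ adj G u v)

    keepAdj⁺ : ∀ {u v} → T (keep u) → T (keep v) → Adj G u v → T (keepAdj u v)
    keepAdj⁺ ku kv uv = ∧⁺ ku (∧⁺ kv uv)

    -- A walk towards a kept quiet vertex, the hub, is followed until it is about to enter a deleted
    -- vertex. If the current vertex is light, it is the hub or adjacent to it. If it is heavy, the
    -- deleted vertex is one of its quiet neighbours, so it also has a kept quiet neighbour, and
    -- that one is the hub or adjacent to it.
    keepAdj-connected : (∀ u v → Reachable G u v) → ∀ {u v} → T (keep u) → T (keep v) → Path keepAdj u v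
    keepAdj-connected conn {u} {v} ku kv with T? infeasible | T? (anyᶠ λ w → not (keep w))
    ... | yes bad | _ = subst (Path keepAdj u) (keep-first G k d bad ku kv) ∎ᵖ
    ... | no _ | no none = gmap id (λ {x} {y} → keepAdj⁺ (all x) (all y)) (conn u v)
      where
      all : ∀ w → T (keep w)
      all w = ¬¬T (none ∘ anyᶠ⁺ (λ w → not (keep w)) w)
    ... | no ok | yes some = toHub ku (conn u hub) ◅◅ invert keepAdj-sym (toHub kv (conn v hub))
      where
      deleted = anyᶠ⁻ (λ w → not (keep w)) some
      -- With nothing to escape from, `prefix-escapes` simply finds a kept member of a set that has
      -- a member.
      none-touched : count {n} (λ _ → false) < K
      none-touched = s≤s (≤-trans (≤-reflexive (trans (count-sum {n} (λ _ → false)) (sum-zero {n}))) z≤n)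
      hubSpec = prefix-escapes quiet (λ _ → false) none-touched (deleted⇒quiet G k d ok (not⁻ (proj₂ deleted))) (inj₁ id)
      hub : Fin n
      hub = proj₁ hubSpec
      hub-keep : T (keep hub)
      hub-keep = early-avoiding⇒keep G k d ok (avoiding-complete G k d ok (not⁻ (proj₂ deleted)) [] z≤n) (proj₁ (proj₂ hubSpec))
      hub-quiet : T (quiet hub)
      hub-quiet = ∧⁻ˡ (proj₁ (proj₂ hubSpec))
      keepAdj-sym : ∀ {x y} → T (keepAdj x y) → T (keepAdj y x)
      keepAdj-sym {x} {y} h = keepAdj⁺ (∧⁻ˡ (∧⁻ʳ {keep x} h)) (∧⁻ˡ h) (Adj-sym G (∧⁻ʳ {keep y} (∧⁻ʳ {keep x} h)))
      light-toHub : ∀ {x} → T (keep x) → ¬ T (heavy x) → Path keepAdj x hub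
      light-toHub {x} kx light with x Fin.≟ hub
      ... | yes refl = ∎ᵖ
      ... | no x≢hub = keepAdj⁺ kx hub-keep (Adj-sym G (quiet-adj G k d hub-quiet light (x≢hub ∘ sym))) ◅ ∎ᵖ
      toHub : ∀ {x} → T (keep x) → Reachable G x hub → Path keepAdj x hub
      toHub kx ∎ᵖ = ∎ᵖ
      toHub {x} kx (_◅_ {j = w} xw p) with T? (keep w) | T? (heavy x)
      ... | yes kw | _     = keepAdj⁺ kx kw xw ◅ toHub kw p
      ... | no _   | no light = light-toHub kx light
      ... | no ¬kw | yes h =
        let (y , e , _) = prefix-escapes (quietNbr x) (λ _ → false) none-touched (∧⁺ (deleted⇒quiet G k d ok ¬kw) xw) (inj₁ id)
            ky = early-nbr⇒keep G k d ok h e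
            y∈ = ∧⁻ˡ {quietNbr x y} e
        in keepAdj⁺ kx ky (∧⁻ʳ {quiet y} y∈) ◅ light-toHub ky (quiet⇒light G k d (∧⁻ˡ y∈))

    reduced-connected : (∀ u v → Reachable G u v) → ∀ i j → Reachable (induced G ι) i j
    reduced-connected conn i j = gmap id (λ {x} {y} h → ∧⁻ʳ {keep (ι y)} (∧⁻ʳ {keep (ι x)} h))
      (path-restrict (λ {u} h → ∧⁻ˡ h , ∧⁻ˡ (∧⁻ʳ {keep u} h)) (keepAdj-connected conn (ι-keep i) (ι-keep j)))
    module Replace {R : Rel n} (R-sym : ∀ {u v} → T (R u v) → T (R v u)) (R⊆G : ∀ {u v} → T (R u v) → Adj G u v)
                   (solution : Contracts (adj G) R) (few : count (touched R) < K) where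

      private
        ok : ¬ T infeasible
        ok = feasible G k d solution few

      reachesDeleted : Fin n → Bool
      reachesDeleted x = anyᶠ λ v → not (keep v) ∧ R x v

      -- Being untouched makes a substitute a component of R by itself, so the given solution
      -- already forces it to be adjacent to all other components.
      substitute : Rel n
      substitute x y = keep y ∧ (quiet y ∧ (not (touched R y) ∧ adj G x y))

      -- An edge from x to a deleted vertex is replaced by the edge from x to its substitute.
      redirected : Rel n
      redirected x y = keep x ∧ (reachesDeleted x ∧ least (substitute x) y)

      inner : Rel n
      inner u v = keep u ∧ (keep v ∧ R u v)

      replaced : Rel n
      replaced u v = inner u v ∨ (redirected u v ∨ redirected v u)

      -- For heavy x the deleted vertex is a quiet neighbour that was not among the first K, so one
      -- of those first K is untouched. A light x is adjacent to every other quiet vertex, so the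
      -- first K quiet vertices serve instead; the untouched one differs from x, which is touched.
      substitute-exists : ∀ {x} → T (reachesDeleted x) → ∃[ y ] T (least (substitute x) y)
      substitute-exists {x} h with anyᶠ⁻ (λ v → not (keep v) ∧ R x v) h | T? (heavy x)
      ... | v , w | yes hx =
        let ¬kv = not⁻ (∧⁻ˡ w)
            (y , e , ¬ty) = prefix-escapes (quietNbr x) (touched R) few
              (∧⁺ (deleted⇒quiet G k d ok ¬kv) (R⊆G (∧⁻ʳ {not (keep v)} w))) (inj₂ (¬kv ∘ early-nbr⇒keep G k d ok hx))
            y∈ = ∧⁻ˡ {quietNbr x y} e
        in least-exists (substitute x) {y} (∧⁺ (early-nbr⇒keep G k d ok hx e) (∧⁺ {quiet y} (∧⁻ˡ y∈) (∧⁺ (not⁺ ¬ty) (∧⁻ʳ {quiet y} y∈))))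
      ... | v , w | no light =
        let ¬kv = not⁻ (∧⁻ˡ w)
            []∈ = avoiding-complete G k d ok ¬kv [] z≤n
            (y , e , ¬ty) = prefix-escapes quiet (touched R) few
              (deleted⇒quiet G k d ok ¬kv) (inj₂ (¬kv ∘ early-avoiding⇒keep G k d ok []∈))
            qy = ∧⁻ˡ {quiet y} e
            y≢x = λ y≡x → ¬ty (subst (T ∘ touched R) (sym y≡x) (anyᶠ⁺ (R x) v (∧⁻ʳ {not (keep v)} w)))
        in least-exists (substitute x) {y} (∧⁺ (early-avoiding⇒keep G k d ok []∈ e) (∧⁺ qy (∧⁺ (not⁺ ¬ty) (Adj-sym G (quiet-adj G k d qy light y≢x)))))

      substitute-spec : ∀ {x y} → T (least (substitute x) y) → T (keep y) × T (quiet y) × ¬ T (touched R y) × Adj G x y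
      substitute-spec {x} {y} l = let h = least-∈ (substitute x) {y} l ; h′ = ∧⁻ʳ {keep y} h ; h″ = ∧⁻ʳ {quiet y} h′ in
        ∧⁻ˡ h , ∧⁻ˡ h′ , not⁻ (∧⁻ˡ h″) , ∧⁻ʳ {not (touched R y)} h″

      redirected-spec : ∀ {x y} → T (redirected x y) → T (keep x) × T (reachesDeleted x) × T (least (substitute x) y)
      redirected-spec {x} h = let h′ = ∧⁻ʳ {keep x} h in ∧⁻ˡ h , ∧⁻ˡ h′ , ∧⁻ʳ {reachesDeleted x} h′

      inner-spec : ∀ {u v} → T (inner u v) → T (keep u) × T (keep v) × T (R u v)
      inner-spec {u} {v} i = ∧⁻ˡ {keep u} i , ∧⁻ˡ {keep v} (∧⁻ʳ {keep u} i) , ∧⁻ʳ {keep v} (∧⁻ʳ {keep u} i)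

      inner⁺ : ∀ {u v} → T (inner u v) → T (replaced u v)
      inner⁺ {u} {v} = ∨⁺ˡ {inner u v} {redirected u v ∨ redirected v u}

      redirected⁺ : ∀ {u v} → T (redirected u v) → T (replaced u v)
      redirected⁺ {u} {v} r = ∨⁺ʳ {inner u v} (∨⁺ˡ {redirected u v} {redirected v u} r)

      redirected⁻ : ∀ {u v} → T (redirected v u) → T (replaced u v)
      redirected⁻ {u} {v} r = ∨⁺ʳ {inner u v} (∨⁺ʳ {redirected u v} {redirected v u} r)

      redirected⊆G : ∀ {x y} → T (redirected x y) → T (keep x) × T (keep y) × Adj G x y
      redirected⊆G h = let (kx , _ , l) = redirected-spec h ; (ky , _ , _ , xy) = substitute-spec l in kx , ky , xy

      replaced⊆G : ∀ {u v} → T (replaced u v) → T (keep u) × T (keep v) × Adj G u v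
      replaced⊆G {u} {v} h with ∨⁻ {inner u v} h
      ... | inj₁ i = let (ku , kv , r) = inner-spec {u} {v} i in ku , kv , R⊆G r
      ... | inj₂ h′ with ∨⁻ {redirected u v} h′
      ...   | inj₁ r = redirected⊆G r
      ...   | inj₂ r = let (kv , ku , vu) = redirected⊆G r in ku , kv , Adj-sym G vu

      replaced-sym : ∀ {u v} → T (replaced u v) → T (replaced v u)
      replaced-sym {u} {v} h with ∨⁻ {inner u v} h
      ... | inj₁ i = let (ku , kv , r) = inner-spec {u} {v} i in inner⁺ (∧⁺ kv (∧⁺ ku (R-sym r)))
      ... | inj₂ h′ with ∨⁻ {redirected u v} h′
      ...   | inj₁ r = redirected⁻ r
      ...   | inj₂ r = redirected⁺ r

      -- What is left of a component of R that passed through a deleted vertex: a foothold at an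
      -- untouched quiet vertex. Two footholds coincide or are adjacent.
      Anchored : Fin n → Set
      Anchored u = ∃[ y ] (Path replaced u y × T (quiet y) × T (keep y) × ¬ T (touched R y))

      follow : ∀ {u w} → T (keep u) → Path R u w → Anchored u ⊎ (T (keep w) × Path replaced u w)
      follow ku ∎ᵖ = inj₂ (ku , ∎ᵖ)
      follow {u} ku (_◅_ {j = v} r p) with T? (keep v)
      ... | no ¬kv = let del = anyᶠ⁺ (λ v → not (keep v) ∧ R u v) v (∧⁺ (not⁺ ¬kv) r)
                         (y , l) = substitute-exists del
                         (ky , qy , ¬ty , _) = substitute-spec l
                     in inj₁ (y , redirected⁺ (∧⁺ ku (∧⁺ del l)) ◅ ∎ᵖ , qy , ky , ¬ty)
      ... | yes kv with follow kv p
      ...   | inj₁ (y , q , rest) = inj₁ (y , inner⁺ (∧⁺ ku (∧⁺ kv r)) ◅ q , rest)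
      ...   | inj₂ (kw , q)       = inj₂ (kw , inner⁺ (∧⁺ ku (∧⁺ kv r)) ◅ q)

      Joined : Fin n → Fin n → Set
      Joined u v = ∃[ a ] ∃[ b ] (Path replaced u a × Path replaced v b × Adj G a b)

      -- The anchor y is a component of R by itself, so it has a neighbour in the R-component of v.
      -- If the R-path from v to this neighbour meets a deleted vertex, v is anchored too, and the
      -- two anchors join u and v.
      anchored-joined : ∀ {u v} → Anchored u → T (keep v) → ¬ Path replaced u v → Joined u v
      anchored-joined {u} {v} (y , p , qy , ky , ¬ty) kv apart with y Fin.≟ v
      ... | yes refl = ⊥-elim (apart p)
      ... | no y≢v with solution y v (y≢v ∘ untouched-path ¬ty)
      ...   | a , b , ya , vb , ab with untouched-path ¬ty ya | follow kv vb
      ...     | refl | inj₂ (_ , q) = a , b , p , q , ab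
      ...     | refl | inj₁ (z , q , qz , _) with y Fin.≟ z
      ...       | yes refl = ⊥-elim (apart (p ◅◅ invert replaced-sym q))
      ...       | no y≢z = y , z , p , q , quiet-adj G k d qy (quiet⇒light G k d qz) y≢z

      replaced-contracts : ∀ {u v} → T (keep u) → T (keep v) → ¬ Path replaced u v → Joined u v
      replaced-contracts {u} {v} ku kv apart with T? (closure R u v)
      -- Here u and v shared a component that the deletion has cut apart; the path between them met
      -- a deleted vertex, so u is anchored.
      ... | yes c with follow ku (closure-sound R c)
      ...   | inj₁ anchored = anchored-joined anchored kv apart
      ...   | inj₂ (_ , p)  = ⊥-elim (apart p)
      replaced-contracts {u} {v} ku kv apart | no ¬c with solution u v (¬c ∘ closure-complete R)
      ...   | a , b , p , q , ab with follow ku p | follow kv q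
      ...     | inj₁ anchored | _ = anchored-joined anchored kv apart
      ...     | inj₂ _ | inj₁ anchored = let (x , y , p′ , q′ , xy) = anchored-joined anchored ku (apart ∘ invert replaced-sym) in
        y , x , q′ , p′ , Adj-sym G xy
      ...     | inj₂ (_ , p′) | inj₂ (_ , q′) = a , b , p′ , q′ , ab

      outward : Rel n
      outward u v = keep u ∧ (not (keep v) ∧ R u v)

      -- However many deleted R-neighbours a kept vertex has, it receives only one substitute.
      volume-redirected : volume redirected ≤ volume outward
      volume-redirected = sum-mono λ x → ≤-trans (≤-reflexive (sym (count-sum (redirected x)))) (row x)
        where
        row : ∀ x → count (redirected x) ≤ sum λ v → bit (outward x v)
        row x with T? (keep x ∧ reachesDeleted x)
        ... | yes h = let (v , w) = anyᶠ⁻ (λ v → not (keep v) ∧ R x v) (∧⁻ʳ {keep x} h) in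
          ≤-trans (count-unique (redirected x) λ {i} {j} a b → least-unique (substitute x) {i} {j}
              (proj₂ (proj₂ (redirected-spec a))) (proj₂ (proj₂ (redirected-spec b))))
            (≤-trans (≤-reflexive (cong bit (sym (T⇒≡ (∧⁺ {keep x} (∧⁻ˡ h) w))))) (term≤sum (λ v → bit (outward x v)) v))
        ... | no ¬h = ≤-trans (≤-reflexive (count-sum (redirected x))) (≤-trans
          (sum-mono {g = λ _ → 0} λ y → bit-mono {redirected x y} {false} λ r →
            ¬h (∧⁺ (proj₁ (redirected-spec r)) (proj₁ (proj₂ (redirected-spec r)))))
          (≤-trans (≤-reflexive (sum-zero {n})) z≤n))

      volume-replaced : volume replaced ≤ volume R
      volume-replaced = begin
        volume replaced                                        ≤⟨ volume-+ {S = inner} {λ u v → redirected u v ∨ redirected v u} (λ u v → bit-∨ (inner u v) _) ⟩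
        volume inner + volume (λ u v → redirected u v ∨ redirected v u)
          ≤⟨ +-monoʳ-≤ (volume inner) (volume-+ {S = redirected} {λ u v → redirected v u} (λ u v → bit-∨ (redirected u v) _)) ⟩
        volume inner + (volume redirected + volume (λ u v → redirected v u))
          ≤⟨ +-monoʳ-≤ (volume inner) (+-mono-≤ volume-redirected (≤-trans (≤-reflexive (sym (volume-flip redirected))) volume-redirected)) ⟩
        volume inner + (volume outward + volume outward)       ≡⟨ cong (λ z → volume inner + (volume outward + z)) (volume-flip outward) ⟩
        volume inner + (volume outward + volume (λ u v → outward v u))
          ≤⟨ +-monoʳ-≤ (volume inner) (volume-+⁻ {S = outward} {λ u v → outward v u} crossing) ⟩
        volume inner + volume (λ u v → outward u v ∨ outward v u) ≤⟨ volume-+⁻ {S = inner} {λ u v → outward u v ∨ outward v u} exclusive ⟩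
        volume R                                               ∎
        where
        open ≤-Reasoning
        bit-∨ : ∀ a b → bit (a ∨ b) ≤ bit a + bit b
        bit-∨ true  b = s≤s z≤n
        bit-∨ false b = ≤-refl
        crossing : ∀ u v → bit (outward u v) + bit (outward v u) ≤ bit (outward u v ∨ outward v u)
        crossing u v with keep u | keep v
        ... | true  | true  = z≤n
        ... | true  | false with R u v
        ...   | true  = s≤s z≤n
        ...   | false = z≤n
        crossing u v | false | true with R v u
        ...   | true  = s≤s z≤n
        ...   | false = z≤n
        crossing u v | false | false = z≤n
        exclusive : ∀ u v → bit (inner u v) + bit (outward u v ∨ outward v u) ≤ bit (R u v)
        exclusive u v rewrite T-≡ (R-sym {v} {u}) (R-sym {u} {v}) with keep u | keep v
        ... | true  | true  = ≤-reflexive (+-identityʳ _)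
        ... | true  | false with R u v
        ...   | true  = s≤s z≤n
        ...   | false = z≤n
        exclusive u v | false | true  = ≤-refl
        exclusive u v | false | false = z≤n

-- Lifting: repairing the bad components at a cost of one edge each

module LiftedSolutions where

  open import Algebra.Properties.CommutativeSemigroup +-commutativeSemigroup using (interchange)
  open ListPrograms using (anyᴸ; countᴸ)
  open Algorithm
  open Counting
  open GraphTheory
  open Deletion
  open Reduction

  graph-of : ∀ {n} (R : Rel n) → (∀ {u v} → T (R u v) → T (R v u)) → (∀ {u} → ¬ T (R u u)) → Graph n
  graph-of R R-sym R-irrefl = record
    { adj = R ; adj-sym = λ u v → T-≡ (R-sym {u} {v}) R-sym ; adj-irrefl = λ u → ¬T⇒≡ R-irrefl }

  m+m≤n+n⇒m≤n : ∀ {m n} → m + m ≤ n + n → m ≤ n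
  m+m≤n+n⇒m≤n h = ≮⇒≥ λ n<m → <⇒≱ (+-mono-< n<m n<m) h

  module Lifting {n} (G : Graph n) (k d : ℕ) (F′ : Rel (length (Kernel.kept (input G k d))))
    (F′-sym : ∀ {i j} → T (F′ i j) → T (F′ j i)) where

    open Kernel (input G k d) hiding (kept)
    open Kernel.Lift (input G k d) F′ hiding (ι; touched)
    open Restrict keep

    F-spec : ∀ {u v} → T (F u v) → ∃[ i ] ∃[ j ] (ι i ≡ u × ι j ≡ v × T (F′ i j))
    F-spec {u} {v} h =
      let (i , hi) = anyᶠ⁻ (λ i → ι i == u ∧ anyᶠ λ j → ι j == v ∧ F′ i j) h
          (j , hj) = anyᶠ⁻ (λ j → ι j == v ∧ F′ i j) (∧⁻ʳ {ι i == u} hi)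
      in i , j , ==⇒≡ {u = ι i} {u} (∧⁻ˡ hi) , ==⇒≡ {u = ι j} {v} (∧⁻ˡ hj) , ∧⁻ʳ {ι j == v} hj

    F-ι⁺ : ∀ {i j} → T (F′ i j) → T (F (ι i) (ι j))
    F-ι⁺ {i} {j} f = anyᶠ⁺ (λ i′ → ι i′ == ι i ∧ anyᶠ λ j′ → ι j′ == ι j ∧ F′ i′ j′) i (∧⁺ (==-refl (ι i))
      (anyᶠ⁺ (λ j′ → ι j′ == ι j ∧ F′ i j′) j (∧⁺ (==-refl (ι j)) f)))

    F-ι⁻ : ∀ {i j} → T (F (ι i) (ι j)) → T (F′ i j)
    F-ι⁻ h with F-spec h
    ... | i′ , j′ , i≡ , j≡ , f rewrite ι-injective i≡ | ι-injective j≡ = f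

    F-sym : ∀ {u v} → T (F u v) → T (F v u)
    F-sym h with F-spec h
    ... | i , j , refl , refl , f = F-ι⁺ (F′-sym f)

    F-supported : Supported F
    F-supported h with F-spec h
    ... | i , j , refl , refl , _ = ι-keep i , ι-keep j

    volume-F : volume F′ ≡ volume F
    volume-F = trans (volume-cong {R = F′} {restrict F} λ i j → T-≡ (F-ι⁺ {i} {j}) (F-ι⁻ {i} {j})) (volume-restrict {F} F-supported)

    keep-path : ∀ {u v} → T (keep u) → Path F u v → T (keep v)
    keep-path ku ∎ᵖ       = ku
    keep-path ku (r ◅ p) = keep-path (proj₂ (F-supported r)) p

    conn-sym : ∀ {u v} → T (conn u v) → T (conn v u)
    conn-sym c = closure-complete F (invert F-sym (closure-sound F c))

    conn-trans : ∀ {u v w} → T (conn u v) → T (conn v w) → T (conn u w)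
    conn-trans c c′ = closure-complete F (closure-sound F c ◅◅ closure-sound F c′)

    bad⁻ : ∀ {u} → T (bad u) → ∃[ v ] (¬ T (keep v) × (∀ {w} → T (conn u w) → ¬ Adj G w v))
    bad⁻ {u} h =
      let (v , hv) = anyᶠ⁻ (λ v → not (keep v) ∧ not (anyᶠ λ w → conn u w ∧ adj G w v)) h
      in v , not⁻ (∧⁻ˡ {not (keep v)} hv) , λ {w} c wv →
        not⁻ (∧⁻ʳ {not (keep v)} hv) (anyᶠ⁺ (λ w → conn u w ∧ adj G w v) w (∧⁺ c wv))

    bad⁺ : ∀ {u v} → ¬ T (keep v) → (∀ {w} → T (conn u w) → ¬ Adj G w v) → T (bad u)
    bad⁺ {u} {v} ¬kv h = anyᶠ⁺ (λ v → not (keep v) ∧ not (anyᶠ λ w → conn u w ∧ adj G w v)) v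
      (∧⁺ (not⁺ ¬kv) (not⁺ λ a → let (w , hw) = anyᶠ⁻ (λ w → conn u w ∧ adj G w v) a in
        h (∧⁻ˡ {conn u w} hw) (∧⁻ʳ {conn u w} hw)))

    rep-spec : ∀ {r} → T (rep r) → T (keep r) × T (bad r) × (∀ {w} → T (w ≺ r) → ¬ T (conn r w))
    rep-spec {r} h = let h′ = ∧⁻ʳ {keep r} h in ∧⁻ˡ {keep r} h , ∧⁻ˡ {bad r} h′ , λ {w} w≺r c →
      not⁻ (∧⁻ʳ {bad r} h′) (anyᶠ⁺ (λ w → w ≺ r ∧ conn r w) w (∧⁺ w≺r c))

    exit : Fin n → Fin n → Bool
    exit r b = quiet b ∧ anyᶠ (door r b)

    link-spec : ∀ {r a b} → T (link r a b) → T (quiet b) × T (conn r a) × Adj G a b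
    link-spec {r} {a} {b} h =
      let e = least-∈ (exit r) {b} (∧⁻ˡ {least (exit r) b} h)
          x = least-∈ (door r b) {a} (∧⁻ʳ {least (exit r) b} h)
      in ∧⁻ˡ {quiet b} e , ∧⁻ˡ {conn r a} x , ∧⁻ʳ {conn r a} x

    added : Rel n
    added u v = anyᶠ λ r → rep r ∧ link r u v

    extended⁻ : ∀ {u v} → T (extended u v) → T (F u v) ⊎ (T (added u v) ⊎ T (added v u))
    extended⁻ {u} {v} h with ∨⁻ {F u v} h
    ... | inj₁ f = inj₁ f
    ... | inj₂ h′ with anyᶠ⁻ (λ r → rep r ∧ (link r u v ∨ link r v u)) h′
    ...   | r , hr with ∨⁻ {link r u v} (∧⁻ʳ {rep r} hr)
    ...     | inj₁ l = inj₂ (inj₁ (anyᶠ⁺ (λ r → rep r ∧ link r u v) r (∧⁺ (∧⁻ˡ {rep r} hr) l)))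
    ...     | inj₂ l = inj₂ (inj₂ (anyᶠ⁺ (λ r → rep r ∧ link r v u) r (∧⁺ (∧⁻ˡ {rep r} hr) l)))

    F⊆extended : ∀ {u v} → T (F u v) → T (extended u v)
    F⊆extended {u} {v} = ∨⁺ˡ {F u v}

    added⊆extended : ∀ {u v} → T (added u v) → T (extended u v)
    added⊆extended {u} {v} h = let (r , hr) = anyᶠ⁻ (λ r → rep r ∧ link r u v) h in
      ∨⁺ʳ {F u v} (anyᶠ⁺ (λ r → rep r ∧ (link r u v ∨ link r v u)) r
        (∧⁺ {rep r} (∧⁻ˡ {rep r} hr) (∨⁺ˡ {link r u v} (∧⁻ʳ {rep r} hr))))

    added⊆extendedᵀ : ∀ {u v} → T (added v u) → T (extended u v)
    added⊆extendedᵀ {u} {v} h = let (r , hr) = anyᶠ⁻ (λ r → rep r ∧ link r v u) h in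
      ∨⁺ʳ {F u v} (anyᶠ⁺ (λ r → rep r ∧ (link r u v ∨ link r v u)) r
        (∧⁺ {rep r} (∧⁻ˡ {rep r} hr) (∨⁺ʳ {link r u v} (∧⁻ʳ {rep r} hr))))

    extended-sym : ∀ {u v} → T (extended u v) → T (extended v u)
    extended-sym h with extended⁻ h
    ... | inj₁ f        = F⊆extended (F-sym f)
    ... | inj₂ (inj₁ a) = added⊆extendedᵀ a
    ... | inj₂ (inj₂ a) = added⊆extended a

    added⊆G : ∀ {u v} → T (added u v) → Adj G u v
    added⊆G {u} {v} h = let (r , hr) = anyᶠ⁻ (λ r → rep r ∧ link r u v) h in proj₂ (proj₂ (link-spec {r} (∧⁻ʳ {rep r} hr)))

    extended⊆G : (∀ {i j} → T (F′ i j) → Adj G (ι i) (ι j)) → ∀ {u v} → T (extended u v) → Adj G u v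
    extended⊆G F′⊆G h with extended⁻ h
    ... | inj₂ (inj₁ a) = added⊆G a
    ... | inj₂ (inj₂ a) = Adj-sym G (added⊆G a)
    ... | inj₁ f with F-spec f
    ...   | i , j , refl , refl , f′ = F′⊆G f′

    -- Least elements are unique, so every r determines one exit b, and r with b determine one door
    -- a.
    volume-added : volume added ≤ count rep
    volume-added = begin
      volume added                                                      ≤⟨ sum-mono (λ u → sum-mono (spread u)) ⟩
      sum (λ u → sum λ v → sum λ r → bit (rep r ∧ link r u v))          ≡⟨ sum-cong-≗ (λ u → ∑-comm (λ v r → bit (rep r ∧ link r u v))) ⟩
      sum (λ u → sum λ r → sum λ v → bit (rep r ∧ link r u v))          ≡⟨ ∑-comm (λ u r → sum λ v → bit (rep r ∧ link r u v)) ⟩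
      sum (λ r → sum λ u → sum λ v → bit (rep r ∧ link r u v))          ≡⟨ sum-cong-≗ (λ r → ∑-comm (λ u v → bit (rep r ∧ link r u v))) ⟩
      sum (λ r → sum λ v → sum λ u → bit (rep r ∧ link r u v))          ≤⟨ sum-mono (λ r → sum-mono (one-door r)) ⟩
      sum (λ r → sum λ v → bit (rep r ∧ least (exit r) v))              ≤⟨ sum-mono one-exit ⟩
      sum (bit ∘ rep)                                                   ≡⟨ count-sum rep ⟨
      count rep                                                         ∎
      where
      open ≤-Reasoning
      spread : ∀ u v → bit (added u v) ≤ sum λ r → bit (rep r ∧ link r u v)
      spread u v with added u v in eq
      ... | false = z≤n
      ... | true  = let (r , hr) = anyᶠ⁻ (λ r → rep r ∧ link r u v) (subst T (sym eq) _) in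
        ≤-trans (≤-reflexive (cong bit (sym (T⇒≡ hr)))) (term≤sum (λ r → bit (rep r ∧ link r u v)) r)
      zeros : ∀ (p : Fin n → Bool) → (∀ x → ¬ T (p x)) → count p ≤ 0
      zeros p none = ≤-trans (≤-reflexive (count-sum p)) (≤-trans
        (sum-mono {g = λ _ → 0} λ x → bit-mono {p x} {false} (none x)) (≤-reflexive (sum-zero {n})))
      one-door : ∀ r v → sum (λ u → bit (rep r ∧ link r u v)) ≤ bit (rep r ∧ least (exit r) v)
      one-door r v = ≤-trans (≤-reflexive (sym (count-sum λ u → rep r ∧ link r u v))) (go (T? (rep r ∧ least (exit r) v)))
        where
        go : Dec (T (rep r ∧ least (exit r) v)) → count (λ u → rep r ∧ link r u v) ≤ bit (rep r ∧ least (exit r) v)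
        go (yes h) = ≤-trans (count-unique (λ u → rep r ∧ link r u v) λ {i} {j} hi hj →
          least-unique (door r v) {i} {j} (∧⁻ʳ {least (exit r) v} (∧⁻ʳ {rep r} hi)) (∧⁻ʳ {least (exit r) v} (∧⁻ʳ {rep r} hj)))
          (≤-reflexive (cong bit (sym (T⇒≡ h))))
        go (no ¬h) = ≤-trans (zeros (λ u → rep r ∧ link r u v) λ u h →
          ¬h (∧⁺ {rep r} (∧⁻ˡ {rep r} h) (∧⁻ˡ {least (exit r) v} (∧⁻ʳ {rep r} h)))) z≤n
      one-exit : ∀ r → sum (λ v → bit (rep r ∧ least (exit r) v)) ≤ bit (rep r)
      one-exit r = ≤-trans (≤-reflexive (sym (count-sum λ v → rep r ∧ least (exit r) v))) (go (T? (rep r)))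
        where
        go : Dec (T (rep r)) → count (λ v → rep r ∧ least (exit r) v) ≤ bit (rep r)
        go (yes h) = ≤-trans (count-unique (λ v → rep r ∧ least (exit r) v) λ {i} {j} hi hj →
          least-unique (exit r) {i} {j} (∧⁻ʳ {rep r} hi) (∧⁻ʳ {rep r} hj)) (≤-reflexive (cong bit (sym (T⇒≡ h))))
        go (no ¬h) = ≤-trans (zeros (λ v → rep r ∧ least (exit r) v) λ v h → ¬h (∧⁻ˡ {rep r} h)) z≤n

    volume-extended : volume extended ≤ volume F + (count rep + count rep)
    volume-extended = begin
      volume extended                                    ≤⟨ volume-+ {S = F} {λ u v → added u v ∨ added v u} each ⟩
      volume F + volume (λ u v → added u v ∨ added v u)  ≤⟨ +-monoʳ-≤ (volume F) (volume-+ {S = added} {λ u v → added v u} λ u v → bit-∨ (added u v) _) ⟩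
      volume F + (volume added + volume (λ u v → added v u)) ≤⟨ +-monoʳ-≤ (volume F) (+-mono-≤ volume-added (≤-trans (≤-reflexive (sym (volume-flip added))) volume-added)) ⟩
      volume F + (count rep + count rep)                 ∎
      where
      open ≤-Reasoning
      bit-∨ : ∀ a b → bit (a ∨ b) ≤ bit a + bit b
      bit-∨ true  b = s≤s z≤n
      bit-∨ false b = ≤-refl
      each : ∀ u v → bit (extended u v) ≤ bit (F u v) + bit (added u v ∨ added v u)
      each u v = ≤-trans (bit-mono {extended u v} {F u v ∨ (added u v ∨ added v u)} to) (bit-∨ (F u v) _)
        where
        to : T (extended u v) → T (F u v ∨ (added u v ∨ added v u))
        to h with extended⁻ h
        ... | inj₁ f        = ∨⁺ˡ {F u v} f
        ... | inj₂ (inj₁ a) = ∨⁺ʳ {F u v} (∨⁺ˡ {added u v} a)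
        ... | inj₂ (inj₂ a) = ∨⁺ʳ {F u v} (∨⁺ʳ {added u v} a)

    module Solution (F′-irrefl : ∀ {i} → ¬ T (F′ i i)) (ok : ¬ T infeasible) (few : count (touched F) < K)
                    (solution : Contracts (restrict (adj G)) F′) where

      private
        Joined : Fin n → Fin n → Set
        Joined u v = ∃[ a ] ∃[ b ] (Path F u a × Path F v b × Adj G a b)

      F-irrefl : ∀ {u} → ¬ T (F u u)
      F-irrefl h with F-spec h
      ... | i , j , refl , eq , f rewrite ι-injective eq = F′-irrefl f

      F-contracts : ∀ {u v} → T (keep u) → T (keep v) → ¬ Path F u v → Joined u v
      F-contracts ku kv apart with ι-onto ku | ι-onto kv
      ... | i , refl | j , refl with solution i j (apart ∘ gmap ι F-ι⁺)
      ...   | a , b , p , q , ab = ι a , ι b , gmap ι F-ι⁺ p , gmap ι F-ι⁺ q , ab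

      -- The missed vertex v is deleted and therefore quiet, that is, adjacent to every other light
      -- vertex. A light member of the component would be adjacent to v, since it is kept and so
      -- differs from v.
      bad-heavy : ∀ {r v w} → T (keep r) → ¬ T (keep v) → (∀ {w} → T (conn r w) → ¬ Adj G w v) → T (conn r w) → T (heavy w)
      bad-heavy {r} {v} {w} kr ¬kv miss c = ¬¬T λ light →
        miss c (Adj-sym G (quiet-adj G k d (deleted⇒quiet G k d ok ¬kv) (not⁻ light)
          λ { refl → ¬kv (keep-path kr (closure-sound F c)) }))

      untouched-joined : ∀ {r y} → T (keep r) → T (keep y) → ¬ T (touched F y) → ¬ T (conn r y) → ∃[ a ] (T (conn r a) × Adj G a y)
      untouched-joined {r} {y} kr ky ¬ty ¬c with F-contracts kr ky (¬c ∘ closure-complete F)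
      ... | a , b , p , q , ab with untouched-path ¬ty q
      ...   | refl = a , closure-complete F p , ab

      -- By way of the empty tuple there is a kept quiet vertex that F does not touch. It is a
      -- component by itself, different from the all-heavy component of r, so the clique condition
      -- in the kernel makes the two adjacent.
      bad-exit : ∀ {r} → T (keep r) → T (bad r) → ∃[ b ] T (exit r b)
      bad-exit {r} kr br =
        let (v , ¬kv , miss) = bad⁻ br
            []∈ = avoiding-complete G k d ok ¬kv [] z≤n
            (y , e , ¬ty) = prefix-escapes quiet (touched F) few (deleted⇒quiet G k d ok ¬kv) (inj₂ (¬kv ∘ early-avoiding⇒keep G k d ok []∈))
            qy = ∧⁻ˡ {quiet y} e
            (a , c , ay) = untouched-joined kr (early-avoiding⇒keep G k d ok []∈ e) ¬ty
              (λ c → quiet⇒light G k d qy (bad-heavy kr ¬kv miss c))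
        in y , ∧⁺ {quiet y} qy (anyᶠ⁺ (door r y) a (∧⁺ {conn r a} c ay))

      -- If the component had at most d vertices, its tuple A would have been enumerated, and v was deleted only
      -- because K vertices avoiding A were kept.
      bad-large : ∀ {r} → T (keep r) → T (bad r) → d < count (conn r)
      bad-large {r} kr br = ≰⇒> λ small →
        let (v , ¬kv , miss) = bad⁻ br
            A = filterᵇ (conn r) (allFin n)
            in-class : ∀ {x} → x ∈ A → T (conn r x)
            in-class = λ x∈ → proj₂ (∈-filter⁻ (T? ∘ conn r) {xs = allFin n} x∈)
            A∈ = avoiding-complete G k d ok ¬kv (All.tabulate (λ x∈ → bad-heavy kr ¬kv miss (in-class x∈)))
                   (≤-trans (≤-reflexive (length-filter (conn r))) small)
            (y , e , ¬ty) = prefix-escapes (avoiding A) (touched F) few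
              (avoiding⁺ G k d A (deleted⇒quiet G k d ok ¬kv) (miss ∘ in-class)) (inj₂ (¬kv ∘ early-avoiding⇒keep G k d ok A∈))
            y-avoids = ∧⁻ˡ {avoiding A y} e
            (a , c , ay) = untouched-joined kr (early-avoiding⇒keep G k d ok A∈ e) ¬ty
              (λ c → quiet⇒light G k d (avoiding⇒quiet G k d A y-avoids) (bad-heavy kr ¬kv miss c))
        in avoiding⁻ G k d (∈-filter⁺ (T? ∘ conn r) (∈-allFin a) c) y-avoids ay

      rep-exists : ∀ {u} → T (keep u) → T (bad u) → ∃[ r ] (T (conn u r) × T (rep r))
      rep-exists {u} ku bu =
        let (r , l) = least-exists (conn u) {u} (closure-complete F ∎ᵖ)
            ur = least-∈ (conn u) {r} l
            (v , ¬kv , miss) = bad⁻ bu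
        in r , ur , ∧⁺ {keep r} (keep-path ku (closure-sound F ur))
          (∧⁺ {bad r} (bad⁺ ¬kv (miss ∘ conn-trans ur)) (not⁺ λ h →
            let (w , hw) = anyᶠ⁻ (λ w → w ≺ r ∧ conn r w) h in
            least-≮ (conn u) {r} l {w} (∧⁻ˡ {w ≺ r} hw) (conn-trans ur (∧⁻ʳ {w ≺ r} hw))))

      rep-link : ∀ {r} → T (rep r) → ∃[ a ] ∃[ b ] T (link r a b)
      rep-link {r} h =
        let (kr , br , _) = rep-spec h
            (b₀ , e₀) = bad-exit kr br
            (b , lb) = least-exists (exit r) {b₀} e₀
            (a₀ , x₀) = anyᶠ⁻ (door r b) (∧⁻ʳ {quiet b} (least-∈ (exit r) {b} lb))
            (a , la) = least-exists (door r b) {a₀} x₀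
        in a , b , ∧⁺ {least (exit r) b} lb la

      extended-path : ∀ {u v} → T (conn u v) → Path extended u v
      extended-path c = gmap id F⊆extended (closure-sound F c)

      bad-reaches-quiet : ∀ {u} → T (keep u) → T (bad u) → ∃[ b ] (T (quiet b) × Path extended u b)
      bad-reaches-quiet ku bu =
        let (r , ur , hr) = rep-exists ku bu
            (a , b , l) = rep-link hr
            (qb , ra , _) = link-spec {r} {a} {b} l
        in b , qb , extended-path ur ◅◅ extended-path ra
             ◅◅ added⊆extended (anyᶠ⁺ (λ r → rep r ∧ link r a b) r (∧⁺ {rep r} hr l)) ◅ ∎ᵖ

      meets : ∀ {u v} → T (keep u) → ¬ T (keep v) → ¬ Path extended u v → ∃[ a ] (Path extended u a × Adj G a v)
      meets {u} {v} ku ¬kv apart with T? (bad u)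
      -- The quiet end b of the added edge could be v itself, but then u and v would be connected.
      ... | yes bu = let (b , qb , p) = bad-reaches-quiet ku bu in b , p ,
        quiet-adj G k d qb (quiet⇒light G k d (deleted⇒quiet G k d ok ¬kv)) λ b≡v → apart (subst (Path extended u) b≡v p)
      ... | no good with T? (anyᶠ λ w → conn u w ∧ adj G w v)
      ...   | yes h = let (w , hw) = anyᶠ⁻ (λ w → conn u w ∧ adj G w v) h in
        w , extended-path (∧⁻ˡ {conn u w} hw) , ∧⁻ʳ {conn u w} hw
      ...   | no ¬h = ⊥-elim (good (bad⁺ ¬kv λ {w} c wv → ¬h (anyᶠ⁺ (λ w → conn u w ∧ adj G w v) w (∧⁺ {conn u w} c wv))))

      extended-contracts : Contracts (adj G) extended
      extended-contracts u v apart with T? (keep u) | T? (keep v)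
      ... | yes ku | yes kv = let (a , b , p , q , ab) = F-contracts ku kv (apart ∘ gmap id F⊆extended) in
        a , b , gmap id F⊆extended p , gmap id F⊆extended q , ab
      ... | no ¬ku | no ¬kv = u , v , ∎ᵖ , ∎ᵖ , quiet-adj G k d (deleted⇒quiet G k d ok ¬ku)
        (quiet⇒light G k d (deleted⇒quiet G k d ok ¬kv)) λ { refl → apart ∎ᵖ }
      ... | yes ku | no ¬kv = let (a , p , av) = meets ku ¬kv apart in a , v , p , ∎ᵖ , av
      ... | no ¬ku | yes kv = let (a , p , au) = meets kv ¬ku (apart ∘ invert extended-sym) in u , a , ∎ᵖ , p , Adj-sym G au

      count-rep : (H : Graph n) → (∀ u v → adj H u v ≡ F u v) → count rep * d ≤ length (edges H)
      count-rep H H≡F = forest-bound H rep conn (gmap id (λ {u} {v} → subst T (sym (H≡F u v))) ∘ closure-sound F)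
        (λ hr hr′ p → apart hr hr′ (closure-complete F (gmap id (λ {u} {v} → subst T (H≡F u v)) p)))
        (λ r hr → let (kr , br , _) = rep-spec hr in bad-large kr br)
        where
        apart : ∀ {r r′} → T (rep r) → T (rep r′) → T (conn r r′) → r ≡ r′
        apart {r} {r′} hr hr′ c with Fin.<-cmp r r′
        ... | tri< r<r′ _ _ = ⊥-elim (proj₂ (proj₂ (rep-spec hr′)) (<⇒≺ r<r′) (conn-sym c))
        ... | tri≈ _ eq _   = eq
        ... | tri> _ _ r′<r = ⊥-elim (proj₂ (proj₂ (rep-spec hr)) (<⇒≺ r′<r) c)

      -- Every bad component costs one new edge, while `count-rep` finds d edges of F per bad
      -- component; so the new edges, taken d times, number at most as many as those of H.
      lifted-size : (H : Graph (length kept)) → (∀ i j → adj H i j ≡ F′ i j) →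
        (L : Graph n) → (∀ u v → adj L u v ≡ extended u v) → d * length (edges L) ≤ suc d * length (edges H)
      lifted-size H H≡F′ L L≡ = begin
        d * ∣L∣              ≤⟨ *-monoʳ-≤ d L≤ ⟩
        d * (∣H∣ + count rep) ≡⟨ *-distribˡ-+ d ∣H∣ (count rep) ⟩
        d * ∣H∣ + d * count rep ≤⟨ +-monoʳ-≤ (d * ∣H∣) (≤-trans (≤-reflexive (*-comm d (count rep)))
                                   (≤-trans (count-rep Fᴳ (λ _ _ → refl)) F≤)) ⟩
        d * ∣H∣ + ∣H∣        ≡⟨ +-comm (d * ∣H∣) ∣H∣ ⟩
        suc d * ∣H∣          ∎
        where
        open ≤-Reasoning
        ∣L∣ = length (edges L)
        ∣H∣ = length (edges H)
        Fᴳ : Graph n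
        Fᴳ = graph-of F F-sym F-irrefl
        volume-H : volume F ≡ ∣H∣ + ∣H∣
        volume-H = trans (sym volume-F) (trans (volume-cong (λ i j → sym (H≡F′ i j))) (volume-edges H))
        F≤ : length (edges Fᴳ) ≤ ∣H∣
        F≤ = m+m≤n+n⇒m≤n (≤-reflexive (trans (sym (volume-edges Fᴳ)) volume-H))
        L≤ : ∣L∣ ≤ ∣H∣ + count rep
        L≤ = m+m≤n+n⇒m≤n (begin
          ∣L∣ + ∣L∣                          ≡⟨ volume-edges L ⟨
          volume (adj L)                     ≡⟨ volume-cong L≡ ⟩
          volume extended                    ≤⟨ volume-extended ⟩
          volume F + (count rep + count rep) ≡⟨ cong (_+ (count rep + count rep)) volume-H ⟩
          ∣H∣ + ∣H∣ + (count rep + count rep) ≡⟨ interchange ∣H∣ ∣H∣ (count rep) (count rep) ⟩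
          ∣H∣ + count rep + (∣H∣ + count rep) ∎)

-- From relations to instances, solutions and capped values

module Instances where

  open import Data.Integer.Base as ℤ using (+_)
  open import Relation.Nullary.Construct.Add.Supremum using (⊤⁺; [_])
  open import Relation.Binary.Construct.Add.Supremum.NonStrict (Data.Nat.Base._≤_) using (_≤⁺_) renaming ([_] to ≤[_])
  open Algorithm
  open Counting
  open GraphTheory
  open Deletion
  open Reduction
  open LiftedSolutions
  open Programs
  open ListPrograms using (size-encodeℕ; listᴱ-tabulate; ⊨-length)
  open VertexPrograms
  open ReductionProgram hiding (length-cons-all)
  open LiftingProgram

  open CCInstance

  inputOf : ℕ → CCInstance → Input
  inputOf d I = input (graph I) (k I) d

  module _ (d : ℕ) (I : CCInstance) where

    private
      G : Graph (order I)
      G = graph I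

    open Kernel (inputOf d I) hiding (kept)
    open Restrict keep

    some-kept : Fin (order I) → ∃[ v ] T (keep v)
    some-kept u with T? infeasible | T? (keep u)
    ... | _      | yes ku = u , ku
    ... | no ok  | no ¬ku =
      let (y , e , _) = prefix-escapes quiet (λ _ → false)
            (s≤s (≤-trans (≤-reflexive (trans (count-sum {order I} (λ _ → false)) (sum-zero {order I}))) z≤n))
            (deleted⇒quiet G (k I) d ok ¬ku) (inj₁ id)
      in y , early-avoiding⇒keep G (k I) d ok (avoiding-complete G (k I) d ok ¬ku [] z≤n) e
    ... | yes bad | no _ =
      let (y , l) = least-exists (λ _ → true) {u} _ in
      y , subst T (sym (keep≡first G (k I) d bad y)) (not⁺ λ h →
        let (w , w≺y) = anyᶠ⁻ (λ w → w ≺ y) h in least-≮ (λ _ → true) {y} l w≺y _)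

    reduce : CCInstance
    reduce = record
      { order     = length kept
      ; graph     = induced G ι
      ; connected = nonEmpty , reduced-connected G (k I) d (proj₂ (connected I))
      ; k         = k I
      ; k-pos     = k-pos I
      }
      where
      nonZero⇒Fin : ∀ {n} → NonZero n → Fin n
      nonZero⇒Fin {suc n} _ = zero
      fin⇒nonZero : ∀ {n} → Fin n → NonZero n
      fin⇒nonZero zero    = _
      fin⇒nonZero (suc _) = _
      nonEmpty : NonZero (length kept)
      nonEmpty = fin⇒nonZero (proj₁ (ι-onto (proj₂ (some-kept (nonZero⇒Fin (proj₁ (connected I)))))))

    order-reduce : NonZero d → order reduce ≤ 4 * 3 ^ suc d * k I ^ suc d
    order-reduce d>0 = ≤-trans (≤-reflexive (length-filter keep)) (count-keep G (k I) d {{k-pos I}} {{d>0}})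

    module _ (S′ : EdgeSet (graph reduce)) where

      private
        H : Graph (length kept)
        H = subgraph S′

      open Kernel.Lift (inputOf d I) (adj H) using (lifted; extended; F) renaming (touched to touchedF)
      open Lifting G (k I) d (adj H) (Adj-sym H)

      giveUp : Bool
      giveUp = infeasible ∨ not (count touchedF <ᵇ K)

      private
        choose : ∀ c {x y x′ y′} → (T x → T x′) → (T y → T y′) → T (if c then x else y) → T (if c then x′ else y′)
        choose true  f _ = f
        choose false _ g = g

        either : ∀ c {x y z} → (T x → T z) → (T y → T z) → T (if c then x else y) → T z
        either true  f _ = f
        either false _ g = g

      lifted⊆G : ∀ {u v} → T (lifted u v) → Adj G u v
      lifted⊆G {u} {v} = either giveUp id (extended⊆G (included S′))

      lift : EdgeSet G
      lift = record
        { subgraph = graph-of lifted (λ {u} {v} → choose giveUp (Adj-sym G {u} {v}) (extended-sym {u} {v}))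
            (¬Adj-refl G (k I) d ∘ lifted⊆G)
        ; included = lifted⊆G
        }
  isClique⇒contracts : ∀ {n} {G : Graph n} (F : EdgeSet G) → QuotientGraph.IsClique (G / F) → Contracts (adj G) (adj (subgraph F))
  isClique⇒contracts F c u v apart = proj₂ (c u v apart)

  contracts⇒isClique : ∀ {n} {G : Graph n} (F : EdgeSet G) → Contracts (adj G) (adj (subgraph F)) → QuotientGraph.IsClique (G / F)
  contracts⇒isClique F c u v apart = apart , c u v apart

  allEdges : ∀ {n} (G : Graph n) → EdgeSet G
  allEdges G = record { subgraph = G ; included = id }

  allEdges-clique : (I : CCInstance) → QuotientGraph.IsClique (graph I / allEdges (graph I))
  allEdges-clique I u v apart = ⊥-elim (apart (proj₂ (connected I) u v))

  []⁻ : ∀ {m n : ℕ} → [ m ] ≤⁺ [ n ] → m ≤ n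
  []⁻ ≤[ m≤n ] = m≤n

  module _ {d : ℕ} {I : CCInstance} where

    private
      G : Graph (order I)
      G = graph I
      n : ℕ
      n = order I
      I′ : CCInstance
      I′ = reduce d I

    open Kernel (inputOf d I) hiding (kept)
    open Restrict keep
    open ParamMinProblem CliqueContraction using (IsOPT; HasValue)

    few-touched : (H : Graph n) → length (edges H) ≤ k I → count (touched (adj H)) < K
    few-touched H H≤k = s≤s (≤-trans (touched≤volume (adj H)) (≤-trans (≤-reflexive (volume-edges H)) (+-mono-≤ H≤k H≤k)))

    shrink : (S : EdgeSet G) → QuotientGraph.IsClique (G / S) → ∣ S ∣ᵉ ≤ k I →
      ∃[ S′ ] (QuotientGraph.IsClique (graph I′ / S′) × ∣ S′ ∣ᵉ ≤ ∣ S ∣ᵉ)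
    shrink S c S≤k = S′ , contracts⇒isClique S′ contracts , m+m≤n+n⇒m≤n (begin
        ∣ S′ ∣ᵉ + ∣ S′ ∣ᵉ           ≡⟨ volume-edges (subgraph S′) ⟨
        volume (restrict replaced)  ≡⟨ volume-restrict {replaced} supported ⟩
        volume replaced             ≤⟨ volume-replaced ⟩
        volume (adj (subgraph S))   ≡⟨ volume-edges (subgraph S) ⟩
        ∣ S ∣ᵉ + ∣ S ∣ᵉ             ∎)
      where
      open ≤-Reasoning
      open Replace G (k I) d (Adj-sym (subgraph S)) (included S) (isClique⇒contracts S c) (few-touched (subgraph S) S≤k)
      replacedGraph : Graph n
      replacedGraph = graph-of replaced replaced-sym (¬Adj-refl G (k I) d ∘ proj₂ ∘ proj₂ ∘ replaced⊆G)
      S′ : EdgeSet (graph I′)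
      S′ = record { subgraph = induced replacedGraph ι ; included = proj₂ ∘ proj₂ ∘ replaced⊆G }
      supported : Supported replaced
      supported r = let (ku , kv , _) = replaced⊆G r in ku , kv
      keep-path : ∀ {u v} → T (keep u) → Path replaced u v → T (keep v)
      keep-path ku ∎ᵖ       = ku
      keep-path ku (r ◅ p) = keep-path (proj₂ (supported r)) p
      contracts : Contracts (restrict (adj G)) (restrict replaced)
      contracts i j apart with replaced-contracts (ι-keep i) (ι-keep j) (apart ∘ path-restrict supported)
      ... | a , b , p , q , ab with path-down supported p | path-down supported q
      ...   | a′ , refl , p′ | b′ , refl , q′ = a′ , b′ , p′ , q′ , ab

    opt≤ : ∀ {o} → IsOPT I′ [ o ] → (S′ : EdgeSet (graph I′)) → QuotientGraph.IsClique (graph I′ / S′) → o ≤ ∣ S′ ∣ᵉ ⊓ suc (k I)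
    opt≤ (_ , best) S′ c = []⁻ (best S′ _ (clique c))

    opt-finite : ∀ {J} → ¬ IsOPT J ⊤⁺
    opt-finite {J} (_ , best) with best (allEdges (graph J)) _ (clique (allEdges-clique J))
    ... | ()

    opt′≤opt : ∀ {o o′} → IsOPT I [ o ] → IsOPT I′ [ o′ ] → o′ ≤ o
    opt′≤opt ((S , clique c) , _) opt′ with ∣ S ∣ᵉ ≤? k I
    ... | yes S≤k = let (S′ , c′ , S′≤S) = shrink S c S≤k in
      ≤-trans (opt≤ opt′ S′ c′) (⊓-mono-≤ S′≤S ≤-refl)
    -- An optimum beyond k is capped to k + 1, and contracting all edges of the connected kernel
    -- never has a larger value.
    ... | no S≰k = ≤-trans (opt≤ opt′ (allEdges (graph I′)) (allEdges-clique I′))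
      (≤-trans (m⊓n≤n _ (suc (k I))) (≤-reflexive (sym (m≥n⇒m⊓n≡n (≰⇒> S≰k)))))

    infeasible-opt : T infeasible → ∀ {o} → IsOPT I [ o ] → o ≡ suc (k I)
    infeasible-opt bad ((S , clique c) , _) with ∣ S ∣ᵉ ≤? k I
    ... | yes S≤k = ⊥-elim (feasible G (k I) d (isClique⇒contracts S c) (few-touched (subgraph S) S≤k) bad)
    ... | no S≰k  = m≥n⇒m⊓n≡n (≰⇒> S≰k)

    module _ (S′ : EdgeSet (graph I′)) (c′ : QuotientGraph.IsClique (graph I′ / S′)) where

      private
        H : Graph (length kept)
        H = subgraph S′
        L : EdgeSet G
        L = lift d I S′
        module 𝕃 = Kernel.Lift (inputOf d I) (adj H)
        module Lg = Lifting G (k I) d (adj H) (Adj-sym H)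

      lifted-giveUp : T (giveUp d I S′) → ∀ u v → 𝕃.lifted u v ≡ adj G u v
      lifted-giveUp h u v = cong (λ b → if b then adj G u v else 𝕃.extended u v) (T⇒≡ h)

      lifted-extended : ¬ T (giveUp d I S′) → ∀ u v → 𝕃.lifted u v ≡ 𝕃.extended u v
      lifted-extended h u v = cong (λ b → if b then adj G u v else 𝕃.extended u v) (¬T⇒≡ h)

      private
        module Go (go : ¬ T (giveUp d I S′)) = Lg.Solution
          (λ {i} f → subst T (adj-irrefl H i) f) (go ∘ ∨⁺ˡ {infeasible})
          (<ᵇ⇒< (count 𝕃.touched) K (¬¬T (go ∘ ∨⁺ʳ {infeasible}))) (isClique⇒contracts S′ c′)

      lift-clique : QuotientGraph.IsClique (G / L)
      lift-clique with T? (giveUp d I S′)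
      ... | yes h = λ u v apart → ⊥-elim (apart (gmap id (λ {x} {y} → subst T (sym (lifted-giveUp h x y))) (proj₂ (connected I) u v)))
      ... | no go = contracts⇒isClique L λ u v apart →
        let (a , b , p , q , ab) = Go.extended-contracts go u v (apart ∘ gmap id to) in a , b , gmap id to p , gmap id to q , ab
        where
        to : ∀ {x y} → T (𝕃.extended x y) → T (𝕃.lifted x y)
        to {x} {y} = subst T (sym (lifted-extended go x y))

      lift-value : ¬ T infeasible → d * (∣ L ∣ᵉ ⊓ suc (k I)) ≤ suc d * (∣ S′ ∣ᵉ ⊓ suc (k I))
      lift-value ok with T? (giveUp d I S′) | ∣ S′ ∣ᵉ ≤? k I
      ... | _     | no S′≰k = begin
        d * (∣ L ∣ᵉ ⊓ suc (k I))       ≤⟨ *-mono-≤ (n≤1+n d) (m⊓n≤n ∣ L ∣ᵉ (suc (k I))) ⟩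
        suc d * suc (k I)              ≡⟨ cong (suc d *_) (m≥n⇒m⊓n≡n (≰⇒> S′≰k)) ⟨
        suc d * (∣ S′ ∣ᵉ ⊓ suc (k I))  ∎
        where open ≤-Reasoning
      ... | no go | yes S′≤k = begin
        d * (∣ L ∣ᵉ ⊓ suc (k I))       ≤⟨ *-monoʳ-≤ d (m⊓n≤m ∣ L ∣ᵉ (suc (k I))) ⟩
        d * ∣ L ∣ᵉ                     ≤⟨ Go.lifted-size go H (λ _ _ → refl) (subgraph L) (lifted-extended go) ⟩
        suc d * ∣ S′ ∣ᵉ                ≡⟨ cong (suc d *_) (m≤n⇒m⊓n≡m (m≤n⇒m≤1+n S′≤k)) ⟨
        suc d * (∣ S′ ∣ᵉ ⊓ suc (k I))  ∎
        where open ≤-Reasoning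
      -- Giving up is excluded here: at most k edges touch at most 2k vertices, which is less than
      -- K.
      ... | yes h | yes S′≤k with ∨⁻ {infeasible} h
      ...   | inj₁ bad  = ⊥-elim (ok bad)
      ...   | inj₂ many = ⊥-elim (not⁻ many (<⇒<ᵇ (s≤s (≤-trans (touched≤volume 𝕃.F)
        (≤-trans (≤-reflexive (trans (sym Lg.volume-F) (volume-edges H))) (+-mono-≤ S′≤k S′≤k))))))

-- Rational arithmetic and the approximation ratio

module Ratios where

  open import Data.Integer.Base as ℤ using (+_)
  import Data.Integer.Properties as ℤ
  open import Data.Rational.Base as ℚ using (ℚ; 1ℚ; toℚᵘ)
  import Data.Rational.Properties as ℚ
  open import Data.Rational.Unnormalised.Base as ℚᵘ using (mkℚᵘ; *≤*; *≡*)
  import Data.Rational.Unnormalised.Properties as ℚᵘ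
  open import Relation.Nullary.Construct.Add.Supremum using (⊤⁺; [_])
  open Algorithm
  open Counting
  open GraphTheory
  open Deletion
  open Reduction
  open LiftedSolutions
  open Instances
  open Programs
  open ListPrograms using (size-encodeℕ; listᴱ-tabulate; ⊨-length)
  open VertexPrograms
  open ReductionProgram hiding (length-cons-all)
  open LiftingProgram

  toℚᵘ-/ : ∀ m n → toℚᵘ (+ m ℚ./ suc n) ℚᵘ.≃ mkℚᵘ (+ m) n
  toℚᵘ-/ m n = ℚ.toℚᵘ-fromℚᵘ (mkℚᵘ (+ m) n)

  ratio-≤ : ∀ d v o v′ o′ → suc d * (v * suc o′) ≤ suc (suc d) * (v′ * suc o) →
    (+ v ℚ./ suc o) ℚ.≤ (+ suc (suc d) ℚ./ suc d) ℚ.* (+ v′ ℚ./ suc o′)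
  ratio-≤ d v o v′ o′ h = ℚ.toℚᵘ-cancel-≤ (begin
    toℚᵘ (+ v ℚ./ suc o)                                           ≃⟨ toℚᵘ-/ v o ⟩
    mkℚᵘ (+ v) o                                                   ≤⟨ *≤* (ℤ.≤-trans (ℤ.≤-reflexive (sym (ℤ.pos-* v (suc d * suc o′)))) (ℤ.≤-trans (ℤ.+≤+ h′)
                                                                      (ℤ.≤-reflexive (trans (ℤ.pos-* (suc (suc d) * v′) (suc o)) (cong (ℤ._* + suc o) (ℤ.pos-* (suc (suc d)) v′)))))) ⟩
    mkℚᵘ (+ suc (suc d)) d ℚᵘ.* mkℚᵘ (+ v′) o′                     ≃⟨ ℚᵘ.*-cong (toℚᵘ-/ (suc (suc d)) d) (toℚᵘ-/ v′ o′) ⟨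
    toℚᵘ (+ suc (suc d) ℚ./ suc d) ℚᵘ.* toℚᵘ (+ v′ ℚ./ suc o′)      ≃⟨ ℚ.toℚᵘ-homo-* (+ suc (suc d) ℚ./ suc d) (+ v′ ℚ./ suc o′) ⟨
    toℚᵘ ((+ suc (suc d) ℚ./ suc d) ℚ.* (+ v′ ℚ./ suc o′))          ∎)
    where
    open ℚᵘ.≤-Reasoning
    h′ : v * (suc d * suc o′) ≤ suc (suc d) * v′ * suc o
    h′ = ≤-trans (≤-reflexive (trans (sym (*-assoc v (suc d) (suc o′))) (trans (cong (_* suc o′) (*-comm v (suc d))) (*-assoc (suc d) v (suc o′)))))
      (≤-trans h (≤-reflexive (sym (*-assoc (suc (suc d)) v′ (suc o)))))

  -- With D = d + 1, adding D to both sides of the hypothesis gives D + 1 ≤ D r, which is then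
  -- divided by D.
  1+1/d≤ : ∀ d r → 1ℚ ℚ.≤ (+ suc d ℚ./ 1) ℚ.* (r ℚ.- 1ℚ) → (+ suc (suc d) ℚ./ suc d) ℚ.≤ r
  1+1/d≤ d r h = ℚ.*-cancelˡ-≤-pos D {{ℚ.normalize-pos (suc d) 1}} (begin
    D ℚ.* (+ suc (suc d) ℚ./ suc d)  ≡⟨ clear ⟩
    1ℚ ℚ.+ D                         ≤⟨ ℚ.+-monoˡ-≤ D h ⟩
    D ℚ.* (r ℚ.- 1ℚ) ℚ.+ D           ≡⟨ cong (D ℚ.* (r ℚ.- 1ℚ) ℚ.+_) (ℚ.*-identityʳ D) ⟨
    D ℚ.* (r ℚ.- 1ℚ) ℚ.+ D ℚ.* 1ℚ    ≡⟨ ℚ.*-distribˡ-+ D (r ℚ.- 1ℚ) 1ℚ ⟨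
    D ℚ.* (r ℚ.- 1ℚ ℚ.+ 1ℚ)          ≡⟨ cong (D ℚ.*_) (trans (ℚ.+-assoc r (ℚ.- 1ℚ) 1ℚ) (ℚ.+-identityʳ r)) ⟩
    D ℚ.* r                          ∎)
    where
    open ℚ.≤-Reasoning
    D : ℚ
    D = + suc d ℚ./ 1
    clear : D ℚ.* (+ suc (suc d) ℚ./ suc d) ≡ 1ℚ ℚ.+ D
    clear = ℚ.toℚᵘ-injective (ℚᵘ.≃-trans (ℚ.toℚᵘ-homo-* D (+ suc (suc d) ℚ./ suc d))
      (ℚᵘ.≃-trans (ℚᵘ.*-cong (toℚᵘ-/ (suc d) 0) (toℚᵘ-/ (suc (suc d)) d))
      (ℚᵘ.≃-trans (*≡* eq) (ℚᵘ.≃-sym (ℚᵘ.≃-trans (ℚ.toℚᵘ-homo-+ 1ℚ D) (ℚᵘ.+-congʳ (toℚᵘ 1ℚ) (toℚᵘ-/ (suc d) 0)))))))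
      where
      eq : ℚᵘ.↥ (mkℚᵘ (+ suc d) 0 ℚᵘ.* mkℚᵘ (+ suc (suc d)) d) ℤ.* ℚᵘ.↧ (mkℚᵘ (+ 1) 0 ℚᵘ.+ mkℚᵘ (+ suc d) 0) ≡
           ℚᵘ.↥ (mkℚᵘ (+ 1) 0 ℚᵘ.+ mkℚᵘ (+ suc d) 0) ℤ.* ℚᵘ.↧ (mkℚᵘ (+ suc d) 0 ℚᵘ.* mkℚᵘ (+ suc (suc d)) d)
      eq = cong +_ (trans (*-identityʳ _) (trans (*-comm (suc d) (suc (suc d)))
        (cong₂ _*_ (cong (λ m → suc (suc m)) (sym (*-identityʳ d))) (sym (+-identityʳ (suc d))))))

  module _ {α : ℝ} (d : ℕ) (α≥ : ∀ r → upper α r → (+ suc (suc d) ℚ./ suc d) ℚ.≤ r) where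

    private
      scaled : ∀ v o v′ o′ → suc d * (v * suc o′) ≤ suc (suc d) * (v′ * suc o) →
        ∀ r → upper α r → (+ v ℚ./ suc o) ℚ.≤ r ℚ.* (+ v′ ℚ./ suc o′)
      scaled v o v′ o′ h r u = ℚ.≤-trans (ratio-≤ d v o v′ o′ h)
        (ℚ.*-monoʳ-≤-nonNeg (+ v′ ℚ./ suc o′) {{ℚ.normalize-nonNeg v′ (suc o′)}} (α≥ r u))

      at-most-one : ∀ {v o} → v ≤ suc o → ∀ r → upper α r → (+ v ℚ./ suc o) ℚ.≤ r ℚ.* 1ℚ
      at-most-one {v} {o} h = scaled v o 1 0 (≤-trans (*-mono-≤ (n≤1+n (suc d)) (≤-trans (≤-reflexive (*-identityʳ v)) h))
        (≤-reflexive (cong (suc (suc d) *_) (sym (+-identityʳ (suc o))))))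

    -- The last two hypotheses serve the conventions for a zero optimum. If o = 0, the left ratio is
    -- finite only for v = 0; if v′ = o′ = 0, the right ratio is 1 and the cross-multiplied
    -- inequality says nothing, so v ≤ o has to be given.
    ratio-bound : ∀ v o v′ o′ → suc d * (v * o′) ≤ suc (suc d) * (v′ * o) →
      (o ≡ 0 → o′ ≡ 0 × (v′ ≡ 0 → v ≡ 0)) → (v′ ≡ 0 → o′ ≡ 0 → v ≤ o) → ratio [ v ] [ o ] ≤ α · ratio [ v′ ] [ o′ ]
    ratio-bound v o       (suc v′) zero     _ _ _ = tt
    ratio-bound v zero    v′       (suc o′) _ z _ with proj₁ (z refl)
    ... | ()
    ratio-bound zero    zero zero zero _ _ _ = at-most-one {1} {0} ≤-refl
    ratio-bound (suc v) zero zero zero _ z _ with proj₂ (z refl) refl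
    ... | ()
    ratio-bound zero    (suc o) zero zero _ _ b = at-most-one (b refl refl)
    ratio-bound (suc v) (suc o) zero zero _ _ b = at-most-one (b refl refl)
    ratio-bound zero    (suc o) zero     (suc o′) h _ _ = scaled zero o zero o′ h
    ratio-bound zero    (suc o) (suc v′) (suc o′) h _ _ = scaled zero o (suc v′) o′ h
    ratio-bound (suc v) (suc o) zero     (suc o′) h _ _ = scaled (suc v) o zero o′ h
    ratio-bound (suc v) (suc o) (suc v′) (suc o′) h _ _ = scaled (suc v) o (suc v′) o′ h

  module _ {ε : ℝ} {d : ℕ} (ceil : suc d ≡⌈1/ ε ⌉) (I : CCInstance) where

    open ParamMinProblem CliqueContraction using (IsOPT; HasValue)
    open CCInstance

    approximates : (S′ : EdgeSet (graph (reduce (suc d) I))) → ∀ {v o v′ o′} →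
      HasValue I (lift (suc d) I S′) v → IsOPT I o →
      HasValue (reduce (suc d) I) S′ v′ → IsOPT (reduce (suc d) I) o′ → ratio v o ≤ 1+ ε · ratio v′ o′
    approximates S′ {o = ⊤⁺} _ opt _ _ = ⊥-elim (opt-finite {suc d} {I} {I} opt)
    approximates S′ {o′ = ⊤⁺} _ _ _ opt′ = ⊥-elim (opt-finite {suc d} {I} {reduce (suc d) I} opt′)
    approximates S′ {o = [ o ]} {o′ = [ o′ ]} _ opt (not-clique _) opt′ = tt
    approximates S′ (not-clique ¬c) opt (clique c′) opt′ = ⊥-elim (¬c (lift-clique {suc d} {I} S′ c′))
    approximates S′ {o = [ o ]} {o′ = [ o′ ]} (clique c) opt (clique c′) opt′ =
      ratio-bound {1+ ε} d (λ r u → 1+1/d≤ d r (proj₁ ceil (r ℚ.- 1ℚ) u)) v o v′ o′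
        (proj₁ bounds) (proj₁ (proj₂ bounds)) (proj₂ (proj₂ bounds))
      where
      v v′ : ℕ
      v = ∣ lift (suc d) I S′ ∣ᵉ ⊓ suc (k I)
      v′ = ∣ S′ ∣ᵉ ⊓ suc (k I)
      o′≤v′ : o′ ≤ v′
      o′≤v′ = opt≤ {suc d} {I} opt′ S′ c′
      bounds : suc d * (v * o′) ≤ suc (suc d) * (v′ * o) × (o ≡ 0 → o′ ≡ 0 × (v′ ≡ 0 → v ≡ 0)) × (v′ ≡ 0 → o′ ≡ 0 → v ≤ o)
      bounds with T? (Kernel.infeasible (inputOf (suc d) I))
      -- The value 1 separates the two ratios: v ≤ o because o = k + 1 is the cap, and o′ ≤ v′
      -- because o′ is optimal.
      ... | yes bad = *-mono-≤ (n≤1+n (suc d)) (≤-trans (≤-reflexive (*-comm v o′)) (*-mono-≤ o′≤v′ v≤o))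
                    , (λ o≡0 → ⊥-elim (0≢1+n (trans (sym o≡0) o≡)))
                    , λ _ _ → v≤o
        where
        o≡ : o ≡ suc (k I)
        o≡ = infeasible-opt {suc d} {I} bad opt
        v≤o : v ≤ o
        v≤o = ≤-trans (m⊓n≤n _ (suc (k I))) (≤-reflexive (sym o≡))
      ... | no ok = (begin
          suc d * (v * o′)          ≡⟨ *-assoc (suc d) v o′ ⟨
          suc d * v * o′            ≤⟨ *-mono-≤ dv≤ o′≤o ⟩
          suc (suc d) * v′ * o      ≡⟨ *-assoc (suc (suc d)) v′ o ⟩
          suc (suc d) * (v′ * o)    ∎)
        , (λ o≡0 → n≤0⇒n≡0 (≤-trans o′≤o (≤-reflexive o≡0)) , v≡0)
        , λ v′≡0 _ → ≤-trans (≤-reflexive (v≡0 v′≡0)) z≤n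
        where
        open ≤-Reasoning
        o′≤o : o′ ≤ o
        o′≤o = opt′≤opt {suc d} {I} opt opt′
        dv≤ : suc d * v ≤ suc (suc d) * v′
        dv≤ = lift-value {suc d} {I} S′ c′ ok
        v≡0 : v′ ≡ 0 → v ≡ 0
        v≡0 v′≡0 = n≤0⇒n≡0 (≤-trans (m≤n*m v (suc d)) (≤-trans dv≤
          (≤-reflexive (trans (cong (suc (suc d) *_) v′≡0) (*-zeroʳ (suc (suc d)))))))

-- Assembly: programs for fixed d, size of the kernel and the theorem

open import Data.Integer.Base as ℤ using (+_)
import Data.Integer.Properties as ℤ
open import Data.Rational.Base as ℚ using (ℚ; 0ℚ; 1ℚ)
import Data.Rational.Properties as ℚ
open import Data.Rational.Unnormalised.Base as ℚᵘ using (*≤*)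
open import Relation.Nullary.Construct.Add.Supremum using ([_])
open Algorithm
open Counting
open GraphTheory
open Deletion
open Reduction
open LiftedSolutions
open Instances
open Ratios
open Programs
open ListPrograms using (size-encodeℕ; listᴱ-tabulate; ⊨-length)
open VertexPrograms
open ReductionProgram hiding (length-cons-all)
open LiftingProgram

open CCInstance
relᴱ-encodeGraph : ∀ {n} (G : Graph n) → encodeGraph G ≡ relᴱ (adj G)
relᴱ-encodeGraph {n} G = trans (cong encodeList (List.tabulate-cong (λ u → sym (listᴱ-tabulate (encodeBool ∘ adj G u) id))))
  (sym (listᴱ-tabulate (λ u → setᴱ (adj G u)) id))

encodeInstance : CCInstance → Tree
encodeInstance I = node (encodeGraph (graph I)) (encodeℕ (k I))

base-inputOf : {Γ : Set} {e : Γ → Tree} (d : Γ → ℕ) (I : Γ → CCInstance) → e ⊨ (λ γ → encodeℕ (d γ)) →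
  e ⊨ (λ γ → encodeInstance (I γ)) → Base e (λ γ → inputOf (d γ) (I γ))
base-inputOf {e = e} d I dᴾ Iᴾ = record
  -- The rows of the adjacency matrix are used merely as a list of length n, from which
  -- `⊨-trichotomy` builds the vertex vectors and the order.
  { verticesᴾ = ⊨-cong (λ γ → trans (cong (λ m → relᴱ {m} _==_) (List.length-tabulate id))
                         (cong encodeList (List.map-cong (λ u → sym (unit≡ u)) (allFin (order (I γ))))))
                  (⊨-trichotomy true false false rows)
  ; orderᴾ    = ⊨-cong (λ γ → cong (λ m → relᴱ {m} (λ u v → v ≺ u)) (List.length-tabulate {n = order (I γ)} id))
                  (⊨-trichotomy false false true rows)
  ; edgeᴾ     = rows
  ; kᴾ        = ⊨-snd {a = λ γ → encodeGraph (graph (I γ))} Iᴾ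
  ; dᴾ        = dᴾ
  }
  where
  rows : e ⊨ (λ γ → relᴱ (adj (graph (I γ))))
  rows = ⊨-cong (λ γ → relᴱ-encodeGraph (graph (I γ))) (⊨-fst {b = λ γ → encodeℕ (k (I γ))} Iᴾ)

opaque
  ⊨-reduce : (λ ((d , I) : ℕ × CCInstance) → node (encodeℕ d) (encodeInstance I)) ⊨ (λ (d , I) → encodeInstance (reduce d I))
  ⊨-reduce = ⊨-node (⊨-cong (λ (d , I) → encode-induced (graph I) (Kernel.kept (inputOf d I))) (⊨-induced B)) (kᴾ B)
    where
    open Base
    B : Base (λ ((d , I) : ℕ × CCInstance) → node (encodeℕ d) (encodeInstance I)) (λ (d , I) → inputOf d I)
    B = base-inputOf proj₁ proj₂ ⊨-hd ⊨-tl
    map-lookup : ∀ {A : Set} (a : A → Tree) (l : List A) → listᴱ a l ≡ encodeList (tabulate (a ∘ lookup l))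
    map-lookup a l = trans (cong (listᴱ a) (sym (List.tabulate-lookup l))) (listᴱ-tabulate a (lookup l))
    encode-induced : ∀ {n} (G : Graph n) (l : List (Fin n)) →
      listᴱ (λ u → listᴱ (λ v → encodeBool (adj G u v)) l) l ≡ encodeGraph (induced G (lookup l))
    encode-induced G l = trans (map-lookup _ l) (cong encodeList (List.tabulate-cong λ i → map-lookup (λ v → encodeBool (adj G (lookup l i) v)) l))

LiftIndex : Set
LiftIndex = Σ ℕ λ d → Σ CCInstance λ I → EdgeSet (graph (reduce d I))

liftEnv : LiftIndex → Tree
liftEnv (d , I , S′) = node (encodeℕ d) (node (encodeInstance I) (node (encodeInstance (reduce d I)) (encodeGraph (subgraph S′))))

opaque
  ⊨-lift : liftEnv ⊨ (λ (d , I , S′) → encodeGraph (subgraph (lift d I S′)))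
  ⊨-lift = ⊨-cong (λ (d , I , S′) → sym (relᴱ-encodeGraph (subgraph (lift d I S′)))) (⊨-lifted {F′ = λ (_ , _ , S′) → adj (subgraph S′)} B)
    where
    B : LiftBase liftEnv (λ (d , I , _) → inputOf d I) (λ (_ , _ , S′) → adj (subgraph S′))
    B = record
      { base      = base-inputOf proj₁ (λ (_ , I , _) → I) ⊨-hd (⊨-tl ⨟ ⊨-hd)
      ; solutionᴾ = ⊨-cong (λ (_ , _ , S′) → relᴱ-encodeGraph (subgraph S′)) (⊨-tl ⨟ ⊨-tl ⨟ ⊨-tl)
      }

constᵖ : ℕ → Prog
constᵖ zero    = nilᵖ
constᵖ (suc d) = consᵖ nilᵖ (constᵖ d)

const-runs : ∀ d x → constᵖ d ⊢ x ⇓ encodeℕ d within (suc (d + d) * size x)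
const-runs zero    x = _ , ⇓nil , ≤-reflexive (sym (+-identityʳ (size x)))
const-runs (suc d) x = let (_ , r , r≤) = const-runs d x in _ , ⇓cons ⇓nil r , (begin
  size x + size x + _                        ≤⟨ +-monoʳ-≤ (size x + size x) r≤ ⟩
  size x + size x + suc (d + d) * size x     ≡⟨ +-assoc (size x) (size x) _ ⟩
  size x + (size x + suc (d + d) * size x)   ≡⟨ cong (λ m → suc m * size x) (sym (+-suc (suc d) d)) ⟩
  suc (suc d + suc d) * size x               ∎)
  where open ≤-Reasoning

-- With d supplied by the program instead of the input, only the constant factor depends on d.
supplied : Prog → ℕ → Prog
supplied p d = consᵖ (constᵖ d) idᵖ ⨾ p

suppliedConstant : ℕ → ℕ → ℕ
suppliedConstant d c = (suc (d + d) + 2) + (suc (suc (d + d)) + 2) ^ c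

-- Writing d takes time linear in `size x` with a factor depending on d. Requiring c to exceed the
-- degree makes c positive, so that this linear term is absorbed by `size x ^ c`.
supplied-runs : ∀ {Γ : Set} {e o : Γ → Tree} (f : e ⊨ o) (d : ℕ) (x : Tree) (γ : Γ) → e γ ≡ node (encodeℕ d) x →
  ∀ {c} → suc (degree (poly f)) ≤ c → supplied (prog f) d ⊢ x ⇓ o γ within (suppliedConstant d c * size x ^ c)
supplied-runs {e = e} {o} f d x γ eq {c} deg<c =
  let (_ , r , r≤) = const-runs d x
      (t , s , s≤) = runs f γ
  in _ , ⇓seq (⇓cons r ⇓id) (subst (λ y → prog f ⊢ y ⇓ o γ [ t ]) eq s) , (begin
    size x + _ + size x + t                        ≤⟨ +-mono-≤ (+-monoˡ-≤ (size x) (+-monoʳ-≤ (size x) r≤)) (≤-trans s≤ (bounded (poly f) γ)) ⟩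
    size x + A * size x + size x + suc (size (e γ)) ^ degree (poly f) ≤⟨ +-mono-≤ (≤-reflexive linear) power ⟩
    (A + 2) * size x + (suc A + 2) ^ c * size x ^ c ≤⟨ +-monoˡ-≤ _ (*-monoʳ-≤ (A + 2) x≤x^c) ⟩
    (A + 2) * size x ^ c + (suc A + 2) ^ c * size x ^ c ≡⟨ *-distribʳ-+ (size x ^ c) (A + 2) ((suc A + 2) ^ c) ⟨
    suppliedConstant d c * size x ^ c              ∎)
  where
  open ≤-Reasoning
  A : ℕ
  A = suc (d + d)
  instance
    size≢0 : NonZero (size x)
    size≢0 = >-nonZero (size-pos x)
  linear : size x + A * size x + size x ≡ (A + 2) * size x
  linear = trans (+-comm (size x + A * size x) (size x)) (cong (_* size x) (+-comm 2 A))
  x≤x^c : size x ≤ size x ^ c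
  x≤x^c = subst (_≤ size x ^ c) (*-identityʳ (size x)) (^-monoʳ-≤ (size x) {1} {c} (≤-trans (s≤s z≤n) deg<c))
  env≤ : suc (size (e γ)) ≤ (suc A + 2) * size x
  env≤ = begin
    suc (size (e γ))                  ≡⟨ cong (suc ∘ size) eq ⟩
    suc (suc (size (encodeℕ d) + size x)) ≡⟨ cong (λ m → suc (suc (m + size x))) (size-encodeℕ d) ⟩
    2 + (A + size x)                  ≡⟨ sym (+-assoc 2 A (size x)) ⟩
    (2 + A) + size x                  ≤⟨ +-monoˡ-≤ (size x) (m≤m*n (2 + A) (size x)) ⟩
    (2 + A) * size x + size x         ≡⟨ +-comm ((2 + A) * size x) (size x) ⟩
    suc (2 + A) * size x              ≡⟨ cong (λ m → suc m * size x) (+-comm 2 A) ⟩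
    (suc A + 2) * size x              ∎
  power : suc (size (e γ)) ^ degree (poly f) ≤ (suc A + 2) ^ c * size x ^ c
  power = begin
    suc (size (e γ)) ^ degree (poly f)  ≤⟨ ^-monoʳ-≤ (suc (size (e γ))) (≤-trans (n≤1+n _) deg<c) ⟩
    suc (size (e γ)) ^ c                ≤⟨ ^-monoˡ-≤ c env≤ ⟩
    ((suc A + 2) * size x) ^ c          ≡⟨ ^-distribʳ-* c (suc A + 2) (size x) ⟩
    (suc A + 2) ^ c * size x ^ c        ∎

-- The calculus of `Poly` is applied to the encoding of k alone. There the base 1 +
-- `size (encodeℕ k)` equals 2(k + 1), whence the constant `2 ^ degree P`.
kernel-poly : ∀ C e → ∃[ B ] ∃[ c ] (∀ k m → m ≤ C * k ^ e → suc (suc (m * suc (suc (m * 4))) + suc (k + k)) + k ≤ B * suc k ^ c)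
kernel-poly C e = 2 ^ degree P , degree P , λ k m m≤ → (begin
  suc (suc (m * suc (suc (m * 4))) + suc (k + k)) + k
    ≤⟨ +-monoˡ-≤ k (s≤s (s≤s (+-monoˡ-≤ (suc (k + k)) (*-mono-≤ m≤ (s≤s (s≤s (*-monoˡ-≤ 4 m≤))))))) ⟩
  suc (suc (M k * suc (suc (M k * 4))) + suc (k + k)) + k   ≤⟨ bounded P k ⟩
  suc (size (encodeℕ k)) ^ degree P                        ≡⟨ cong (λ z → suc z ^ degree P) (size-encodeℕ k) ⟩
  (2 + (k + k)) ^ degree P                                 ≡⟨ cong (_^ degree P) (twice k) ⟩
  (2 * suc k) ^ degree P                                   ≡⟨ ^-distribʳ-* (degree P) 2 (suc k) ⟩
  2 ^ degree P * suc k ^ degree P                          ∎)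
  where
  open ≤-Reasoning
  M : ℕ → ℕ
  M k = C * k ^ e
  pk : Poly encodeℕ id
  pk = poly-≤ (λ k → ≤-trans (m≤n⇒m≤1+n (m≤m+n k k)) (≤-reflexive (sym (size-encodeℕ k)))) poly-size
  pM : Poly encodeℕ M
  pM = poly-* (poly-const C) (poly-^ e pk)
  P : Poly encodeℕ (λ k → suc (suc (M k * suc (suc (M k * 4))) + suc (k + k)) + k)
  P = poly-+ (poly-suc (poly-+ (poly-suc (poly-* pM (poly-suc (poly-suc (poly-* pM (poly-const 4)))))) (poly-suc (poly-+ pk pk)))) pk
  twice : ∀ k → 2 + (k + k) ≡ 2 * suc k
  twice k = cong suc (trans (sym (+-suc k k)) (cong (λ z → k + suc z) (sym (+-identityʳ k))))

size-encodeInstance : ∀ I → size (encodeInstance I) ≤ suc (suc (order I * suc (suc (order I * 4))) + suc (k I + k I))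
size-encodeInstance I = s≤s (+-mono-≤ (≤-trans (≤-reflexive (cong size (relᴱ-encodeGraph (graph I)))) (size-relᴱ (adj (graph I))))
  (≤-reflexive (size-encodeℕ (k I))))

1≰0 : ¬ (1ℚ ℚ.≤ 0ℚ)
1≰0 (ℚ.*≤* (ℤ.+≤+ ()))

⌈1/⌉≢0 : ∀ {ε} → ¬ (0 ≡⌈1/ ε ⌉)
⌈1/⌉≢0 (1≤0 , r , r∈ , _) = 1≰0 (subst (1ℚ ℚ.≤_) (ℚ.*-zeroˡ r) (1≤0 r r∈))

-- This is the exponent that does not depend on ε: both degrees belong to programs for which d is
-- still an input. The sum dominates each of them, and the successor meets the strictness in
-- `supplied-runs`.
timeDegree : ℕ
timeDegree = suc (degree (poly ⊨-reduce) + degree (poly ⊨-lift))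

kernel : ∀ {x d} → suc d ≡⌈1/ x ⌉ → PolynomialApproxKernel CliqueContraction (1+ x) timeDegree
kernel {x} {d} ceil = record
  { preprocessing = record
    { reduceProg   = supplied (prog ⊨-reduce) (suc d)
    ; liftProg     = supplied (prog ⊨-lift) (suc d)
    ; reduce       = reduce (suc d)
    ; lift         = lift (suc d)
    ; C            = suppliedConstant (suc d) timeDegree
    ; reduce-runs  = λ I → supplied-runs ⊨-reduce (suc d) (encodeInstance I) (suc d , I) refl
                       (s≤s (m≤m+n (degree (poly ⊨-reduce)) (degree (poly ⊨-lift))))
    ; lift-runs    = λ I S′ → supplied-runs ⊨-lift (suc d) _ (suc d , I , S′) refl
                       (s≤s (m≤n+m (degree (poly ⊨-lift)) (degree (poly ⊨-reduce))))
    ; approximates = approximates {x} {d} ceil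
    }
  ; B = proj₁ small
  ; e = proj₁ (proj₂ small)
  ; size-poly = λ I → ≤-trans (+-monoˡ-≤ (k I) (size-encodeInstance (reduce (suc d) I)))
      (proj₂ (proj₂ small) (k I) (order (reduce (suc d) I)) (order-reduce (suc d) I _))
  }
  where
  small : ∃[ B ] ∃[ c ] (∀ k m → m ≤ 4 * 3 ^ suc (suc d) * k ^ suc (suc d) →
    suc (suc (m * suc (suc (m * 4))) + suc (k + k)) + k ≤ B * suc k ^ c)
  small = kernel-poly (4 * 3 ^ suc (suc d)) (suc (suc d))

theorem1p1 : ∃[ c ] ((ε : ℝ) → Positive ε → (d : ℕ) → d ≡⌈1/ ε ⌉ →
    Σ[ K ∈ PolynomialApproxKernel CliqueContraction (1+ ε) c ]
    ∃[ C ] ((I : CCInstance) →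
    CCInstance.order (PolynomialApproxKernel.reduce K I)
    ≤ C * CCInstance.k I ^ suc d))
theorem1p1 = timeDegree , λ
  { x _ zero    ceil → ⊥-elim (⌈1/⌉≢0 {x} ceil)
  ; x _ (suc d) ceil → kernel {x} {d} ceil , 4 * 3 ^ suc (suc d) , λ I → order-reduce (suc d) I _
  }
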